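{- Let $H_1$ be the complex reflection group of order $96$ (Shephard–Todd group No. 8), and let $K_1,K_3,K_4,K_8,K_9$ be representatives of the five conjugacy classes of subgroups $K\le H_1$ for which the transitive permutation representation of $H_1$ on $K\backslash H_1$ is faithful, with $|K_1|=1$, $|K_3|=2$, $|K_4|=3$, $|K_8|=|K_9|=4$. For $i\in\{1,3,4,8,9\}$ let $\theta_i$ be the permutation character of $H_1$ on $K_i\backslash H_1$ (so the degrees are $96,48,32,24,24$ respectively), and for an integer $k\ge 1$ let $\mathfrak{A}_{\theta_i}^{(k)}$ be the centralizer ring of the $k$-th tensor power of this permutation representation. Then for every $k\ge 1$ the following isomorphisms of $\mathbb{C}$-algebras hold. (1) $\mathfrak{A}_{\theta_1}^{(k)}\cong 4M_{a_k}\oplus 6M_{e_k}\oplus 4M_{l_k}\oplus 2M_{p_k}$, where $a_k=96^{k-1}$, $e_k=\frac{96^k}{48}$, $l_k=\frac{96^k}{32}$, $p_k=\frac{96^k}{24}$. (2) $\mathfrak{A}_{\theta_3}^{(k)}\cong 2M_{a_k}\oplus 2M_{c_k}\oplus M_{e_k}\oplus M_{f_k}\oplus 4M_{g_k}\oplus 2M_{l_k}\oplus 2M_{n_k}\oplus 2M_{p_k}$, where $a_k=\frac{48^{k-1}}{2}+\frac{8^{k-1}}{2}$, $c_k=\frac{48^{k-1}}{2}-\frac{8^{k-1}}{2}$, $e_k=48^{k-1}+8^{k-1}$, $f_k=48^{k-1}-8^{k-1}$, $g_k=48^{k-1}$, $l_k=\frac{48^k}{32}-\frac{8^{k-1}}{2}$,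 $n_k=\frac{48^k}{32}+\frac{8^{k-1}}{2}$, $p_k=\frac{48^k}{24}$. (3) $\mathfrak{A}_{\theta_4}^{(k)}\cong 4M_{a_k}\oplus 6M_{e_k}\oplus 4M_{l_k}\oplus 2M_{p_k}$, where $a_k=\frac{32^{k-1}}{3}+\frac{8^k}{12}$, $e_k=\frac{32^k}{48}-\frac{8^k}{12}$, $l_k=32^{k-1}$, $p_k=\frac{32^k}{24}+\frac{8^k}{12}$. (4) For each $i\in\{8,9\}$, $\mathfrak{A}_{\theta_i}^{(k)}\cong M_{a_k}\oplus 3M_{b_k}\oplus M_{e_k}\oplus 3M_{f_k}\oplus 2M_{e_k}\oplus M_{l_k}\oplus 3M_{m_k}\oplus 2M_{p_k}$, where $a_k=\frac{24^{k-1}}{4}+3\cdot 4^{k-2}$, $b_k=\frac{24^{k-1}}{4}-4^{k-2}$, $e_k=\frac{24^{k-1}}{2}+\frac{4^{k-1}}{2}$, $f_k=\frac{24^{k-1}}{2}-\frac{4^{k-1}}{2}$, $l_k=\frac{24^k}{32}-3\cdot 4^{k-2}$, $m_k=\frac{24^k}{32}+4^{k-2}$, $p_k=24^{k-1}$.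
   Context: The group $H_1$ is the primitive complex reflection group of order $96$, No. 8 in the Shephard–Todd list; concretely, $H_1=\langle T,D\rangle\le GL(2,\mathbb{C})$ with $T=\frac{1+i}{2}\begin{pmatrix}1&1\\1&-1\end{pmatrix}$ and $D=\begin{pmatrix}1&0\\0&i\end{pmatrix}$, where $i=\sqrt{ -1}$. For a subgroup $K\le H_1$, the permutation representation of $H_1$ with respect to $K$ is the action of $H_1$ by right multiplication on the set of right cosets $K\backslash H_1$, $Kg\mapsto Kga$, regarded as a complex matrix representation by permutation matrices of degree $|H_1|/|K|$. It is faithful if the homomorphism $H_1\to \mathrm{Sym}(K\backslash H_1)$ is injective. Two such representations are equivalent if and only if the subgroups are conjugate. $H_1$ has $24$ conjugacy classes of subgroups, of which exactly five give faithful representations; these have orders $1,2,3,4,4$, and the two of order $4$ are not conjugate to each other. If $V$ is the $\mathbb{C}$-space of a representation of $H_1$, the centralizer ring of its $k$-th tensor power is $\mathrm{End}_{H_1}(V^{\otimes k})$, the algebra of all $\mathbb{C}$-linear endomorphisms of $V^{\otimes k}$ commuting with the diagonal action of $H_1$. $M_d$ denotes the full matrix algebra of degree $d$ over $\mathbb{C}$ (with $M_0=0$), and $nM_d$ denotes the direct sum of $n$ copies of $M_d$. -}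

module Defs where

open import Level using (0ℓ)
open import Algebra.Bundles using (Group; Monoid; Ring; CommutativeRing)
open import Algebra.Module.Bundles.Raw using (RawLeftModule)
import Algebra.Construct.DirectProduct as DirectProduct
import Algebra.Construct.Pointwise as Pointwise
import Algebra.Module.Morphism.Structures as ModuleMorphisms
import Algebra.Morphism.Structures as Morphisms
import Algebra.Properties.Group as GroupProperties
import Algebra.Properties.Semiring.Sum as SemiringSum
open import Data.Bool.Base using (if_then_else_)
open import Data.Fin.Base using (Fin; zero; suc; quotient; remainder)
open import Data.Fin.Properties using () renaming (_≟_ to _≟ᶠ_)
open import Data.Integer.Base as ℤ using (ℤ; +_; -[1+_])
open import Data.Nat.Base as ℕ using (ℕ; zero; suc; NonZero)
import Data.Nat.Properties as ℕₚ
open import Data.Product.Base using (Σ; ∃; _×_; _,_; proj₁; proj₂)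
open import Data.Rational.Base as ℚ using (ℚ; 0ℚ; 1ℚ; ½; ∣_∣)
import Data.Rational.Properties as ℚₚ
open import Data.Rational.Solver using (module +-*-Solver)
open import Data.Sum.Base using (_⊎_; inj₁; inj₂)
open import Data.Vec.Functional using (Vector; _∷_; [])
open import Function.Base using (id; _∘_)
open import Function.Bundles using (Inverse; _⇔_)
open import Relation.Binary.Bundles using (Setoid)
open import Relation.Binary.Definitions using (_Respects_)
open import Relation.Binary.PropositionalEquality using (_≡_; refl; sym; trans; cong; subst; subst₂)
import Relation.Binary.PropositionalEquality as ≡
import Relation.Binary.Reasoning.Setoid as SetoidReasoning
open import Relation.Nullary.Decidable.Core using (does)
open import Relation.Unary using (Pred; _∈_)

record Vanishing {I : Set} (h : I → ℕ) (f : I → ℚ) : Set where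
  constructor mkVanishing
  field
    eventually : ∀ ε → 0ℚ ℚ.< ε → ∃ λ N → ∀ i → N ℕ.≤ h i → ∣ f i ∣ ℚ.< ε

open Vanishing public

-- N ≤ m ⊓ n says that both indices are at least N.
Cauchy : (ℕ → ℚ) → Set
Cauchy x = Vanishing {ℕ × ℕ} (λ (m , n) → m ℕ.⊓ n) (λ (m , n) → x m ℚ.- x n)

-- A real number, up to _≈ℝ_.
record ℝ : Set where
  constructor mkℝ
  field
    seq    : ℕ → ℚ
    cauchy : Cauchy seq

open ℝ public

record _≈ℝ_ (x y : ℝ) : Set where
  constructor mk≈ℝ
  field
    vanishing : Vanishing id (λ n → seq x n ℚ.- seq y n)

open _≈ℝ_ public

record Bounded {I : Set} (h : I → ℕ) (b : I → ℚ) : Set where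
  constructor mkBounded
  field
    bound        : ℚ
    positive     : ℚ.Positive bound
    from         : ℕ
    ∣b∣≤bound    : ∀ i → from ℕ.≤ h i → ∣ b i ∣ ℚ.≤ bound

private
  open +-*-Solver using (solve; con; _:+_; _:*_; _:-_; :-_; _:=_)

  module _ {I : Set} {h : I → ℕ} where

    vanishing-≗ : ∀ {f g} → Vanishing h f → (∀ i → f i ≡ g i) → Vanishing h g
    vanishing-≗ v f≗g .eventually ε ε>0 =
      let N , p = eventually v ε ε>0 in
      N , λ i N≤i → subst (λ q → ∣ q ∣ ℚ.< ε) (f≗g i) (p i N≤i)

    vanishing-0 : Vanishing h (λ _ → 0ℚ)
    vanishing-0 .eventually ε ε>0 = 0 , λ _ _ → ε>0

    half-pos : ∀ {ε} → 0ℚ ℚ.< ε → 0ℚ ℚ.< ε ℚ.* ½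
    half-pos {ε} ε>0 =
      subst (ℚ._< ε ℚ.* ½) (ℚₚ.*-zeroˡ ½) (ℚₚ.*-monoˡ-<-pos ½ ε>0)

    halves : ∀ ε → ε ℚ.* ½ ℚ.+ ε ℚ.* ½ ≡ ε
    halves ε = trans (sym (ℚₚ.*-distribˡ-+ ε ½ ½)) (ℚₚ.*-identityʳ ε)

    vanishing-+ : ∀ {f g} → Vanishing h f → Vanishing h g →
                  Vanishing h (λ i → f i ℚ.+ g i)
    vanishing-+ {f} {g} u v .eventually ε ε>0 =
      let M , p = eventually u (ε ℚ.* ½) (half-pos ε>0)
          N , q = eventually v (ε ℚ.* ½) (half-pos ε>0)
      in M ℕ.⊔ N , λ i M⊔N≤i →
      ℚₚ.≤-<-trans (ℚₚ.∣p+q∣≤∣p∣+∣q∣ (f i) (g i))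
        (subst (∣ f i ∣ ℚ.+ ∣ g i ∣ ℚ.<_) (halves ε)
          (ℚₚ.+-mono-< (p i (ℕₚ.≤-trans (ℕₚ.m≤m⊔n M N) M⊔N≤i))
                       (q i (ℕₚ.≤-trans (ℕₚ.m≤n⊔m M N) M⊔N≤i))))

    vanishing-neg : ∀ {f} → Vanishing h f → Vanishing h (λ i → ℚ.- f i)
    vanishing-neg {f} v .eventually ε ε>0 =
      let N , p = eventually v ε ε>0 in
      N , λ i N≤i →
      subst (ℚ._< ε) (sym (ℚₚ.∣-p∣≡∣p∣ (f i))) (p i N≤i)

    vanishing-* : ∀ {b f} → Bounded h b → Vanishing h f →
                  Vanishing h (λ i → b i ℚ.* f i)
    vanishing-* {b} {f} (mkBounded B B-pos M p) v .eventually ε ε>0 =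
      helper (eventually v (ε ℚ.* B⁻¹) ε/B>0)
      where
      instance
        pos : ℚ.Positive B
        pos = B-pos
        nonZero : ℚ.NonZero B
        nonZero = ℚₚ.pos⇒nonZero B
        nonNeg : ℚ.NonNegative B
        nonNeg = ℚₚ.pos⇒nonNeg B
      B⁻¹ = ℚ.1/ B
      instance
        inv-pos : ℚ.Positive B⁻¹
        inv-pos = ℚₚ.1/pos⇒pos B
      ε/B>0 : 0ℚ ℚ.< ε ℚ.* B⁻¹
      ε/B>0 = subst (ℚ._< ε ℚ.* B⁻¹) (ℚₚ.*-zeroˡ B⁻¹) (ℚₚ.*-monoˡ-<-pos B⁻¹ ε>0)
      cancel : B ℚ.* (ε ℚ.* B⁻¹) ≡ ε
      cancel = trans (solve 3 (λ x y z → x :* (y :* z) := y :* (x :* z)) refl B ε B⁻¹)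
                 (trans (cong (ε ℚ.*_) (ℚₚ.*-inverseʳ B)) (ℚₚ.*-identityʳ ε))
      helper : (∃ λ N → ∀ i → N ℕ.≤ h i → ∣ f i ∣ ℚ.< ε ℚ.* B⁻¹) →
               ∃ λ N → ∀ i → N ℕ.≤ h i → ∣ b i ℚ.* f i ∣ ℚ.< ε
      helper (N , q) = M ℕ.⊔ N , λ i M⊔N≤i →
        subst₂ ℚ._<_ (sym (ℚₚ.∣p*q∣≡∣p∣*∣q∣ (b i) (f i))) cancel
          (ℚₚ.≤-<-trans
            (ℚₚ.*-monoʳ-≤-nonNeg ∣ f i ∣ {{ℚₚ.∣-∣-nonNeg (f i)}}
              (p i (ℕₚ.≤-trans (ℕₚ.m≤m⊔n M N) M⊔N≤i)))
            (ℚₚ.*-monoʳ-<-pos B (q i (ℕₚ.≤-trans (ℕₚ.m≤n⊔m M N) M⊔N≤i))))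

  cauchy-bound : ∀ {x} → Cauchy x → Bounded id x
  cauchy-bound {x} c = mkBounded (1ℚ ℚ.+ ∣ x N ∣) pos N bound′
    where
    close = eventually c 1ℚ (ℚₚ.positive⁻¹ 1ℚ)
    N = proj₁ close
    pos : ℚ.Positive (1ℚ ℚ.+ ∣ x N ∣)
    pos = ℚₚ.pos+nonNeg⇒pos 1ℚ ∣ x N ∣ {{ℚₚ.∣-∣-nonNeg (x N)}}
    bound′ : ∀ n → N ℕ.≤ n → ∣ x n ∣ ℚ.≤ 1ℚ ℚ.+ ∣ x N ∣
    bound′ n N≤n = subst (λ q → ∣ q ∣ ℚ.≤ 1ℚ ℚ.+ ∣ x N ∣)
      (solve 2 (λ a b → (a :- b) :+ b := a) refl (x n) (x N))
      (ℚₚ.≤-trans (ℚₚ.∣p+q∣≤∣p∣+∣q∣ (x n ℚ.- x N) (x N))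
        (ℚₚ.+-monoˡ-≤ ∣ x N ∣
          (ℚₚ.<⇒≤ (proj₂ close (n , N) (ℕₚ.⊓-glb N≤n ℕₚ.≤-refl)))))

  boundedˡ : ∀ {x} → Cauchy x → Bounded {ℕ × ℕ} (λ (m , n) → m ℕ.⊓ n) (λ (m , n) → x m)
  boundedˡ {x} c = let mkBounded B pos N p = cauchy-bound {x} c in
    mkBounded B pos N λ (m , n) N≤ → p m (ℕₚ.≤-trans N≤ (ℕₚ.m⊓n≤m m n))

  boundedʳ : ∀ {x} → Cauchy x → Bounded {ℕ × ℕ} (λ (m , n) → m ℕ.⊓ n) (λ (m , n) → x n)
  boundedʳ {x} c = let mkBounded B pos N p = cauchy-bound {x} c in
    mkBounded B pos N λ (m , n) N≤ → p n (ℕₚ.≤-trans N≤ (ℕₚ.m⊓n≤n m n))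

  abstract
    cauchy-const : ∀ q → Cauchy (λ _ → q)
    cauchy-const q = vanishing-≗
      vanishing-0
      (λ _ → sym (ℚₚ.+-inverseʳ q))

    cauchy-+ : ∀ {x y} → Cauchy x → Cauchy y → Cauchy (λ n → x n ℚ.+ y n)
    cauchy-+ {x} {y} c d = vanishing-≗
      (vanishing-+ c d)
      (λ (m , n) → solve 4 (λ a b a′ b′ → (a :- a′) :+ (b :- b′) := (a :+ b) :- (a′ :+ b′))
                     refl (x m) (y m) (x n) (y n))

    cauchy-neg : ∀ {x} → Cauchy x → Cauchy (λ n → ℚ.- x n)
    cauchy-neg {x} c = vanishing-≗
      (vanishing-neg c)
      (λ (m , n) → solve 2 (λ a a′ → :- (a :- a′) := (:- a) :- (:- a′)) refl (x m) (x n))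

    cauchy-* : ∀ {x y} → Cauchy x → Cauchy y → Cauchy (λ n → x n ℚ.* y n)
    cauchy-* {x} {y} c d = vanishing-≗
      (vanishing-+ (vanishing-* (boundedˡ {x} c) d) (vanishing-* (boundedʳ {y} d) c))
      (λ (m , n) → solve 4 (λ a b a′ b′ →
                       a :* (b :- b′) :+ b′ :* (a :- a′) := a :* b :- a′ :* b′)
                     refl (x m) (y m) (x n) (y n))

infixl 6 _+ℝ_
infixl 7 _*ℝ_
infix  8 -ℝ_
infix  4 _≈ℝ_

fromℚ : ℚ → ℝ
fromℚ q = mkℝ (λ _ → q) (cauchy-const q)

_+ℝ_ _*ℝ_ : ℝ → ℝ → ℝ
-ℝ_ : ℝ → ℝ
x +ℝ y = mkℝ (λ n → seq x n ℚ.+ seq y n) (cauchy-+ {seq x} {seq y} (cauchy x) (cauchy y))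
-ℝ x   = mkℝ (λ n → ℚ.- seq x n) (cauchy-neg {seq x} (cauchy x))
x *ℝ y = mkℝ (λ n → seq x n ℚ.* seq y n) (cauchy-* {seq x} {seq y} (cauchy x) (cauchy y))

abstract
  pointwise⇒≈ℝ : ∀ {x y} → (∀ n → seq x n ≡ seq y n) → x ≈ℝ y
  pointwise⇒≈ℝ {x} {y} x≗y .vanishing = vanishing-≗
      vanishing-0
      (λ n → trans (sym (ℚₚ.+-inverseʳ (seq x n))) (cong (λ q → seq x n ℚ.- q) (x≗y n)))

  ≈ℝ-sym : ∀ {x y} → x ≈ℝ y → y ≈ℝ x
  ≈ℝ-sym {x} {y} p .vanishing = vanishing-≗
      (vanishing-neg (vanishing p))
      (λ n → solve 2 (λ a b → :- (a :- b) := b :- a) refl (seq x n) (seq y n))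

  ≈ℝ-trans : ∀ {x y z} → x ≈ℝ y → y ≈ℝ z → x ≈ℝ z
  ≈ℝ-trans {x} {y} {z} p q .vanishing = vanishing-≗
      (vanishing-+ (vanishing p) (vanishing q))
      (λ n → solve 3 (λ a b c → (a :- b) :+ (b :- c) := a :- c) refl (seq x n) (seq y n) (seq z n))

  +ℝ-cong : ∀ {x x′ y y′} → x ≈ℝ x′ → y ≈ℝ y′ → x +ℝ y ≈ℝ x′ +ℝ y′
  +ℝ-cong {x} {x′} {y} {y′} p q .vanishing = vanishing-≗
      (vanishing-+ (vanishing p) (vanishing q))
      (λ n → solve 4 (λ a b a′ b′ → (a :- a′) :+ (b :- b′) := (a :+ b) :- (a′ :+ b′))
             refl (seq x n) (seq y n) (seq x′ n) (seq y′ n))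

  -ℝ-cong : ∀ {x x′} → x ≈ℝ x′ → -ℝ x ≈ℝ -ℝ x′
  -ℝ-cong {x} {x′} p .vanishing = vanishing-≗
      (vanishing-neg (vanishing p))
      (λ n → solve 2 (λ a a′ → :- (a :- a′) := (:- a) :- (:- a′)) refl (seq x n) (seq x′ n))

  *ℝ-cong : ∀ {x x′ y y′} → x ≈ℝ x′ → y ≈ℝ y′ → x *ℝ y ≈ℝ x′ *ℝ y′
  *ℝ-cong {x} {x′} {y} {y′} p q .vanishing = vanishing-≗
      (vanishing-+ (vanishing-* (cauchy-bound {seq x} (cauchy x)) (vanishing q))
                 (vanishing-* (cauchy-bound {seq y′} (cauchy y′)) (vanishing p)))
      (λ n → solve 4 (λ a b a′ b′ → a :* (b :- b′) :+ b′ :* (a :- a′) := a :* b :- a′ :* b′)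
             refl (seq x n) (seq y n) (seq x′ n) (seq y′ n))

record ℂ : Set where
  constructor _+i_
  field
    re im : ℝ

open ℂ public

infix 4 _≈ℂ_
infix 5 _+i_

record _≈ℂ_ (z w : ℂ) : Set where
  constructor mk≈ℂ
  field
    re≈ : re z ≈ℝ re w
    im≈ : im z ≈ℝ im w

open _≈ℂ_ public

infixl 6 _+ℂ_
infixl 7 _*ℂ_
infix  8 -ℂ_

_+ℂ_ _*ℂ_ : ℂ → ℂ → ℂ
(a +i b) +ℂ (c +i d) = (a +ℝ c) +i (b +ℝ d)
(a +i b) *ℂ (c +i d) = (a *ℝ c +ℝ -ℝ (b *ℝ d)) +i (a *ℝ d +ℝ b *ℝ c)

-ℂ_ : ℂ → ℂ
-ℂ (a +i b) = (-ℝ a) +i (-ℝ b)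

fromℚ² : ℚ → ℚ → ℂ
fromℚ² p q = fromℚ p +i fromℚ q

0ℂ 1ℂ iℂ : ℂ
0ℂ = fromℚ² 0ℚ 0ℚ
1ℂ = fromℚ² 1ℚ 0ℚ
iℂ = fromℚ² 0ℚ 1ℚ

pointwise⇒≈ℂ : ∀ {z w} → (∀ n → seq (re z) n ≡ seq (re w) n) →
               (∀ n → seq (im z) n ≡ seq (im w) n) → z ≈ℂ w
pointwise⇒≈ℂ p q = mk≈ℂ (pointwise⇒≈ℝ p) (pointwise⇒≈ℝ q)

private
  +ℂ-cong : ∀ {z z′ w w′} → z ≈ℂ z′ → w ≈ℂ w′ → z +ℂ w ≈ℂ z′ +ℂ w′
  +ℂ-cong (mk≈ℂ p q) (mk≈ℂ p′ q′) = mk≈ℂ (+ℝ-cong p p′) (+ℝ-cong q q′)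

  *ℂ-cong : ∀ {z z′ w w′} → z ≈ℂ z′ → w ≈ℂ w′ → z *ℂ w ≈ℂ z′ *ℂ w′
  *ℂ-cong (mk≈ℂ p q) (mk≈ℂ p′ q′) = mk≈ℂ
    (+ℝ-cong (*ℝ-cong p p′) (-ℝ-cong (*ℝ-cong q q′)))
    (+ℝ-cong (*ℝ-cong p q′) (*ℝ-cong q p′))

  *ℂ-comm : ∀ z w → z *ℂ w ≈ℂ w *ℂ z
  *ℂ-comm (a +i b) (c +i d) = pointwise⇒≈ℂ
    (λ n → solve 4 (λ a b c d → a :* c :- b :* d := c :* a :- d :* b)
             refl (seq a n) (seq b n) (seq c n) (seq d n))
    (λ n → solve 4 (λ a b c d → a :* d :+ b :* c := c :* b :+ d :* a)
             refl (seq a n) (seq b n) (seq c n) (seq d n))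

  *ℂ-assoc : ∀ z w u → (z *ℂ w) *ℂ u ≈ℂ z *ℂ (w *ℂ u)
  *ℂ-assoc (a +i b) (c +i d) (e +i f) = pointwise⇒≈ℂ
    (λ n → solve 6 (λ a b c d e f →
               (a :* c :- b :* d) :* e :- (a :* d :+ b :* c) :* f :=
               a :* (c :* e :- d :* f) :- b :* (c :* f :+ d :* e))
             refl (seq a n) (seq b n) (seq c n) (seq d n) (seq e n) (seq f n))
    (λ n → solve 6 (λ a b c d e f →
               (a :* c :- b :* d) :* f :+ (a :* d :+ b :* c) :* e :=
               a :* (c :* f :+ d :* e) :+ b :* (c :* e :- d :* f))
             refl (seq a n) (seq b n) (seq c n) (seq d n) (seq e n) (seq f n))

  *ℂ-identityˡ : ∀ z → 1ℂ *ℂ z ≈ℂ z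
  *ℂ-identityˡ (a +i b) = pointwise⇒≈ℂ
    (λ n → solve 2 (λ a b → con 1ℚ :* a :- con 0ℚ :* b := a) refl (seq a n) (seq b n))
    (λ n → solve 2 (λ a b → con 1ℚ :* b :+ con 0ℚ :* a := b) refl (seq a n) (seq b n))

  *ℂ-distribˡ : ∀ z w u → z *ℂ (w +ℂ u) ≈ℂ z *ℂ w +ℂ z *ℂ u
  *ℂ-distribˡ (a +i b) (c +i d) (e +i f) = pointwise⇒≈ℂ
    (λ n → solve 6 (λ a b c d e f →
               a :* (c :+ e) :- b :* (d :+ f) := (a :* c :- b :* d) :+ (a :* e :- b :* f))
             refl (seq a n) (seq b n) (seq c n) (seq d n) (seq e n) (seq f n))
    (λ n → solve 6 (λ a b c d e f →
               a :* (d :+ f) :+ b :* (c :+ e) := (a :* d :+ b :* c) :+ (a :* f :+ b :* e))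
             refl (seq a n) (seq b n) (seq c n) (seq d n) (seq e n) (seq f n))

  ≈ℂ-trans : ∀ {z w u} → z ≈ℂ w → w ≈ℂ u → z ≈ℂ u
  ≈ℂ-trans (mk≈ℂ p q) (mk≈ℂ p′ q′) = mk≈ℂ (≈ℝ-trans p p′) (≈ℝ-trans q q′)

ℂ-commutativeRing : CommutativeRing 0ℓ 0ℓ
ℂ-commutativeRing = record
  { Carrier = ℂ ; _≈_ = _≈ℂ_ ; _+_ = _+ℂ_ ; _*_ = _*ℂ_ ; -_ = -ℂ_ ; 0# = 0ℂ ; 1# = 1ℂ
  ; isCommutativeRing = record
    { isRing = record
      { +-isAbelianGroup = record
        { isGroup = record
          { isMonoid = record
            { isSemigroup = record
              { isMagma = record
                { isEquivalence = record
                  { refl  = pointwise⇒≈ℂ (λ _ → refl) (λ _ → refl)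
                  ; sym   = λ (mk≈ℂ p q) → mk≈ℂ (≈ℝ-sym p) (≈ℝ-sym q)
                  ; trans = ≈ℂ-trans
                  }
                ; ∙-cong = +ℂ-cong
                }
              ; assoc = λ z w u → pointwise⇒≈ℂ
                  (λ n → ℚₚ.+-assoc (seq (re z) n) (seq (re w) n) (seq (re u) n))
                  (λ n → ℚₚ.+-assoc (seq (im z) n) (seq (im w) n) (seq (im u) n))
              }
            ; identity =
                (λ z → pointwise⇒≈ℂ (λ n → ℚₚ.+-identityˡ (seq (re z) n))
                                    (λ n → ℚₚ.+-identityˡ (seq (im z) n))) ,
                (λ z → pointwise⇒≈ℂ (λ n → ℚₚ.+-identityʳ (seq (re z) n))
                                    (λ n → ℚₚ.+-identityʳ (seq (im z) n)))
            }
          ; inverse =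
              (λ z → pointwise⇒≈ℂ (λ n → ℚₚ.+-inverseˡ (seq (re z) n))
                                  (λ n → ℚₚ.+-inverseˡ (seq (im z) n))) ,
              (λ z → pointwise⇒≈ℂ (λ n → ℚₚ.+-inverseʳ (seq (re z) n))
                                  (λ n → ℚₚ.+-inverseʳ (seq (im z) n)))
          ; ⁻¹-cong = λ (mk≈ℂ p q) → mk≈ℂ (-ℝ-cong p) (-ℝ-cong q)
          }
        ; comm = λ z w → pointwise⇒≈ℂ (λ n → ℚₚ.+-comm (seq (re z) n) (seq (re w) n))
                                      (λ n → ℚₚ.+-comm (seq (im z) n) (seq (im w) n))
        }
      ; *-cong = *ℂ-cong
      ; *-assoc = *ℂ-assoc
      ; *-identity = *ℂ-identityˡ , λ z → ≈ℂ-trans (*ℂ-comm z 1ℂ) (*ℂ-identityˡ z)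
      ; distrib = *ℂ-distribˡ , λ z w u → ≈ℂ-trans (*ℂ-comm (w +ℂ u) z)
          (≈ℂ-trans (*ℂ-distribˡ z w u) (+ℂ-cong (*ℂ-comm z w) (*ℂ-comm z u)))
      }
    ; *-comm = *ℂ-comm
    }
  }

private module C where
  open CommutativeRing ℂ-commutativeRing public
  open SemiringSum semiring public

Matrix : ℕ → ℕ → Set
Matrix m n = Fin m → Fin n → ℂ

∑ : ∀ {n} → Vector ℂ n → ℂ
∑ = C.sum

δ : ∀ {n} → Fin n → Fin n → ℂ
δ i j = if does (i ≟ᶠ j) then 1ℂ else 0ℂ

infixl 7 _*ᴹ_ _*ᵛ_

_*ᴹ_ : ∀ {l m n} → Matrix l m → Matrix m n → Matrix l n
(A *ᴹ B) i j = ∑ λ k → A i k *ℂ B k j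

_*ᵛ_ : ∀ {m n} → Matrix m n → Vector ℂ n → Vector ℂ m
(A *ᵛ v) i = ∑ λ k → A i k *ℂ v k

private
  open SetoidReasoning C.setoid

  sum-0 : ∀ {n} (f : Vector ℂ n) → (∀ i → f i ≈ℂ 0ℂ) → ∑ f ≈ℂ 0ℂ
  sum-0 {n} f f≈0 = C.trans (C.sum-cong-≋ f≈0) (C.sum-replicate-zero n)

  δ-sumˡ : ∀ {n} (i : Fin n) (v : Vector ℂ n) → (∑ λ k → δ i k *ℂ v k) ≈ℂ v i
  δ-sumˡ zero v = C.trans
    (C.+-cong (C.*-identityˡ (v zero)) (sum-0 _ λ k → C.zeroˡ (v (suc k))))
    (C.+-identityʳ (v zero))
  δ-sumˡ (suc i) v = C.trans
    (C.+-cong (C.zeroˡ (v zero)) (δ-sumˡ i (v ∘ suc)))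
    (C.+-identityˡ (v (suc i)))

  δ-sumʳ : ∀ {n} (v : Vector ℂ n) (j : Fin n) → (∑ λ k → v k *ℂ δ k j) ≈ℂ v j
  δ-sumʳ v zero = C.trans
    (C.+-cong (C.*-identityʳ (v zero)) (sum-0 _ λ k → C.zeroʳ (v (suc k))))
    (C.+-identityʳ (v zero))
  δ-sumʳ v (suc j) = C.trans
    (C.+-cong (C.zeroʳ (v zero)) (δ-sumʳ (v ∘ suc) j))
    (C.+-identityˡ (v (suc j)))

  *ᴹ-assoc : ∀ {k l m n} (A : Matrix k l) (B : Matrix l m) (D : Matrix m n) →
             ∀ i j → ((A *ᴹ B) *ᴹ D) i j ≈ℂ (A *ᴹ (B *ᴹ D)) i j
  *ᴹ-assoc A B D i j = begin
    (∑ λ b → (∑ λ a → A i a *ℂ B a b) *ℂ D b j)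
      ≈⟨ C.sum-cong-≋ (λ b → C.*-distribʳ-sum (D b j) (λ a → A i a *ℂ B a b)) ⟩
    (∑ λ b → ∑ λ a → A i a *ℂ B a b *ℂ D b j)
      ≈⟨ C.∑-comm (λ b a → A i a *ℂ B a b *ℂ D b j) ⟩
    (∑ λ a → ∑ λ b → A i a *ℂ B a b *ℂ D b j)
      ≈⟨ C.sum-cong-≋ (λ a → C.sum-cong-≋ λ b → C.*-assoc (A i a) (B a b) (D b j)) ⟩
    (∑ λ a → ∑ λ b → A i a *ℂ (B a b *ℂ D b j))
      ≈⟨ C.sum-cong-≋ (λ a → C.*-distribˡ-sum (A i a) (λ b → B a b *ℂ D b j)) ⟨
    (∑ λ a → A i a *ℂ (∑ λ b → B a b *ℂ D b j)) ∎

  *ᵛ-cong : ∀ {m n} (A : Matrix m n) {v w : Vector ℂ n} →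
            (∀ i → v i ≈ℂ w i) → ∀ i → (A *ᵛ v) i ≈ℂ (A *ᵛ w) i
  *ᵛ-cong A v≈w i = C.sum-cong-≋ λ k → C.*-congˡ (v≈w k)

  *ᵛ-+ : ∀ {m n} (A : Matrix m n) (v w : Vector ℂ n) →
         ∀ i → (A *ᵛ (λ k → v k +ℂ w k)) i ≈ℂ (A *ᵛ v) i +ℂ (A *ᵛ w) i
  *ᵛ-+ A v w i = C.trans (C.sum-cong-≋ λ k → C.distribˡ (A i k) (v k) (w k))
    (C.∑-distrib-+ (λ k → A i k *ℂ v k) (λ k → A i k *ℂ w k))

  *ᵛ-scale : ∀ {m n} (A : Matrix m n) (s : ℂ) (v : Vector ℂ n) →
             ∀ i → (A *ᵛ (λ k → s *ℂ v k)) i ≈ℂ s *ℂ (A *ᵛ v) i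
  *ᵛ-scale A s v i = C.trans
    (C.sum-cong-≋ λ k → C.trans (C.sym (C.*-assoc (A i k) s (v k)))
      (C.trans (C.*-congʳ (C.*-comm (A i k) s)) (C.*-assoc s (A i k) (v k))))
    (C.sym (C.*-distribˡ-sum s (λ k → A i k *ℂ v k)))

  *ᵛ-0 : ∀ {m n} (A : Matrix m n) → ∀ i → (A *ᵛ (λ _ → 0ℂ)) i ≈ℂ 0ℂ
  *ᵛ-0 A i = sum-0 _ λ k → C.zeroʳ (A i k)

  open import Algebra.Properties.Ring C.ring using (-‿distribʳ-*; -1*x≈-x)

  *ᵛ-neg : ∀ {m n} (A : Matrix m n) (v : Vector ℂ n) →
           ∀ i → (A *ᵛ (λ k → -ℂ v k)) i ≈ℂ -ℂ (A *ᵛ v) i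
  *ᵛ-neg A v i = C.trans (*ᵛ-cong A (λ k → C.sym (-1*x≈-x (v k))) i)
    (C.trans (*ᵛ-scale A (-ℂ 1ℂ) v i) (-1*x≈-x ((A *ᵛ v) i)))

matrixRing : ℕ → Ring 0ℓ 0ℓ
matrixRing n = record
  { Carrier = Matrix n n
  ; _≈_ = λ A B → ∀ i j → A i j ≈ℂ B i j
  ; _+_ = λ A B i j → A i j +ℂ B i j
  ; _*_ = _*ᴹ_
  ; -_ = λ A i j → -ℂ A i j
  ; 0# = λ _ _ → 0ℂ
  ; 1# = δ
  ; isRing = record
    { +-isAbelianGroup = Pointwise.isAbelianGroup (Fin n)
        (Pointwise.isAbelianGroup (Fin n) C.+-isAbelianGroup)
    ; *-cong = λ A≈A′ B≈B′ i j → C.sum-cong-≋ λ k → C.*-cong (A≈A′ i k) (B≈B′ k j)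
    ; *-assoc = *ᴹ-assoc
    ; *-identity = (λ A i j → δ-sumˡ i (λ k → A k j)) , (λ A i j → δ-sumʳ (A i) j)
    ; distrib =
        (λ A B D i j → *ᵛ-+ A (λ k → B k j) (λ k → D k j) i) ,
        (λ A B D i j → C.trans
          (C.sum-cong-≋ λ k → C.distribʳ (A k j) (B i k) (D i k))
          (C.∑-distrib-+ (λ k → B i k *ℂ A k j) (λ k → D i k *ℂ A k j)))
    }
  }

infixl 7 _⊗_
infixr 8 _^⊗_

-- Kronecker product; the pair (i , i′) is numbered i * n + i′.
_⊗_ : ∀ {l m n o} → Matrix l m → Matrix n o → Matrix (l ℕ.* n) (m ℕ.* o)
_⊗_ {l} {m} {n} {o} A B p q =
  A (quotient {l} n p) (quotient {m} o q) *ℂ B (remainder {l} n p) (remainder {m} o q)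

-- The action on (ℂⁿ)^⊗k, with respect to the basis of pure tensors of basis
-- vectors.
_^⊗_ : ∀ {n} → Matrix n n → (k : ℕ) → Matrix (n ℕ.^ k) (n ℕ.^ k)
A ^⊗ zero  = δ
A ^⊗ suc k = A ⊗ (A ^⊗ k)

record ℂ-Algebra : Set₁ where
  infixr 7 _·_
  field
    ring : Ring 0ℓ 0ℓ
  open Ring ring public
  field
    _·_         : ℂ → Carrier → Carrier
    ·-cong      : ∀ {s t x y} → s ≈ℂ t → x ≈ y → s · x ≈ t · y
    ·-distribˡ  : ∀ s x y → s · (x + y) ≈ s · x + s · y
    ·-distribʳ  : ∀ s t x → (s +ℂ t) · x ≈ s · x + t · x
    ·-assoc     : ∀ s t x → (s *ℂ t) · x ≈ s · (t · x)
    ·-identity  : ∀ x → 1ℂ · x ≈ x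
    ·-*-assocˡ  : ∀ s x y → s · (x * y) ≈ (s · x) * y
    ·-*-assocʳ  : ∀ s x y → s · (x * y) ≈ x * (s · y)

infix 4 _≃_

record _≃_ (A B : ℂ-Algebra) : Set where
  private
    module A = ℂ-Algebra A
    module B = ℂ-Algebra B
  open Morphisms.RingMorphisms A.rawRing B.rawRing using (IsRingIsomorphism)
  field
    ⟦_⟧               : A.Carrier → B.Carrier
    isRingIsomorphism : IsRingIsomorphism ⟦_⟧
    ·-homo            : ∀ s x → ⟦ s A.· x ⟧ B.≈ s B.· ⟦ x ⟧

M : ℕ → ℂ-Algebra
M d = record
  { ring       = matrixRing d
  ; _·_        = λ s A i j → s *ℂ A i j
  ; ·-cong     = λ s≈t A≈B i j → C.*-cong s≈t (A≈B i j)
  ; ·-distribˡ = λ s A B i j → C.distribˡ s (A i j) (B i j)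
  ; ·-distribʳ = λ s t A i j → C.distribʳ (A i j) s t
  ; ·-assoc    = λ s t A i j → C.*-assoc s t (A i j)
  ; ·-identity = λ A i j → C.*-identityˡ (A i j)
  ; ·-*-assocˡ = λ s A B i j → C.trans (C.*-distribˡ-sum s (λ k → A i k *ℂ B k j))
      (C.sum-cong-≋ λ k → C.sym (C.*-assoc s (A i k) (B k j)))
  ; ·-*-assocʳ = λ s A B i j → C.sym (*ᵛ-scale A s (λ k → B k j) i)
  }

infixr 5 _⊕_
infixr 6 _⊠_

_⊕_ : ℂ-Algebra → ℂ-Algebra → ℂ-Algebra
A ⊕ B = record
  { ring       = DirectProduct.ring A.ring B.ring
  ; _·_        = λ s (x , y) → s A.· x , s B.· y
  ; ·-cong     = λ s≈t (p , q) → A.·-cong s≈t p , B.·-cong s≈t q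
  ; ·-distribˡ = λ s (x , y) (x′ , y′) → A.·-distribˡ s x x′ , B.·-distribˡ s y y′
  ; ·-distribʳ = λ s t (x , y) → A.·-distribʳ s t x , B.·-distribʳ s t y
  ; ·-assoc    = λ s t (x , y) → A.·-assoc s t x , B.·-assoc s t y
  ; ·-identity = λ (x , y) → A.·-identity x , B.·-identity y
  ; ·-*-assocˡ = λ s (x , y) (x′ , y′) → A.·-*-assocˡ s x x′ , B.·-*-assocˡ s y y′
  ; ·-*-assocʳ = λ s (x , y) (x′ , y′) → A.·-*-assocʳ s x x′ , B.·-*-assocʳ s y y′
  }
  where
  module A = ℂ-Algebra A
  module B = ℂ-Algebra B

-- The direct sum of n copies of A.
_⊠_ : ℕ → ℂ-Algebra → ℂ-Algebra
n ⊠ A = record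
  { ring       = Pointwise.ring (Fin n) A.ring
  ; _·_        = λ s x c → s A.· x c
  ; ·-cong     = λ s≈t p c → A.·-cong s≈t (p c)
  ; ·-distribˡ = λ s x y c → A.·-distribˡ s (x c) (y c)
  ; ·-distribʳ = λ s t x c → A.·-distribʳ s t (x c)
  ; ·-assoc    = λ s t x c → A.·-assoc s t (x c)
  ; ·-identity = λ x c → A.·-identity (x c)
  ; ·-*-assocˡ = λ s x y c → A.·-*-assocˡ s (x c) (y c)
  ; ·-*-assocʳ = λ s x y c → A.·-*-assocʳ s (x c) (y c)
  }
  where module A = ℂ-Algebra A

ℂ^ : ℕ → RawLeftModule ℂ 0ℓ 0ℓ
ℂ^ n = record
  { Carrierᴹ = Vector ℂ n
  ; _≈ᴹ_ = λ v w → ∀ i → v i ≈ℂ w i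
  ; _+ᴹ_ = λ v w i → v i +ℂ w i
  ; _*ₗ_ = λ s v i → s *ℂ v i
  ; 0ᴹ = λ _ → 0ℂ
  ; -ᴹ_ = λ v i → -ℂ v i
  }

module _ {n : ℕ} {I : Set} (ρ : I → Matrix n n) where

  open RawLeftModule (ℂ^ n)
  open ModuleMorphisms.LeftModuleMorphisms (ℂ^ n) (ℂ^ n)

  record CommutingEndomorphism : Set where
    field
      fun      : Carrierᴹ → Carrierᴹ
      isLinear : IsLeftModuleHomomorphism fun
      commutes : ∀ g v → fun (ρ g *ᵛ v) ≈ᴹ ρ g *ᵛ fun v

    open IsLeftModuleHomomorphism isLinear public

  open CommutingEndomorphism

  private
    mkLinear : ∀ {f : Carrierᴹ → Carrierᴹ} →
               (∀ {v w} → v ≈ᴹ w → f v ≈ᴹ f w) →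
               (∀ v w → f (v +ᴹ w) ≈ᴹ f v +ᴹ f w) →
               f 0ᴹ ≈ᴹ 0ᴹ →
               (∀ v → f (-ᴹ v) ≈ᴹ -ᴹ f v) →
               (∀ s v → f (s *ₗ v) ≈ᴹ s *ₗ f v) →
               IsLeftModuleHomomorphism f
    mkLinear f-cong f-+ f-0 f-neg f-scale = record
      { +ᴹ-isGroupHomomorphism = record
        { isMonoidHomomorphism = record
          { isMagmaHomomorphism = record
            { isRelHomomorphism = record { cong = f-cong }
            ; homo = f-+
            }
          ; ε-homo = f-0
          }
        ; ⁻¹-homo = f-neg
        }
      ; *ₗ-homo = f-scale
      }

    open import Algebra.Properties.AbelianGroup C.+-abelianGroup using (⁻¹-∙-comm; ε⁻¹≈ε)
    open import Algebra.Properties.CommutativeSemigroup C.+-commutativeSemigroup using (interchange)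
    open import Algebra.Properties.CommutativeSemigroup C.*-commutativeSemigroup using (x∙yz≈y∙xz)

    _⊹_ _∘ᴱ_ : CommutingEndomorphism → CommutingEndomorphism → CommutingEndomorphism
    (f ⊹ g) .fun v = fun f v +ᴹ fun g v
    (f ⊹ g) .isLinear = mkLinear
      (λ p i → C.+-cong (⟦⟧-cong f p i) (⟦⟧-cong g p i))
      (λ v w i → C.trans (C.+-cong (+ᴹ-homo f v w i) (+ᴹ-homo g v w i))
        (interchange (fun f v i) (fun f w i) (fun g v i) (fun g w i)))
      (λ i → C.trans (C.+-cong (0ᴹ-homo f i) (0ᴹ-homo g i)) (C.+-identityˡ 0ℂ))
      (λ v i → C.trans (C.+-cong (-ᴹ-homo f v i) (-ᴹ-homo g v i))
        (⁻¹-∙-comm (fun f v i) (fun g v i)))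
      (λ s v i → C.trans (C.+-cong (*ₗ-homo f s v i) (*ₗ-homo g s v i))
        (C.sym (C.distribˡ s (fun f v i) (fun g v i))))
    (f ⊹ g) .commutes a v i = C.trans (C.+-cong (commutes f a v i) (commutes g a v i))
      (C.sym (*ᵛ-+ (ρ a) (fun f v) (fun g v) i))

    (f ∘ᴱ g) .fun = fun f ∘ fun g
    (f ∘ᴱ g) .isLinear = mkLinear
      (λ p → ⟦⟧-cong f (⟦⟧-cong g p))
      (λ v w i → C.trans (⟦⟧-cong f (+ᴹ-homo g v w) i) (+ᴹ-homo f (fun g v) (fun g w) i))
      (λ i → C.trans (⟦⟧-cong f (0ᴹ-homo g) i) (0ᴹ-homo f i))
      (λ v i → C.trans (⟦⟧-cong f (-ᴹ-homo g v) i) (-ᴹ-homo f (fun g v) i))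
      (λ s v i → C.trans (⟦⟧-cong f (*ₗ-homo g s v) i) (*ₗ-homo f s (fun g v) i))
    (f ∘ᴱ g) .commutes a v i = C.trans (⟦⟧-cong f (commutes g a v) i) (commutes f a (fun g v) i)

    negᴱ : CommutingEndomorphism → CommutingEndomorphism
    negᴱ f .fun v = -ᴹ fun f v
    negᴱ f .isLinear = mkLinear
      (λ p i → C.-‿cong (⟦⟧-cong f p i))
      (λ v w i → C.trans (C.-‿cong (+ᴹ-homo f v w i))
        (C.sym (⁻¹-∙-comm (fun f v i) (fun f w i))))
      (λ i → C.trans (C.-‿cong (0ᴹ-homo f i)) ε⁻¹≈ε)
      (λ v i → C.-‿cong (-ᴹ-homo f v i))
      (λ s v i → C.trans (C.-‿cong (*ₗ-homo f s v i)) (-‿distribʳ-* s (fun f v i)))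
    negᴱ f .commutes a v i = C.trans (C.-‿cong (commutes f a v i))
      (C.sym (*ᵛ-neg (ρ a) (fun f v) i))

    scaleᴱ : ℂ → CommutingEndomorphism → CommutingEndomorphism
    scaleᴱ s f .fun v = s *ₗ fun f v
    scaleᴱ s f .isLinear = mkLinear
      (λ p i → C.*-congˡ (⟦⟧-cong f p i))
      (λ v w i → C.trans (C.*-congˡ (+ᴹ-homo f v w i)) (C.distribˡ s (fun f v i) (fun f w i)))
      (λ i → C.trans (C.*-congˡ (0ᴹ-homo f i)) (C.zeroʳ s))
      (λ v i → C.trans (C.*-congˡ (-ᴹ-homo f v i)) (C.sym (-‿distribʳ-* s (fun f v i))))
      (λ t v i → C.trans (C.*-congˡ (*ₗ-homo f t v i)) (x∙yz≈y∙xz s t (fun f v i)))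
    scaleᴱ s f .commutes a v i = C.trans (C.*-congˡ (commutes f a v i))
      (C.sym (*ᵛ-scale (ρ a) s (fun f v) i))

    zeroᴱ idᴱ : CommutingEndomorphism
    zeroᴱ .fun _ = 0ᴹ
    zeroᴱ .isLinear = mkLinear
      (λ _ _ → C.refl) (λ _ _ _ → C.sym (C.+-identityˡ 0ℂ)) (λ _ → C.refl)
      (λ _ _ → C.sym ε⁻¹≈ε) (λ s _ _ → C.sym (C.zeroʳ s))
    zeroᴱ .commutes a v i = C.sym (*ᵛ-0 (ρ a) i)

    idᴱ .fun = id
    idᴱ .isLinear = mkLinear
      id (λ _ _ _ → C.refl) (λ _ → C.refl) (λ _ _ → C.refl) (λ _ _ _ → C.refl)
    idᴱ .commutes _ _ _ = C.refl

  centralizerAlgebra : ℂ-Algebra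
  centralizerAlgebra = record
    { ring = record
      { Carrier = CommutingEndomorphism
      ; _≈_ = λ f g → ∀ v → fun f v ≈ᴹ fun g v
      ; _+_ = _⊹_
      ; _*_ = _∘ᴱ_
      ; -_ = negᴱ
      ; 0# = zeroᴱ
      ; 1# = idᴱ
      ; isRing = record
        { +-isAbelianGroup = record
          { isGroup = record
            { isMonoid = record
              { isSemigroup = record
                { isMagma = record
                  { isEquivalence = record
                    { refl  = λ _ _ → C.refl
                    ; sym   = λ p v i → C.sym (p v i)
                    ; trans = λ p q v i → C.trans (p v i) (q v i)
                    }
                  ; ∙-cong = λ p q v i → C.+-cong (p v i) (q v i)
                  }
                ; assoc = λ f g h v i → C.+-assoc (fun f v i) (fun g v i) (fun h v i)
                }
              ; identity = (λ f v i → C.+-identityˡ (fun f v i)) ,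
                           (λ f v i → C.+-identityʳ (fun f v i))
              }
            ; inverse = (λ f v i → C.-‿inverseˡ (fun f v i)) ,
                        (λ f v i → C.-‿inverseʳ (fun f v i))
            ; ⁻¹-cong = λ p v i → C.-‿cong (p v i)
            }
          ; comm = λ f g v i → C.+-comm (fun f v i) (fun g v i)
          }
        ; *-cong = λ {f} {f′} {g} {g′} p q v i →
            C.trans (⟦⟧-cong f (q v) i) (p (fun g′ v) i)
        ; *-assoc = λ _ _ _ _ _ → C.refl
        ; *-identity = (λ _ _ _ → C.refl) , (λ _ _ _ → C.refl)
        ; distrib = (λ f g h v → +ᴹ-homo f (fun g v) (fun h v)) , (λ _ _ _ _ _ → C.refl)
        }
      }
    ; _·_ = scaleᴱ
    ; ·-cong = λ s≈t p v i → C.*-cong s≈t (p v i)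
    ; ·-distribˡ = λ s f g v i → C.distribˡ s (fun f v i) (fun g v i)
    ; ·-distribʳ = λ s t f v i → C.distribʳ (fun f v i) s t
    ; ·-assoc = λ s t f v i → C.*-assoc s t (fun f v i)
    ; ·-identity = λ f v i → C.*-identityˡ (fun f v i)
    ; ·-*-assocˡ = λ _ _ _ _ _ → C.refl
    ; ·-*-assocʳ = λ s f g v i → C.sym (*ₗ-homo f s (fun g v) i)
    }

record Subgroup (G : Group 0ℓ 0ℓ) : Set₁ where
  open Group G
  field
    ⟨_⟩       : Pred Carrier 0ℓ
    resp      : ⟨_⟩ Respects _≈_
    ε-closed  : ε ∈ ⟨_⟩
    ∙-closed  : ∀ {x y} → x ∈ ⟨_⟩ → y ∈ ⟨_⟩ → x ∙ y ∈ ⟨_⟩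
    ⁻¹-closed : ∀ {x} → x ∈ ⟨_⟩ → x ⁻¹ ∈ ⟨_⟩

  group : Group 0ℓ 0ℓ
  group = record
    { Carrier = Σ Carrier ⟨_⟩
    ; _≈_ = λ x y → proj₁ x ≈ proj₁ y
    ; _∙_ = λ (x , p) (y , q) → x ∙ y , ∙-closed p q
    ; ε = ε , ε-closed
    ; _⁻¹ = λ (x , p) → x ⁻¹ , ⁻¹-closed p
    ; isGroup = record
      { isMonoid = record
        { isSemigroup = record
          { isMagma = record
            { isEquivalence = record
              { refl = Group.refl G ; sym = Group.sym G ; trans = Group.trans G }
            ; ∙-cong = ∙-cong
            }
          ; assoc = λ (x , _) (y , _) (z , _) → assoc x y z
          }
        ; identity = (λ (x , _) → identityˡ x) , (λ (x , _) → identityʳ x)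
        }
      ; inverse = (λ (x , _) → inverseˡ x) , (λ (x , _) → inverseʳ x)
      ; ⁻¹-cong = ⁻¹-cong
      }
    }

module _ (G : Group 0ℓ 0ℓ) where
  open Group G

  data Generated (S : Pred Carrier 0ℓ) : Pred Carrier 0ℓ where
    gen  : ∀ {x} → x ∈ S → Generated S x
    one  : Generated S ε
    mul  : ∀ {x y} → Generated S x → Generated S y → Generated S (x ∙ y)
    inv  : ∀ {x} → Generated S x → Generated S (x ⁻¹)
    resp : ∀ {x y} → x ≈ y → Generated S x → Generated S y

  generatedBy : Pred Carrier 0ℓ → Subgroup G
  generatedBy S = record
    { ⟨_⟩ = Generated S ; resp = resp ; ε-closed = one ; ∙-closed = mul ; ⁻¹-closed = inv }

  HasOrder : Subgroup G → ℕ → Set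
  HasOrder K m = Inverse (≡.setoid (Fin m)) (Group.setoid (Subgroup.group K))

  Conjugate : Subgroup G → Subgroup G → Set
  Conjugate K L = ∃ λ g → ∀ x → x ∈ Subgroup.⟨ K ⟩ ⇔ (g ⁻¹ ∙ x ∙ g) ∈ Subgroup.⟨ L ⟩

  module _ (K : Subgroup G) where
    open Subgroup K using (⟨_⟩; ε-closed; ∙-closed; ⁻¹-closed) renaming (resp to K-resp)

    private
      open GroupProperties G using (⁻¹-anti-homo-∙; ⁻¹-involutive)

      flip-quotient : ∀ x y → (x ∙ y ⁻¹) ⁻¹ ≈ y ∙ x ⁻¹
      flip-quotient x y = Group.trans G (⁻¹-anti-homo-∙ x (y ⁻¹)) (∙-congʳ (⁻¹-involutive y))

      cancel-mid : ∀ x y z → (x ∙ y ⁻¹) ∙ (y ∙ z ⁻¹) ≈ x ∙ z ⁻¹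
      cancel-mid x y z = Group.trans G (assoc x (y ⁻¹) (y ∙ z ⁻¹))
        (∙-congˡ (Group.trans G (Group.sym G (assoc (y ⁻¹) y (z ⁻¹)))
          (Group.trans G (∙-congʳ (inverseˡ y)) (identityˡ (z ⁻¹)))))

    -- The set K \ G of right cosets: x and y represent the same coset
    -- K x = K y when x y⁻¹ ∈ K.
    rightCosets : Setoid 0ℓ 0ℓ
    rightCosets = record
      { Carrier = Carrier
      ; _≈_ = λ x y → x ∙ y ⁻¹ ∈ ⟨_⟩
      ; isEquivalence = record
        { refl  = λ {x} → K-resp (Group.sym G (inverseʳ x)) ε-closed
        ; sym   = λ {x} {y} p → K-resp (flip-quotient x y) (⁻¹-closed p)
        ; trans = λ {x} {y} {z} p q → K-resp (cancel-mid x y z) (∙-closed p q)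
        }
      }

    private module Cosets = Setoid rightCosets

    -- Injectivity of G → Sym(K \ G), where g sends K x to K x g.
    Faithful : Set
    Faithful = ∀ g h → (∀ x → (x ∙ g) Cosets.≈ (x ∙ h)) → g ≈ h

    -- The basis of the permutation representation is K \ G itself; an
    -- enumeration of it is what turns the action into matrices.
    CosetEnumeration : ℕ → Set
    CosetEnumeration n = Inverse (≡.setoid (Fin n)) rightCosets

    -- Row i has its 1 in the column of the coset (i-th coset) ∙ g, so that
    -- the matrix of g ∙ h is the product of the matrices of g and of h.
    permutationMatrix : ∀ {n} → CosetEnumeration n → Carrier → Matrix n n
    permutationMatrix e g i j = δ (Inverse.from e (Inverse.to e i ∙ g)) j

    tensorCentralizer : ∀ {n} → CosetEnumeration n → ℕ → ℂ-Algebra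
    tensorCentralizer e k = centralizerAlgebra (λ g → permutationMatrix e g ^⊗ k)

module _ (R : Monoid 0ℓ 0ℓ) where
  open Monoid R
  private module R = SetoidReasoning setoid

  record Unit : Set where
    field
      elt elt⁻¹ : Carrier
      inverseˡ  : elt⁻¹ ∙ elt ≈ ε
      inverseʳ  : elt ∙ elt⁻¹ ≈ ε

  private
    open Unit

    cancel : ∀ x x′ y y′ → x′ ∙ x ≈ ε → y′ ∙ y ≈ ε → (y′ ∙ x′) ∙ (x ∙ y) ≈ ε
    cancel x x′ y y′ p q = R.begin
      (y′ ∙ x′) ∙ (x ∙ y)  R.≈⟨ assoc y′ x′ (x ∙ y) ⟩
      y′ ∙ (x′ ∙ (x ∙ y))  R.≈⟨ ∙-congˡ (assoc x′ x y) ⟨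
      y′ ∙ ((x′ ∙ x) ∙ y)  R.≈⟨ ∙-congˡ (∙-congʳ p) ⟩
      y′ ∙ (ε ∙ y)         R.≈⟨ ∙-congˡ (identityˡ y) ⟩
      y′ ∙ y               R.≈⟨ q ⟩
      ε                    R.∎

    inverse-unique : ∀ x y → elt x ≈ elt y → elt⁻¹ x ≈ elt⁻¹ y
    inverse-unique x y p = R.begin
      elt⁻¹ x                      R.≈⟨ identityʳ (elt⁻¹ x) ⟨
      elt⁻¹ x ∙ ε                  R.≈⟨ ∙-congˡ (inverseʳ y) ⟨
      elt⁻¹ x ∙ (elt y ∙ elt⁻¹ y)  R.≈⟨ assoc (elt⁻¹ x) (elt y) (elt⁻¹ y) ⟨
      elt⁻¹ x ∙ elt y ∙ elt⁻¹ y    R.≈⟨ ∙-congʳ (∙-congˡ p) ⟨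
      elt⁻¹ x ∙ elt x ∙ elt⁻¹ y    R.≈⟨ ∙-congʳ (inverseˡ x) ⟩
      ε ∙ elt⁻¹ y                  R.≈⟨ identityˡ (elt⁻¹ y) ⟩
      elt⁻¹ y                      R.∎

  unitGroup : Group 0ℓ 0ℓ
  unitGroup = record
    { Carrier = Unit
    ; _≈_ = λ x y → elt x ≈ elt y
    ; _∙_ = λ x y → record
        { elt = elt x ∙ elt y
        ; elt⁻¹ = elt⁻¹ y ∙ elt⁻¹ x
        ; inverseˡ = cancel (elt x) (elt⁻¹ x) (elt y) (elt⁻¹ y) (inverseˡ x) (inverseˡ y)
        ; inverseʳ = cancel (elt⁻¹ y) (elt y) (elt⁻¹ x) (elt x) (inverseʳ y) (inverseʳ x)
        }
    ; ε = record { elt = ε ; elt⁻¹ = ε ; inverseˡ = identityˡ ε ; inverseʳ = identityˡ ε }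
    ; _⁻¹ = λ x → record
        { elt = elt⁻¹ x ; elt⁻¹ = elt x ; inverseˡ = inverseʳ x ; inverseʳ = inverseˡ x }
    ; isGroup = record
      { isMonoid = record
        { isSemigroup = record
          { isMagma = record
            { isEquivalence = record
              { refl = Monoid.refl R ; sym = Monoid.sym R ; trans = Monoid.trans R }
            ; ∙-cong = ∙-cong
            }
          ; assoc = λ x y z → assoc (elt x) (elt y) (elt z)
          }
        ; identity = (λ x → identityˡ (elt x)) , (λ x → identityʳ (elt x))
        }
      ; inverse = inverseˡ , inverseʳ
      ; ⁻¹-cong = λ {x} {y} → inverse-unique x y
      }
    }

GL : ℕ → Group 0ℓ 0ℓ
GL n = unitGroup (Ring.*-monoid (matrixRing n))

private
  scale : ∀ {m n} → ℂ → Matrix m n → Matrix m n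
  scale s A i j = s *ℂ A i j

  Tᴹ T⁻¹ᴹ Dᴹ D⁻¹ᴹ : Matrix 2 2
  Tᴹ   = scale (fromℚ² ½ ½)
           ((1ℂ ∷ 1ℂ ∷ []) ∷
            (1ℂ ∷ -ℂ 1ℂ ∷ []) ∷ [])
  T⁻¹ᴹ = scale (fromℚ² ½ (ℚ.- ½))
           ((1ℂ ∷ 1ℂ ∷ []) ∷
            (1ℂ ∷ -ℂ 1ℂ ∷ []) ∷ [])
  Dᴹ   = (1ℂ ∷ 0ℂ ∷ []) ∷
         (0ℂ ∷ iℂ ∷ []) ∷ []
  D⁻¹ᴹ = (1ℂ ∷ 0ℂ ∷ []) ∷
         (0ℂ ∷ -ℂ iℂ ∷ []) ∷ []

T D : Group.Carrier (GL 2)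
T = record
  { elt = Tᴹ
  ; elt⁻¹ = T⁻¹ᴹ
  ; inverseˡ = λ { zero zero → pointwise⇒≈ℂ (λ _ → refl) (λ _ → refl) ; zero (suc zero) → pointwise⇒≈ℂ (λ _ → refl) (λ _ → refl)
                 ; (suc zero) zero → pointwise⇒≈ℂ (λ _ → refl) (λ _ → refl) ; (suc zero) (suc zero) → pointwise⇒≈ℂ (λ _ → refl) (λ _ → refl) }
  ; inverseʳ = λ { zero zero → pointwise⇒≈ℂ (λ _ → refl) (λ _ → refl) ; zero (suc zero) → pointwise⇒≈ℂ (λ _ → refl) (λ _ → refl)
                 ; (suc zero) zero → pointwise⇒≈ℂ (λ _ → refl) (λ _ → refl) ; (suc zero) (suc zero) → pointwise⇒≈ℂ (λ _ → refl) (λ _ → refl) }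
  }
D = record
  { elt = Dᴹ
  ; elt⁻¹ = D⁻¹ᴹ
  ; inverseˡ = λ { zero zero → pointwise⇒≈ℂ (λ _ → refl) (λ _ → refl) ; zero (suc zero) → pointwise⇒≈ℂ (λ _ → refl) (λ _ → refl)
                 ; (suc zero) zero → pointwise⇒≈ℂ (λ _ → refl) (λ _ → refl) ; (suc zero) (suc zero) → pointwise⇒≈ℂ (λ _ → refl) (λ _ → refl) }
  ; inverseʳ = λ { zero zero → pointwise⇒≈ℂ (λ _ → refl) (λ _ → refl) ; zero (suc zero) → pointwise⇒≈ℂ (λ _ → refl) (λ _ → refl)
                 ; (suc zero) zero → pointwise⇒≈ℂ (λ _ → refl) (λ _ → refl) ; (suc zero) (suc zero) → pointwise⇒≈ℂ (λ _ → refl) (λ _ → refl) }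
  }

H₁ : Group 0ℓ 0ℓ
H₁ = Subgroup.group (generatedBy (GL 2) (λ x → x ≈ T ⊎ x ≈ D))
  where open Group (GL 2) using (_≈_)

data Index : Set where
  #1 #3 #4 #8 #9 : Index

order : Index → ℕ
order #1 = 1
order #3 = 2
order #4 = 3
order #8 = 4
order #9 = 4

-- Stated for an arbitrary group because the positivity check normalises the
-- types of the fields, which does not finish for the concrete group H₁.
record FaithfulRepresentatives (G : Group 0ℓ 0ℓ) : Set₁ where
  field
    K            : Index → Subgroup G
    hasOrder     : ∀ i → HasOrder G (K i) (order i)
    faithful     : ∀ i → Faithful G (K i)
    nonconjugate : ∀ i j → Conjugate G (K i) (K j) → i ≡ j
    -- A predicate on a finite group need not be decidable, so the subgroups
    -- considered are those that come with their order.
    exhaustive   : ∀ (L : Subgroup G) m → HasOrder G L m → Faithful G L →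
                   ∃ λ i → Conjugate G L (K i)

fromℕ : ℕ → ℚ
fromℕ n = + n ℚ./ 1

pow : (b : ℕ) .{{_ : NonZero b}} → ℤ → ℚ
pow b (+ n)      = fromℕ (b ℕ.^ n)
pow b (-[1+ n ]) = (+ 1 ℚ./ (b ℕ.^ suc n)) {{ℕₚ.m^n≢0 b (suc n)}}

infixl 7 _÷_

_÷_ : ℚ → (n : ℕ) .{{_ : NonZero n}} → ℚ
q ÷ n = q ℚ.* (+ 1 ℚ./ n)

{-# OPTIONS --safe #-}
module Submission where

-- The group algebra over ℚ(i) splits into matrix algebras with matrix units
-- E c i j = (d c / 96) Σ_g r c (g⁻¹) j i g, for 16 representations r c over ℤ[i]
-- of the group of order 96.  A commuting endomorphism f of a representation is
-- determined by its restrictions to the images of the idempotents E c 0 0, and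
-- these restrictions are arbitrary, so that the centralizer is the product of
-- the matrix algebras of size tr (E c 0 0).  The traces are computed from the
-- numbers of fixed points of the group on the cosets of K, whose k-th powers are
-- the traces on the tensor power.  These numbers depend on K only up to
-- conjugacy, and a faithful K of order at most 4 is cyclic with one of seven
-- generators up to conjugacy.  Everything up to the matrices of E c 0 0 and
-- bases of their images lives over ℚ(i), where equality is decidable.

open import Algebra.Bundles using (CommutativeRing; Group; Ring)
open import Algebra.Structures using (IsGroup)
open import Data.Bool.Base using (Bool; true; false; _∧_; _∨_; if_then_else_)
open import Data.Fin.Base as Fin using (Fin; zero; suc; toℕ; combine; quotient; remainder)
open import Data.Fin.Properties using (_≟_)
open import Data.Integer.Base as ℤ using (ℤ)
import Data.Integer.Properties as ℤₚ
open import Data.Nat.Base as ℕ using (ℕ; zero; suc)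
import Data.Nat.Properties as ℕₚ
open import Data.Product.Base using (∃; _,_; _×_; proj₁; proj₂)
open import Data.Rational.Base as ℚ using (ℚ; 0ℚ; 1ℚ; ½)
import Data.Rational.Properties as ℚₚ
open import Data.Sum.Base as Sum using (_⊎_; inj₁; inj₂; [_,_]′)
open import Data.Vec.Base as Vec using (Vec; []; _∷_; lookup)
open import Function.Base using (_∘_)
open import Level using (Level; _⊔_; 0ℓ)
open import Relation.Binary.PropositionalEquality as ≡ using (_≡_; _≢_)
open import Relation.Nullary.Decidable using (Dec; does; yes; no)
open import Relation.Nullary.Negation using (¬_; contradiction)

-- Irreducibility and inequivalence of the sixteen representations come out of one integer identity:
-- the sum of degree times character is 96 at the identity and 0 elsewhere. It makes Fourier
-- inversion a left inverse, and comparing the traces of two idempotents in characteristic 0 makes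
-- it two-sided, which is the orthogonality of matrix coefficients. The dimension formulas are
-- rational expressions. That their values are natural numbers is not a matter of arithmetic here:
-- each value is the trace of an idempotent over ℚ(i), and Gaussian elimination produces the rank
-- that equals it. The subgroups K are arbitrary predicates with an enumeration, so their
-- permutation characters cannot be tabulated directly; they are reached through the formula for an
-- induced character. Faithfulness enters by keeping the nontrivial scalars, the powers of T² = i,
-- out of K. The elements with no nontrivial scalar among their powers are then sorted into seven
-- classes by a finite check.

-- Coordinatewise maps on tuples.

module TensorPowers where

  open import Data.Fin.Properties using (combine-remQuot; remQuot-combine)

  quotient-combine : ∀ {m n} (i : Fin m) (j : Fin n) → quotient {m} n (combine i j) ≡ i
  quotient-combine i j = ≡.cong proj₁ (remQuot-combine i j)

  remainder-combine : ∀ {m n} (i : Fin m) (j : Fin n) → remainder {m} n (combine i j) ≡ j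
  remainder-combine i j = ≡.cong proj₂ (remQuot-combine i j)

  -- Tuples are numbered as the basis of a Kronecker power is, so that this is the permutation that
  -- `_^⊗_` induces on basis vectors.
  tensor : ∀ {n} k → (Fin n → Fin n) → Fin (n ℕ.^ k) → Fin (n ℕ.^ k)
  tensor zero        f p = p
  tensor {n} (suc k) f p = combine (f (quotient {n} (n ℕ.^ k) p)) (tensor k f (remainder {n} (n ℕ.^ k) p))

  tensor-id : ∀ {n} k {f : Fin n → Fin n} → (∀ i → f i ≡ i) → ∀ p → tensor k f p ≡ p
  tensor-id zero        f≗id p = ≡.refl
  tensor-id {n} (suc k) f≗id p = ≡.trans (≡.cong₂ combine (f≗id _) (tensor-id k f≗id _)) (combine-remQuot {n} (n ℕ.^ k) p)

  tensor-∘ : ∀ {n} k {f g h : Fin n → Fin n} → (∀ i → h i ≡ g (f i)) → ∀ p → tensor k h p ≡ tensor k g (tensor k f p)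
  tensor-∘ zero        h≗gf p = ≡.refl
  tensor-∘ {n} (suc k) {f} {g} h≗gf p = ≡.cong₂ combine
    (≡.trans (h≗gf _) (≡.cong g (≡.sym (quotient-combine (f _) _))))
    (≡.trans (tensor-∘ k h≗gf _) (≡.cong (tensor k g) (≡.sym (remainder-combine (f (quotient {n} (n ℕ.^ k) p)) _))))

  tensor-cong : ∀ {n} k {f g : Fin n → Fin n} → (∀ i → f i ≡ g i) → ∀ p → tensor k f p ≡ tensor k g p
  tensor-cong zero    f≗g p = ≡.refl
  tensor-cong (suc k) f≗g p = ≡.cong₂ combine (f≗g _) (tensor-cong k f≗g _)

-- Finite sums and matrices over a commutative ring.

module LinearAlgebra {c ℓ : Level} (R : CommutativeRing c ℓ) where

  open import Data.Fin.Base using (_↑ˡ_; _↑ʳ_)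
  open TensorPowers using (quotient-combine; remainder-combine)
  open import Data.Fin.Permutation using (permutation)
  open import Relation.Nullary.Decidable using (dec-true; dec-false)

  open CommutativeRing R public hiding (zero)
  import Algebra.Properties.Semiring.Sum semiring as Sums
  open import Algebra.Properties.CommutativeSemigroup *-commutativeSemigroup public
    using (x∙yz≈y∙xz; x∙yz≈z∙xy; x∙yz≈y∙zx; x∙yz≈xz∙y; xy∙z≈xz∙y)
  open import Relation.Binary.Reasoning.Setoid setoid

  -- Opaque, so that the length of a sum can be inferred from the sum.
  opaque
    sum : ∀ {n} → (Fin n → Carrier) → Carrier
    sum = Sums.sum

    sum≡Sum : ∀ {n} (f : Fin n → Carrier) → sum f ≡ Sums.sum f
    sum≡Sum f = ≡.refl

    sum-[] : (f : Fin 0 → Carrier) → sum f ≈ 0#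
    sum-[] f = refl

    sum-∷ : ∀ {n} (f : Fin (suc n) → Carrier) → sum f ≈ f zero + sum (f ∘ suc)
    sum-∷ f = refl

    sum-cong : ∀ {n} {f g : Fin n → Carrier} → (∀ i → f i ≈ g i) → sum f ≈ sum g
    sum-cong f≈g = Sums.sum-cong-≋ f≈g

    sum-zero : ∀ {n} {f : Fin n → Carrier} → (∀ i → f i ≈ 0#) → sum f ≈ 0#
    sum-zero {n} f≈0 = trans (Sums.sum-cong-≋ f≈0) (Sums.sum-replicate-zero n)

    sum-comm : ∀ {m n} (f : Fin m → Fin n → Carrier) →
               sum (λ i → sum (f i)) ≈ sum (λ j → sum (λ i → f i j))
    sum-comm = Sums.∑-comm

    sum-+ : ∀ {n} (f g : Fin n → Carrier) → sum (λ i → f i + g i) ≈ sum f + sum g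
    sum-+ = Sums.∑-distrib-+

    *-sumˡ : ∀ {n} x (f : Fin n → Carrier) → x * sum f ≈ sum (λ i → x * f i)
    *-sumˡ = Sums.*-distribˡ-sum

    *-sumʳ : ∀ {n} x (f : Fin n → Carrier) → sum f * x ≈ sum (λ i → f i * x)
    *-sumʳ = Sums.*-distribʳ-sum

    sum-reindex : ∀ {n} (to from : Fin n → Fin n) →
                  (∀ i → to (from i) ≡ i) → (∀ i → from (to i) ≡ i) →
                  (f : Fin n → Carrier) → sum (f ∘ to) ≈ sum f
    sum-reindex to from to-from from-to f =
      sym (Sums.sum-permute f (permutation to from to-from from-to))

  [_≐_] : ∀ {n} → Fin n → Fin n → Carrier
  [ i ≐ j ] = if does (i ≟ j) then 1# else 0#

  ≐-refl : ∀ {n} (i : Fin n) → [ i ≐ i ] ≈ 1#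
  ≐-refl i rewrite dec-true (i ≟ i) ≡.refl = refl

  ≐-≢ : ∀ {n} {i j : Fin n} → i ≢ j → [ i ≐ j ] ≈ 0#
  ≐-≢ {i = i} {j} i≢j rewrite dec-false (i ≟ j) i≢j = refl

  ≐-sym : ∀ {n} (i j : Fin n) → [ i ≐ j ] ≈ [ j ≐ i ]
  ≐-sym i j with i ≟ j
  ... | yes ≡.refl = sym (≐-refl i)
  ... | no  i≢j   = sym (≐-≢ (i≢j ∘ ≡.sym))

  ≐-iff : ∀ {m n} {i j : Fin m} {k l : Fin n} → (i ≡ j → k ≡ l) → (k ≡ l → i ≡ j) → [ i ≐ j ] ≈ [ k ≐ l ]
  ≐-iff {i = i} {j} {k} {l} to from with i ≟ j | k ≟ l
  ... | yes _ | yes _ = refl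
  ... | no  _ | no  _ = refl
  ... | yes p | no ¬q = contradiction (to p) ¬q
  ... | no ¬p | yes q = contradiction (from q) ¬p

  ≐-sumˡ : ∀ {n} (i : Fin n) (f : Fin n → Carrier) → sum (λ k → [ i ≐ k ] * f k) ≈ f i
  ≐-sumˡ zero    f = trans (sum-∷ _) (trans (+-cong (*-identityˡ _) (sum-zero λ k → zeroˡ _)) (+-identityʳ _))
  ≐-sumˡ (suc i) f = trans (sum-∷ _) (trans (+-cong (zeroˡ _) (≐-sumˡ i (f ∘ suc))) (+-identityˡ _))

  ≐-sumʳ : ∀ {n} (i : Fin n) (f : Fin n → Carrier) → sum (λ k → f k * [ k ≐ i ]) ≈ f i
  ≐-sumʳ i f = trans (sum-cong λ k → trans (*-comm _ _) (*-congʳ (≐-sym k i))) (≐-sumˡ i f)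

  sum-↑ : ∀ m {n} (f : Fin (m ℕ.+ n) → Carrier) →
          sum f ≈ sum (λ i → f (i ↑ˡ n)) + sum (λ j → f (m ↑ʳ j))
  sum-↑ zero    f = sym (trans (+-congʳ (sum-[] _)) (+-identityˡ _))
  sum-↑ (suc m) f = trans (sum-∷ f) (trans (+-congˡ (sum-↑ m (f ∘ suc)))
    (trans (sym (+-assoc _ _ _)) (+-congʳ (sym (sum-∷ _)))))

  sum-combine : ∀ m {n} (f : Fin (m ℕ.* n) → Carrier) →
                sum f ≈ sum (λ i → sum (λ j → f (combine {m} {n} i j)))
  sum-combine zero        f = trans (sum-[] f) (sym (sum-[] _))
  sum-combine (suc m) {n} f = trans (sum-↑ n f)
    (trans (+-congˡ (sum-combine m (λ j → f (n ↑ʳ j)))) (sym (sum-∷ _)))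

  sum-remQuot : ∀ m n (f : Fin m → Fin n → Carrier) →
                sum (λ p → f (quotient {m} n p) (remainder {m} n p)) ≈ sum (λ i → sum (λ j → f i j))
  sum-remQuot m n f = trans (sum-combine m _) (sum-cong λ i → sum-cong λ j →
    reflexive (≡.cong₂ f (quotient-combine i j) (remainder-combine i j)))

  sum-*-sum : ∀ {m n} (f : Fin m → Carrier) (g : Fin n → Carrier) →
              sum (λ i → sum (λ j → f i * g j)) ≈ sum f * sum g
  sum-*-sum f g = begin
    sum (λ i → sum (λ j → f i * g j))  ≈⟨ sum-cong (λ i → *-sumˡ (f i) g) ⟨
    sum (λ i → f i * sum g)            ≈⟨ *-sumʳ (sum g) f ⟨
    sum f * sum g                      ∎

  infix  4 _≋_
  infixl 7 _⊡_
  infixl 6 _⊞_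

  Mat : ℕ → ℕ → Set c
  Mat m n = Fin m → Fin n → Carrier

  _≋_ : ∀ {m n} → Mat m n → Mat m n → Set ℓ
  A ≋ B = ∀ i j → A i j ≈ B i j

  _⊡_ : ∀ {l m n} → Mat l m → Mat m n → Mat l n
  (A ⊡ B) i j = sum λ k → A i k * B k j

  _⊞_ : ∀ {m n} → Mat m n → Mat m n → Mat m n
  (A ⊞ B) i j = A i j + B i j

  infixr 7 _◂_

  _◂_ : ∀ {m n} → Carrier → Mat m n → Mat m n
  (s ◂ A) i j = s * A i j

  Id : ∀ {n} → Mat n n
  Id = [_≐_]

  Σᴹ : ∀ {k m n} → (Fin k → Mat m n) → Mat m n
  Σᴹ F i j = sum λ k → F k i j

  ≋-sym : ∀ {m n} {A B : Mat m n} → A ≋ B → B ≋ A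
  ≋-sym p i j = sym (p i j)

  ≋-trans : ∀ {m n} {A B C : Mat m n} → A ≋ B → B ≋ C → A ≋ C
  ≋-trans p q i j = trans (p i j) (q i j)

  ⊡-cong : ∀ {l m n} {A A′ : Mat l m} {B B′ : Mat m n} → A ≋ A′ → B ≋ B′ → A ⊡ B ≋ A′ ⊡ B′
  ⊡-cong p q i j = sum-cong λ k → *-cong (p i k) (q k j)

  ⊡-congˡ : ∀ {l m n} {A : Mat l m} {B B′ : Mat m n} → B ≋ B′ → A ⊡ B ≋ A ⊡ B′
  ⊡-congˡ q i j = sum-cong λ k → *-congˡ (q k j)

  ⊡-congʳ : ∀ {l m n} {A A′ : Mat l m} {B : Mat m n} → A ≋ A′ → A ⊡ B ≋ A′ ⊡ B
  ⊡-congʳ p i j = sum-cong λ k → *-congʳ (p i k)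

  ⊡-assoc : ∀ {k l m n} (A : Mat k l) (B : Mat l m) (C : Mat m n) → (A ⊡ B) ⊡ C ≋ A ⊡ (B ⊡ C)
  ⊡-assoc A B C i j = begin
    sum (λ b → sum (λ a → A i a * B a b) * C b j)   ≈⟨ sum-cong (λ b → *-sumʳ (C b j) _) ⟩
    sum (λ b → sum (λ a → A i a * B a b * C b j))   ≈⟨ sum-comm (λ b a → A i a * B a b * C b j) ⟩
    sum (λ a → sum (λ b → A i a * B a b * C b j))   ≈⟨ sum-cong (λ a → sum-cong λ b → *-assoc _ _ _) ⟩
    sum (λ a → sum (λ b → A i a * (B a b * C b j))) ≈⟨ sum-cong (λ a → *-sumˡ (A i a) _) ⟨
    sum (λ a → A i a * sum (λ b → B a b * C b j))   ∎

  ⊡-identityˡ : ∀ {m n} (A : Mat m n) → Id ⊡ A ≋ A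
  ⊡-identityˡ A i j = ≐-sumˡ i (λ k → A k j)

  ⊡-identityʳ : ∀ {m n} (A : Mat m n) → A ⊡ Id ≋ A
  ⊡-identityʳ A i j = ≐-sumʳ j (A i)

  ⊡-Σˡ : ∀ {k l m n} (F : Fin k → Mat l m) (B : Mat m n) → Σᴹ F ⊡ B ≋ Σᴹ (λ a → F a ⊡ B)
  ⊡-Σˡ F B i j = trans (sum-cong λ b → *-sumʳ (B b j) _) (sum-comm (λ b a → F a i b * B b j))

  ⊡-Σʳ : ∀ {k l m n} (B : Mat l m) (F : Fin k → Mat m n) → B ⊡ Σᴹ F ≋ Σᴹ (λ a → B ⊡ F a)
  ⊡-Σʳ B F i j = trans (sum-cong λ b → *-sumˡ (B i b) _) (sum-comm (λ b a → B i b * F a b j))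

  ⊡-◂ˡ : ∀ {l m n} s (A : Mat l m) (B : Mat m n) → (s ◂ A) ⊡ B ≋ s ◂ (A ⊡ B)
  ⊡-◂ˡ s A B i j = trans (sum-cong λ k → *-assoc _ _ _) (sym (*-sumˡ s _))

  ⊡-◂ʳ : ∀ {l m n} s (A : Mat l m) (B : Mat m n) → A ⊡ (s ◂ B) ≋ s ◂ (A ⊡ B)
  ⊡-◂ʳ s A B i j = trans (sum-cong λ k → x∙yz≈y∙xz _ _ _) (sym (*-sumˡ s _))

  tr : ∀ {n} → Mat n n → Carrier
  tr A = sum λ i → A i i

  tr-cong : ∀ {n} {A B : Mat n n} → A ≋ B → tr A ≈ tr B
  tr-cong p = sum-cong λ i → p i i

  tr-comm : ∀ {m n} (A : Mat m n) (B : Mat n m) → tr (A ⊡ B) ≈ tr (B ⊡ A)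
  tr-comm A B = trans (sum-comm (λ i k → A i k * B k i)) (sum-cong λ k → sum-cong λ i → *-comm _ _)

  tr-⊞ : ∀ {n} (A B : Mat n n) → tr (A ⊞ B) ≈ tr A + tr B
  tr-⊞ A B = sum-+ (λ i → A i i) (λ i → B i i)

  fromℕ : ℕ → Carrier
  fromℕ zero    = 0#
  fromℕ (suc n) = 1# + fromℕ n

  tr-Id : ∀ n → tr (Id {n}) ≈ fromℕ n
  tr-Id n = trans (sum-cong {n} (λ i → ≐-refl i)) (ones n)
    where
    ones : ∀ n → sum {n} (λ _ → 1#) ≈ fromℕ n
    ones zero    = sum-[] _
    ones (suc n) = trans (sum-∷ _) (+-congˡ (ones n))

  ⊡-⊞ʳ : ∀ {l m n} (A : Mat l m) (B C : Mat m n) → A ⊡ (B ⊞ C) ≋ A ⊡ B ⊞ A ⊡ C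
  ⊡-⊞ʳ A B C i j = trans (sum-cong λ k → distribˡ _ _ _) (sum-+ (λ k → A i k * B k j) _)

  ⊡-⊞ˡ : ∀ {l m n} (A B : Mat l m) (C : Mat m n) → (A ⊞ B) ⊡ C ≋ A ⊡ C ⊞ B ⊡ C
  ⊡-⊞ˡ A B C i j = trans (sum-cong λ k → distribʳ _ _ _) (sum-+ (λ k → A i k * C k j) _)

  -1◂-inverse : ∀ {m n} (A : Mat m n) i j → A i j + - 1# * A i j ≈ 0#
  -1◂-inverse A i j = trans (+-congˡ (-1*x≈-x _)) (-‿inverseʳ _)
    where open import Algebra.Properties.Ring ring using (-1*x≈-x)

  sum-single : ∀ {n} (i : Fin n) (f : Fin n → Carrier) → (∀ j → j ≢ i → f j ≈ 0#) → sum f ≈ f i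
  sum-single i f f≈0 = trans (sum-cong λ j → lemma j (j ≟ i)) (≐-sumˡ i f)
    where
    lemma : ∀ j → Dec (j ≡ i) → f j ≈ [ i ≐ j ] * f j
    lemma j (yes ≡.refl) = sym (trans (*-congʳ (≐-refl i)) (*-identityˡ _))
    lemma j (no j≢i)     = trans (f≈0 j j≢i) (sym (trans (*-congʳ (≐-≢ (j≢i ∘ ≡.sym))) (zeroˡ _)))

  -- An isotypic decomposition in coordinates: the space is the sum over c of ℂ^(degree c) tensor
  -- ℂ^(m c), with `A c j` the inclusion of the j-th basis vector tensor ℂ^(m c) and `B c j` the
  -- matching projection. The field `spanned` puts `A c j ⊡ B c o` into the span of the group, so
  -- that whatever commutes with the group commutes with it.
  record Decomposition {C q g N : ℕ} (o : Fin q) (r : Fin C → Fin g → Mat q q)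
                       (ρ : Fin g → Mat N N) (m : Fin C → ℕ) : Set (c ⊔ ℓ) where
    field
      A : ∀ c → Fin q → Mat N (m c)
      B : ∀ c → Fin q → Mat (m c) N
      intertwineˡ : ∀ c x j → ρ x ⊡ A c j ≋ Σᴹ (λ l → r c x l j ◂ A c l)
      intertwineʳ : ∀ c x l → B c l ⊡ ρ x ≋ Σᴹ (λ j → r c x l j ◂ B c j)
      dual        : ∀ c j → B c o ⊡ A c j ≋ [ o ≐ j ] ◂ Id
      orthogonal  : ∀ c c′ j → c ≢ c′ → ∀ a b → (B c o ⊡ A c′ j) a b ≈ 0#
      complete    : Σᴹ (λ c → Σᴹ (λ j → A c j ⊡ B c j)) ≋ Id
      coeff       : Fin C → Fin q → Fin g → Carrier
      spanned     : ∀ c j → A c j ⊡ B c o ≋ Σᴹ (λ x → coeff c j x ◂ ρ x)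

  ZeroOrUnit : Set (c ⊔ ℓ)
  ZeroOrUnit = ∀ x → x ≈ 0# ⊎ ∃ λ y → y * x ≈ 1#

  CharacteristicZero : Set ℓ
  CharacteristicZero = ∀ n → fromℕ n ≈ 0# → n ≡ 0

  -- Representations of the group (Fin g, mul, ε) of degrees at most q, padded
  -- with zeros: r c ε is not the identity but the projection to the first
  -- coordinates, as many as the degree says.  The weight is the degree over g.
  record PlancherelFamily {g : ℕ} (mul : Fin g → Fin g → Fin g) (ε : Fin g) (C q : ℕ) : Set (c ⊔ ℓ) where
    field
      r          : Fin C → Fin g → Mat q q
      w          : Fin C → Carrier
      r-homo     : ∀ c x y → r c (mul x y) ≋ r c x ⊡ r c y
      weight     : ∀ c → fromℕ g * w c ≈ tr (r c ε)
      plancherel : ∀ x → sum (λ c → w c * tr (r c x)) ≈ [ ε ≐ x ]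

-- Gaussian elimination and the rank of an idempotent.

module IdempotentSplitting {c ℓ : Level} (R : CommutativeRing c ℓ)
  (zero⊎unit : LinearAlgebra.ZeroOrUnit R) where

  open LinearAlgebra R

  -- A basis of the span of the columns of M, which P fixes, with dual basis A′.
  record Basis {N n} (P : Mat N N) (M : Mat N n) : Set (c ⊔ ℓ) where
    field
      rank  : ℕ
      A     : Mat N rank
      A′    : Mat rank N
      fixed : P ⊡ A ≋ A
      dual  : A′ ⊡ A ≋ Id
      spans : A ⊡ (A′ ⊡ M) ≋ M

  private
    allZero? : ∀ {n} (w : Fin n → Carrier) → (∀ i → w i ≈ 0#) ⊎ ∃ λ p → ∃ λ y → y * w p ≈ 1#
    allZero? {zero}  w = inj₁ λ ()
    allZero? {suc n} w with zero⊎unit (w zero) | allZero? (w ∘ suc)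
    ... | inj₂ u | _             = inj₂ (zero , u)
    ... | inj₁ _ | inj₂ (p , u)  = inj₂ (suc p , u)
    ... | inj₁ z | inj₁ zs       = inj₁ λ { zero → z ; (suc i) → zs i }

    -- One step of Gaussian elimination: w is the part of the new column that
    -- the basis found so far does not reach.
    module Extend {N n : ℕ} (P : Mat N N) (M : Mat N (suc n)) (PM≋M : P ⊡ M ≋ M)
                  (b : Basis P (λ i → M i ∘ suc)) where
      open Basis b

      col z w : Mat N 1
      col i _ = M i zero
      z = A ⊡ (A′ ⊡ col)
      w = col ⊞ (- 1# ◂ z)

      z+w : ∀ i j → w i j + z i j ≈ col i j
      z+w i j = trans (+-assoc _ _ _)
        (trans (+-congˡ (trans (+-comm _ _) (-1◂-inverse z i j))) (+-identityʳ _))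

      Pw : P ⊡ w ≋ w
      Pw = ≋-trans (⊡-⊞ʳ P col (- 1# ◂ z)) λ i j → +-cong (PM≋M i zero)
        (trans (⊡-◂ʳ (- 1#) P z i j)
          (*-congˡ (trans (sym (⊡-assoc P A (A′ ⊡ col) i j)) (⊡-congʳ {B = A′ ⊡ col} fixed i j))))

      A′w : ∀ i j → (A′ ⊡ w) i j ≈ 0#
      A′w i j = trans (⊡-⊞ʳ A′ col (- 1# ◂ z) i j) (trans
        (+-congˡ (trans (⊡-◂ʳ (- 1#) A′ z i j) (*-congˡ
          (trans (sym (⊡-assoc A′ A (A′ ⊡ col) i j))
            (trans (⊡-congʳ {B = A′ ⊡ col} dual i j) (⊡-identityˡ (A′ ⊡ col) i j))))))
        (-1◂-inverse (A′ ⊡ col) i j))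

      reached : (∀ i → w i zero ≈ 0#) → Basis P M
      reached w≈0 = record
        { rank = rank ; A = A ; A′ = A′ ; fixed = fixed ; dual = dual
        ; spans = λ { i zero → trans (sym (+-identityˡ _)) (trans (+-congʳ (sym (w≈0 i))) (z+w i zero))
                    ; i (suc j) → spans i j } }

      module _ (p : Fin N) (y : Carrier) (yw≈1 : y * w p zero ≈ 1#) where
        -- The functional that reads the p-th coordinate of the part of a vector outside the span of
        -- `A`, scaled by the inverse of the pivot. It is 1 on `w` and vanishes on `A` and on the
        -- columns already reached.
        u : Mat 1 N
        u = y ◂ ((λ _ → Id p) ⊞ (- 1# ◂ (λ _ → (A ⊡ A′) p)))

        u⊡ : ∀ {m} (X : Mat N m) i j → (u ⊡ X) i j ≈ y * (X p j + - 1# * (A ⊡ (A′ ⊡ X)) p j)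
        u⊡ X i j = trans (⊡-◂ˡ y _ X i j) (*-congˡ (trans (⊡-⊞ˡ (λ _ → Id p) _ X i j)
          (+-cong (⊡-identityˡ X p j) (trans (⊡-◂ˡ (- 1#) (λ _ → (A ⊡ A′) p) X i j)
            (*-congˡ (⊡-assoc A A′ X p j))))))

        u⊡≈0 : ∀ {m} (X : Mat N m) j → (A ⊡ (A′ ⊡ X)) p j ≈ X p j → ∀ i → (u ⊡ X) i j ≈ 0#
        u⊡≈0 X j q i = trans (u⊡ X i j) (trans (*-congˡ
          (trans (+-congˡ (*-congˡ q)) (-1◂-inverse X p j))) (zeroʳ y))

        A⁺ : Mat N (suc rank)
        A⁺ i zero    = w i zero
        A⁺ i (suc a) = A i a

        A′⁺ : Mat (suc rank) N
        A′⁺ zero    = u zero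
        A′⁺ (suc a) = A′ a

        extended : Basis P M
        extended = record
          { rank = suc rank ; A = A⁺ ; A′ = A′⁺
          ; fixed = λ { i zero → Pw i zero ; i (suc a) → fixed i a }
          ; dual = λ
            { zero zero → trans (u⊡ w zero zero) (trans (*-congˡ
                (trans (+-congˡ (trans (*-congˡ (sum-zero λ a → trans (*-congˡ (A′w a zero)) (zeroʳ _))) (zeroʳ _)))
                  (+-identityʳ _))) yw≈1)
            ; zero (suc a) → u⊡≈0 A a (trans (⊡-congˡ {A = A} dual p a) (⊡-identityʳ A p a)) zero
            ; (suc a) zero → A′w a zero
            ; (suc a) (suc b) → dual a b }
          ; spans = λ
            { i zero → trans (sum-∷ _) (trans (+-congʳ (trans (*-congˡ (trans (u⊡ col zero zero) yw≈1)) (*-identityʳ _))) (z+w i zero))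
            ; i (suc j) → trans (sum-∷ _) (trans (+-congʳ (trans (*-congˡ (u⊡≈0 (λ i → M i ∘ suc) j (spans p j) zero)) (zeroʳ _)))
                (trans (+-identityˡ _) (spans i j))) } }

    basis : ∀ {N} n (P : Mat N N) (M : Mat N n) → P ⊡ M ≋ M → Basis P M
    basis zero    P M _ = record
      { rank = 0 ; A = λ _ () ; A′ = λ () ; fixed = λ _ () ; dual = λ () ; spans = λ _ () }
    basis (suc n) P M PM with b ← basis n P (λ i → M i ∘ suc) (λ i j → PM i (suc j))
      with allZero? (λ i → Extend.w P M PM b i zero)
    ... | inj₁ w≈0 = Extend.reached P M PM b w≈0
    ... | inj₂ (p , y , yw≈1) = Extend.extended P M PM b p y yw≈1

  record Splitting {N} (P : Mat N N) (r : ℕ) : Set (c ⊔ ℓ) where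
    field
      A    : Mat N r
      B    : Mat r N
      AB≋P : A ⊡ B ≋ P
      BA≋1 : B ⊡ A ≋ Id

  -- An idempotent fixes its own columns, so a basis `A` of their span with dual `A′` gives
  -- `P = A (A′ P)` and `(A′ P) A = A′ A = 1`. Cyclicity of the trace then identifies the trace of P
  -- with the rank.
  splitting : ∀ {N} (P : Mat N N) → P ⊡ P ≋ P → ∃ λ r → Splitting P r × tr P ≈ fromℕ r
  splitting {N} P PP≋P = rank , s , trans (sym (tr-cong AB≋P)) (trans (tr-comm A (A′ ⊡ P))
    (trans (tr-cong BA≋1) (tr-Id rank)))
    where
    open Basis (basis N P P PP≋P)
    s : Splitting P rank
    s = record
      { A = A ; B = A′ ⊡ P ; AB≋P = spans
      ; BA≋1 = ≋-trans (⊡-assoc A′ P A) (≋-trans (⊡-congˡ fixed) dual) }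
    open Splitting s using (AB≋P; BA≋1)

  -- In characteristic 0 the rank is 0, so P factors through the zero space.
  trace-zero : CharacteristicZero → ∀ {N} (P : Mat N N) → P ⊡ P ≋ P → tr P ≈ 0# → ∀ i j → P i j ≈ 0#
  trace-zero characteristic-0 P PP≋P trP≈0 i j with r , s , t ← splitting P PP≋P
      with ≡.refl ← characteristic-0 r (trans (sym t) trP≈0) = trans (sym (Splitting.AB≋P s i j)) (sum-[] _)

-- Schur orthogonality and matrix units from the Plancherel identity.

module MatrixUnits {c ℓ : Level} (R : CommutativeRing c ℓ)
  (zero⊎unit : LinearAlgebra.ZeroOrUnit R) (characteristic-0 : LinearAlgebra.CharacteristicZero R)
  {g : ℕ} {mul : Fin g → Fin g → Fin g} {ε : Fin g} {inv : Fin g → Fin g} (isGroup : IsGroup _≡_ mul ε inv)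
  {C q : ℕ} (F : LinearAlgebra.PlancherelFamily R mul ε C q) where

  open TensorPowers using (quotient-combine; remainder-combine)
  open LinearAlgebra R
  open IdempotentSplitting R zero⊎unit
  open import Relation.Binary.Reasoning.Setoid setoid

  open PlancherelFamily F

  private
    group : Group 0ℓ 0ℓ
    group = record { isGroup = isGroup }

  open import Algebra.Properties.Group group
    using (⁻¹-anti-homo-∙; ⁻¹-involutive; ε⁻¹≈ε)
    renaming ( \\-leftDividesˡ to cancelˡ; \\-leftDividesʳ to cancelˡ′
             ; //-rightDividesˡ to cancelʳ; //-rightDividesʳ to cancelʳ′)
  private module G = IsGroup isGroup

  infixl 8 _∙_
  infix  9 _⁻¹

  _∙_ : Fin g → Fin g → Fin g
  _∙_ = mul

  _⁻¹ : Fin g → Fin g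
  _⁻¹ = inv

  private
    u : ∀ c → Mat q q
    u c = r c ε

    u-ˡ : ∀ c x → u c ⊡ r c x ≋ r c x
    u-ˡ c x i j = trans (sym (r-homo c ε x i j)) (reflexive (≡.cong (λ y → r c y i j) (G.identityˡ x)))

    u-ʳ : ∀ c x → r c x ⊡ u c ≋ r c x
    u-ʳ c x i j = trans (sym (r-homo c x ε i j)) (reflexive (≡.cong (λ y → r c y i j) (G.identityʳ x)))

    uru : ∀ c x → (u c ⊡ r c x) ⊡ u c ≋ r c x
    uru c x = ≋-trans (⊡-congʳ (u-ˡ c x)) (u-ʳ c x)

    shiftˡ : ∀ h (f : Fin g → Carrier) → sum (λ x → f (h ∙ x)) ≈ sum f
    shiftˡ h = sum-reindex (h ∙_) (h ⁻¹ ∙_) (cancelˡ h) (cancelˡ′ h)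

    shiftʳ : ∀ h (f : Fin g → Carrier) → sum (λ x → f (x ∙ h)) ≈ sum f
    shiftʳ h = sum-reindex (_∙ h) (_∙ h ⁻¹) (cancelʳ h) (cancelʳ′ h)

  e : Fin C → Fin q → Fin q → Fin g → Carrier
  e c i j x = w c * r c (x ⁻¹) j i

  -- Φ is the Fourier transform and Ψ its inversion formula, which the
  -- Plancherel identity says is a left inverse.  Then Φ Ψ is an idempotent of
  -- trace g below the idempotent Δ of the same trace, so the two agree.
  module Schur where
    ⟨_⟩ : Fin (C ℕ.* (q ℕ.* q)) → Fin C × Fin q × Fin q
    ⟨ p ⟩ = quotient (q ℕ.* q) p , quotient {q} q s , remainder {q} q s
      where s = remainder {C} (q ℕ.* q) p

    triple : Fin C → Fin q → Fin q → Fin (C ℕ.* (q ℕ.* q))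
    triple c i j = combine c (combine i j)

    ⟨triple⟩ : ∀ c i j → ⟨ triple c i j ⟩ ≡ (c , i , j)
    ⟨triple⟩ c i j = ≡.cong₂ _,_ (quotient-combine c (combine i j)) (≡.cong₂ _,_
      (≡.trans (≡.cong (quotient {q} q) (remainder-combine c (combine i j))) (quotient-combine i j))
      (≡.trans (≡.cong (remainder {q} q) (remainder-combine c (combine i j))) (remainder-combine i j)))

    sum-triple : (f : Fin C × Fin q × Fin q → Carrier) →
                 sum (λ p → f ⟨ p ⟩) ≈ sum (λ c → sum (λ i → sum (λ j → f (c , i , j))))
    sum-triple f = trans
      (sum-remQuot C (q ℕ.* q) (λ c s → f (c , quotient {q} q s , remainder {q} q s)))
      (sum-cong λ c → sum-remQuot q q (λ i j → f (c , i , j)))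

    φ : Fin C × Fin q × Fin q → Fin g → Carrier
    φ (c , i , j) x = r c x i j

    ψ : Fin g → Fin C × Fin q × Fin q → Carrier
    ψ x (c , i , j) = e c i j x

    -- The matrix of X ↦ u X u on families of q × q matrices: the projection onto the entries within
    -- the degrees, which padding puts in the place of the identity.
    d : Fin C × Fin q × Fin q → Fin C × Fin q × Fin q → Carrier
    d (c , i , j) (c′ , i′ , j′) = [ c ≐ c′ ] * (u c i i′ * u c j′ j)

    Φ : Mat _ g
    Φ p = φ ⟨ p ⟩

    Ψ : Mat g _
    Ψ x p = ψ x ⟨ p ⟩

    Δ : Mat _ _
    Δ p p′ = d ⟨ p ⟩ ⟨ p′ ⟩

    select : ∀ c (f : Fin C → Fin q → Fin q → Carrier) →
             sum (λ c′ → sum (λ i → sum (λ j → [ c ≐ c′ ] * f c′ i j))) ≈ sum (λ i → sum (λ j → f c i j))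
    select c f = trans (sum-cong λ c′ → trans
        (sum-cong λ i → sym (*-sumˡ [ c ≐ c′ ] (f c′ i)))
        (sym (*-sumˡ [ c ≐ c′ ] (λ i → sum (f c′ i)))))
      (≐-sumˡ c (λ c′ → sum (λ i → sum (f c′ i))))

    ΨΦ : Ψ ⊡ Φ ≋ Id
    ΨΦ x y = begin
      sum (λ p → ψ x ⟨ p ⟩ * φ ⟨ p ⟩ y)
        ≈⟨ sum-triple (λ t → ψ x t * φ t y) ⟩
      sum (λ c → sum (λ i → sum (λ j → (w c * r c (x ⁻¹) j i) * r c y i j)))
        ≈⟨ sum-cong (λ c → sum-cong λ i → sum-cong λ j → *-assoc _ _ _) ⟩
      sum (λ c → sum (λ i → sum (λ j → w c * (r c (x ⁻¹) j i * r c y i j))))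
        ≈⟨ sum-cong (λ c → trans (sum-cong λ i → sym (*-sumˡ (w c) _)) (sym (*-sumˡ (w c) _))) ⟩
      sum (λ c → w c * sum (λ i → sum (λ j → r c (x ⁻¹) j i * r c y i j)))
        ≈⟨ sum-cong (λ c → *-congˡ (sum-comm (λ i j → r c (x ⁻¹) j i * r c y i j))) ⟩
      sum (λ c → w c * tr (r c (x ⁻¹) ⊡ r c y))
        ≈⟨ sum-cong (λ c → *-congˡ (tr-cong (r-homo c (x ⁻¹) y))) ⟨
      sum (λ c → w c * tr (r c (x ⁻¹ ∙ y)))
        ≈⟨ plancherel (x ⁻¹ ∙ y) ⟩
      [ ε ≐ x ⁻¹ ∙ y ]
        ≈⟨ ≐-iff (λ p → ≡.trans (≡.trans (≡.sym (G.identityʳ x)) (≡.cong (x ∙_) p)) (cancelˡ x y))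
                 (λ { ≡.refl → ≡.sym (G.inverseˡ x) }) ⟩
      [ x ≐ y ] ∎

    ΔΦ : Δ ⊡ Φ ≋ Φ
    ΔΦ p x = at ⟨ p ⟩
     where
     at : ∀ t → sum (λ p′ → d t ⟨ p′ ⟩ * φ ⟨ p′ ⟩ x) ≈ φ t x
     at (c , i , j) = begin
      sum (λ p′ → d (c , i , j) ⟨ p′ ⟩ * φ ⟨ p′ ⟩ x)
        ≈⟨ sum-triple (λ t → d (c , i , j) t * φ t x) ⟩
      sum (λ c′ → sum (λ i′ → sum (λ j′ → [ c ≐ c′ ] * (u c i i′ * u c j′ j) * r c′ x i′ j′)))
        ≈⟨ sum-cong (λ c′ → sum-cong λ i′ → sum-cong λ j′ → *-assoc _ _ _) ⟩
      sum (λ c′ → sum (λ i′ → sum (λ j′ → [ c ≐ c′ ] * ((u c i i′ * u c j′ j) * r c′ x i′ j′))))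
        ≈⟨ select c (λ c′ i′ j′ → (u c i i′ * u c j′ j) * r c′ x i′ j′) ⟩
      sum (λ i′ → sum (λ j′ → (u c i i′ * u c j′ j) * r c x i′ j′))
        ≈⟨ sum-comm _ ⟩
      sum (λ j′ → sum (λ i′ → (u c i i′ * u c j′ j) * r c x i′ j′))
        ≈⟨ sum-cong (λ j′ → trans (sum-cong λ i′ → xy∙z≈xz∙y _ _ _) (sym (*-sumʳ (u c j′ j) _))) ⟩
      ((u c ⊡ r c x) ⊡ u c) i j
        ≈⟨ uru c x i j ⟩
      r c x i j ∎

    ΨΔ : Ψ ⊡ Δ ≋ Ψ
    ΨΔ x p = at ⟨ p ⟩
     where
     regroup : ∀ a b s t → (a * b) * (s * t) ≈ a * ((t * b) * s)
     regroup a b s t = trans (*-assoc _ _ _) (*-congˡ (trans (x∙yz≈z∙xy _ _ _) (sym (*-assoc _ _ _))))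
     at : ∀ t → sum (λ p′ → ψ x ⟨ p′ ⟩ * d ⟨ p′ ⟩ t) ≈ ψ x t
     at (c , i , j) = begin
      sum (λ p′ → ψ x ⟨ p′ ⟩ * d ⟨ p′ ⟩ (c , i , j))
        ≈⟨ sum-triple (λ t → ψ x t * d t (c , i , j)) ⟩
      sum (λ c′ → sum (λ i′ → sum (λ j′ → e c′ i′ j′ x * ([ c′ ≐ c ] * (u c′ i′ i * u c′ j j′)))))
        ≈⟨ sum-cong (λ c′ → sum-cong λ i′ → sum-cong λ j′ →
             trans (x∙yz≈y∙xz _ _ _) (*-congʳ (≐-sym c′ c))) ⟩
      sum (λ c′ → sum (λ i′ → sum (λ j′ → [ c ≐ c′ ] * (e c′ i′ j′ x * (u c′ i′ i * u c′ j j′)))))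
        ≈⟨ select c (λ c′ i′ j′ → e c′ i′ j′ x * (u c′ i′ i * u c′ j j′)) ⟩
      sum (λ i′ → sum (λ j′ → (w c * r c (x ⁻¹) j′ i′) * (u c i′ i * u c j j′)))
        ≈⟨ sum-cong (λ i′ → trans (sum-cong λ j′ → regroup _ _ _ _)
             (trans (sym (*-sumˡ (w c) _)) (*-congˡ (sym (*-sumʳ (u c i′ i) _))))) ⟩
      sum (λ i′ → w c * ((u c ⊡ r c (x ⁻¹)) j i′ * u c i′ i))
        ≈⟨ *-sumˡ (w c) _ ⟨
      w c * ((u c ⊡ r c (x ⁻¹)) ⊡ u c) j i
        ≈⟨ *-congˡ (uru c (x ⁻¹) j i) ⟩
      e c i j x ∎
    ΔΔ : Δ ⊡ Δ ≋ Δ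
    ΔΔ p p″ = at ⟨ p ⟩ ⟨ p″ ⟩
     where
     regroup : ∀ a b s t → (a * b) * (s * t) ≈ (a * s) * (t * b)
     regroup a b s t = trans (*-assoc _ _ _) (trans (*-congˡ (x∙yz≈y∙zx _ _ _)) (sym (*-assoc _ _ _)))
     at : ∀ t t″ → sum (λ p′ → d t ⟨ p′ ⟩ * d ⟨ p′ ⟩ t″) ≈ d t t″
     at (c , i , j) (c″ , i″ , j″) = begin
      sum (λ p′ → d (c , i , j) ⟨ p′ ⟩ * d ⟨ p′ ⟩ (c″ , i″ , j″))
        ≈⟨ sum-triple (λ t → d (c , i , j) t * d t (c″ , i″ , j″)) ⟩
      sum (λ c′ → sum (λ i′ → sum (λ j′ → [ c ≐ c′ ] * (u c i i′ * u c j′ j) * ([ c′ ≐ c″ ] * (u c′ i′ i″ * u c′ j″ j′)))))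
        ≈⟨ sum-cong (λ c′ → sum-cong λ i′ → sum-cong λ j′ → *-assoc _ _ _) ⟩
      sum (λ c′ → sum (λ i′ → sum (λ j′ → [ c ≐ c′ ] * ((u c i i′ * u c j′ j) * ([ c′ ≐ c″ ] * (u c′ i′ i″ * u c′ j″ j′))))))
        ≈⟨ select c (λ c′ i′ j′ → (u c i i′ * u c j′ j) * ([ c′ ≐ c″ ] * (u c′ i′ i″ * u c′ j″ j′))) ⟩
      sum (λ i′ → sum (λ j′ → (u c i i′ * u c j′ j) * ([ c ≐ c″ ] * (u c i′ i″ * u c j″ j′))))
        ≈⟨ sum-cong (λ i′ → sum-cong λ j′ → trans (x∙yz≈y∙xz _ _ _) (*-congˡ (regroup _ _ _ _))) ⟩
      sum (λ i′ → sum (λ j′ → [ c ≐ c″ ] * ((u c i i′ * u c i′ i″) * (u c j″ j′ * u c j′ j))))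
        ≈⟨ trans (sum-cong λ i′ → sym (*-sumˡ [ c ≐ c″ ] _)) (sym (*-sumˡ [ c ≐ c″ ] _)) ⟩
      [ c ≐ c″ ] * sum (λ i′ → sum (λ j′ → (u c i i′ * u c i′ i″) * (u c j″ j′ * u c j′ j)))
        ≈⟨ *-congˡ (sum-*-sum _ _) ⟩
      [ c ≐ c″ ] * ((u c ⊡ u c) i i″ * (u c ⊡ u c) j″ j)
        ≈⟨ *-congˡ (*-cong (u-ˡ c ε i i″) (u-ˡ c ε j″ j)) ⟩
      [ c ≐ c″ ] * (u c i i″ * u c j″ j) ∎
    -- The trace is the sum of the squares of the degrees. As a degree is g times its weight, the
    -- Plancherel identity at ε makes this sum g.
    trΔ : tr Δ ≈ fromℕ g
    trΔ = begin
      sum (λ p → d ⟨ p ⟩ ⟨ p ⟩)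
        ≈⟨ sum-triple (λ t → d t t) ⟩
      sum (λ c → sum (λ i → sum (λ j → [ c ≐ c ] * (u c i i * u c j j))))
        ≈⟨ sum-cong (λ c → sum-cong λ i → sum-cong λ j → trans (*-congʳ (≐-refl c)) (*-identityˡ _)) ⟩
      sum (λ c → sum (λ i → sum (λ j → u c i i * u c j j)))
        ≈⟨ sum-cong (λ c → sum-*-sum _ _) ⟩
      sum (λ c → tr (u c) * tr (u c))
        ≈⟨ sum-cong (λ c → trans (*-congʳ (sym (weight c))) (*-assoc _ _ _)) ⟩
      sum (λ c → fromℕ g * (w c * tr (u c)))
        ≈⟨ *-sumˡ (fromℕ g) _ ⟨
      fromℕ g * sum (λ c → w c * tr (u c))
        ≈⟨ *-congˡ (trans (plancherel ε) (≐-refl ε)) ⟩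
      fromℕ g * 1#
        ≈⟨ *-identityʳ _ ⟩
      fromℕ g ∎

    P Q : Mat _ _
    Q = Φ ⊡ Ψ
    P = Δ ⊞ (- 1# ◂ Q)

    QQ : Q ⊡ Q ≋ Q
    QQ = ≋-trans (⊡-assoc Φ Ψ Q) (⊡-congˡ (≋-trans (≋-sym (⊡-assoc Ψ Φ Ψ)) (≋-trans (⊡-congʳ ΨΦ) (⊡-identityˡ Ψ))))

    ΔQ : Δ ⊡ Q ≋ Q
    ΔQ = ≋-trans (≋-sym (⊡-assoc Δ Φ Ψ)) (⊡-congʳ ΔΦ)

    QΔ : Q ⊡ Δ ≋ Q
    QΔ = ≋-trans (⊡-assoc Φ Ψ Δ) (⊡-congˡ ΨΔ)

    PQ : ∀ i j → (P ⊡ Q) i j ≈ 0#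
    PQ i j = trans (⊡-⊞ˡ Δ (- 1# ◂ Q) Q i j)
      (trans (+-cong (ΔQ i j) (trans (⊡-◂ˡ (- 1#) Q Q i j) (*-congˡ (QQ i j)))) (-1◂-inverse Q i j))

    PP : P ⊡ P ≋ P
    PP i j = trans (⊡-⊞ʳ P Δ (- 1# ◂ Q) i j) (trans (+-cong
      (trans (⊡-⊞ˡ Δ (- 1# ◂ Q) Δ i j) (+-cong (ΔΔ i j) (trans (⊡-◂ˡ (- 1#) Q Δ i j) (*-congˡ (QΔ i j)))))
      (trans (⊡-◂ʳ (- 1#) P Q i j) (trans (*-congˡ (PQ i j)) (zeroʳ _)))) (+-identityʳ _))

    trP : tr P ≈ 0#
    trP = begin
      tr P                      ≈⟨ tr-⊞ Δ (- 1# ◂ Q) ⟩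
      tr Δ + tr (- 1# ◂ Q)      ≈⟨ +-cong trΔ (sym (*-sumˡ (- 1#) _)) ⟩
      fromℕ g + - 1# * tr Q     ≈⟨ +-congˡ (*-congˡ (trans (tr-comm Φ Ψ) (trans (tr-cong ΨΦ) (tr-Id g)))) ⟩
      fromℕ g + - 1# * fromℕ g  ≈⟨ -1◂-inverse {1} {1} (λ _ _ → fromℕ g) Fin.zero Fin.zero ⟩
      0#                        ∎

    Q≋Δ : Q ≋ Δ
    Q≋Δ i j = begin
      Q i j                             ≈⟨ +-identityˡ _ ⟨
      0# + Q i j                        ≈⟨ +-congʳ (trace-zero characteristic-0 P PP trP i j) ⟨
      Δ i j + - 1# * Q i j + Q i j      ≈⟨ +-assoc _ _ _ ⟩
      Δ i j + (- 1# * Q i j + Q i j)    ≈⟨ +-congˡ (trans (+-comm _ _) (-1◂-inverse Q i j)) ⟩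
      Δ i j + 0#                        ≈⟨ +-identityʳ _ ⟩
      Δ i j                             ∎

  -- This is `Q≋Δ` read entry by entry. The two entries of `r c ε` are Kronecker deltas cut off at
  -- the degree.
  schur : ∀ c i j c′ i′ j′ → sum (λ x → r c x i j * e c′ i′ j′ x) ≈ [ c ≐ c′ ] * (r c ε i i′ * r c ε j′ j)
  schur c i j c′ i′ j′ = ≡.subst₂ (λ t t′ → sum (λ x → φ t x * ψ x t′) ≈ d t t′)
    (⟨triple⟩ c i j) (⟨triple⟩ c′ i′ j′) (Q≋Δ (triple c i j) (triple c′ i′ j′))
    where open Schur

  module Representation {N : ℕ} (ρ : Fin g → Mat N N)
    (ρ-homo : ∀ x y → ρ (x ∙ y) ≋ ρ x ⊡ ρ y) (ρ-ε : ρ ε ≋ Id) where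

    E : Fin C → Fin q → Fin q → Mat N N
    E c i j = Σᴹ λ x → e c i j x ◂ ρ x

    -- Substituting x ↦ h⁻¹ x in the sum moves h into the coefficient, where multiplicativity of
    -- `r c` expands it. The matrix units with fixed second index thus transform like the basis of
    -- the representation c.
    ρ-E : ∀ c h i j → ρ h ⊡ E c i j ≋ Σᴹ (λ l → r c h l i ◂ E c l j)
    ρ-E c h i j a b = begin
      (ρ h ⊡ E c i j) a b
        ≈⟨ ⊡-Σʳ (ρ h) (λ x → e c i j x ◂ ρ x) a b ⟩
      sum (λ x → (ρ h ⊡ (e c i j x ◂ ρ x)) a b)
        ≈⟨ sum-cong (λ x → trans (⊡-◂ʳ (e c i j x) (ρ h) (ρ x) a b) (*-congˡ (sym (ρ-homo h x a b)))) ⟩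
      sum (λ x → e c i j x * ρ (h ∙ x) a b)
        ≈⟨ sum-cong (λ x → *-congʳ (reflexive (≡.cong (e c i j) (cancelˡ′ h x)))) ⟨
      sum (λ x → e c i j (h ⁻¹ ∙ (h ∙ x)) * ρ (h ∙ x) a b)
        ≈⟨ shiftˡ h (λ y → e c i j (h ⁻¹ ∙ y) * ρ y a b) ⟩
      sum (λ y → e c i j (h ⁻¹ ∙ y) * ρ y a b)
        ≈⟨ sum-cong (λ y → trans (*-congʳ (e-shift y)) (*-sumʳ _ _)) ⟩
      sum (λ y → sum (λ l → r c h l i * e c l j y * ρ y a b))
        ≈⟨ sum-comm _ ⟩
      sum (λ l → sum (λ y → r c h l i * e c l j y * ρ y a b))
        ≈⟨ sum-cong (λ l → trans (sum-cong λ y → *-assoc _ _ _) (sym (*-sumˡ (r c h l i) _))) ⟩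
      sum (λ l → r c h l i * E c l j a b) ∎
      where
      e-shift : ∀ y → e c i j (h ⁻¹ ∙ y) ≈ sum (λ l → r c h l i * e c l j y)
      e-shift y = begin
        w c * r c ((h ⁻¹ ∙ y) ⁻¹) j i
          ≡⟨ ≡.cong (λ z → w c * r c z j i) (≡.trans (⁻¹-anti-homo-∙ (h ⁻¹) y) (≡.cong (y ⁻¹ ∙_) (⁻¹-involutive h))) ⟩
        w c * r c (y ⁻¹ ∙ h) j i
          ≈⟨ *-congˡ (r-homo c (y ⁻¹) h j i) ⟩
        w c * sum (λ l → r c (y ⁻¹) j l * r c h l i)
          ≈⟨ *-sumˡ (w c) _ ⟩
        sum (λ l → w c * (r c (y ⁻¹) j l * r c h l i))
          ≈⟨ sum-cong (λ l → x∙yz≈z∙xy _ _ _) ⟩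
        sum (λ l → r c h l i * e c l j y) ∎

    E-ρ : ∀ c h i j → E c i j ⊡ ρ h ≋ Σᴹ (λ l → r c h j l ◂ E c i l)
    E-ρ c h i j a b = begin
      (E c i j ⊡ ρ h) a b
        ≈⟨ ⊡-Σˡ (λ x → e c i j x ◂ ρ x) (ρ h) a b ⟩
      sum (λ x → ((e c i j x ◂ ρ x) ⊡ ρ h) a b)
        ≈⟨ sum-cong (λ x → trans (⊡-◂ˡ (e c i j x) (ρ x) (ρ h) a b) (*-congˡ (sym (ρ-homo x h a b)))) ⟩
      sum (λ x → e c i j x * ρ (x ∙ h) a b)
        ≈⟨ sum-cong (λ x → *-congʳ (reflexive (≡.cong (e c i j) (cancelʳ′ h x)))) ⟨
      sum (λ x → e c i j ((x ∙ h) ∙ h ⁻¹) * ρ (x ∙ h) a b)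
        ≈⟨ shiftʳ h (λ y → e c i j (y ∙ h ⁻¹) * ρ y a b) ⟩
      sum (λ y → e c i j (y ∙ h ⁻¹) * ρ y a b)
        ≈⟨ sum-cong (λ y → trans (*-congʳ (e-shift y)) (*-sumʳ _ _)) ⟩
      sum (λ y → sum (λ l → r c h j l * e c i l y * ρ y a b))
        ≈⟨ sum-comm _ ⟩
      sum (λ l → sum (λ y → r c h j l * e c i l y * ρ y a b))
        ≈⟨ sum-cong (λ l → trans (sum-cong λ y → *-assoc _ _ _) (sym (*-sumˡ (r c h j l) _))) ⟩
      sum (λ l → r c h j l * E c i l a b) ∎
      where
      e-shift : ∀ y → e c i j (y ∙ h ⁻¹) ≈ sum (λ l → r c h j l * e c i l y)
      e-shift y = begin
        w c * r c ((y ∙ h ⁻¹) ⁻¹) j i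
          ≡⟨ ≡.cong (λ z → w c * r c z j i) (≡.trans (⁻¹-anti-homo-∙ y (h ⁻¹)) (≡.cong (_∙ y ⁻¹) (⁻¹-involutive h))) ⟩
        w c * r c (h ∙ y ⁻¹) j i
          ≈⟨ *-congˡ (r-homo c h (y ⁻¹) j i) ⟩
        w c * sum (λ l → r c h j l * r c (y ⁻¹) l i)
          ≈⟨ *-sumˡ (w c) _ ⟩
        sum (λ l → w c * (r c h j l * r c (y ⁻¹) l i))
          ≈⟨ sum-cong (λ l → x∙yz≈y∙xz _ _ _) ⟩
        sum (λ l → r c h j l * e c i l y) ∎

    ε-E : ∀ c i j → Σᴹ (λ m → r c ε m i ◂ E c m j) ≋ E c i j
    ε-E c i j = ≋-trans (≋-sym (ρ-E c ε i j)) (≋-trans (⊡-congʳ ρ-ε) (⊡-identityˡ (E c i j)))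

    -- Expanding the left factor and moving each ρ(x) into the right one by `ρ-E` leaves a sum over
    -- x of products of coefficients, which `schur` evaluates. The remaining factor `r c′ ε m i` is
    -- absorbed by `ε-E`.
    E-E : ∀ c i j c′ k l → E c i j ⊡ E c′ k l ≋ ([ c′ ≐ c ] * r c′ ε j k) ◂ E c′ i l
    E-E c i j c′ k l a b = begin
      (E c i j ⊡ E c′ k l) a b
        ≈⟨ ⊡-Σˡ (λ x → e c i j x ◂ ρ x) (E c′ k l) a b ⟩
      sum (λ x → ((e c i j x ◂ ρ x) ⊡ E c′ k l) a b)
        ≈⟨ sum-cong (λ x → trans (⊡-◂ˡ (e c i j x) (ρ x) (E c′ k l) a b) (*-congˡ (ρ-E c′ x k l a b))) ⟩
      sum (λ x → e c i j x * sum (λ m → r c′ x m k * E c′ m l a b))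
        ≈⟨ sum-cong (λ x → trans (*-sumˡ (e c i j x) _) (sum-cong λ m →
             trans (sym (*-assoc _ _ _)) (*-congʳ (*-comm _ _)))) ⟩
      sum (λ x → sum (λ m → r c′ x m k * e c i j x * E c′ m l a b))
        ≈⟨ sum-comm _ ⟩
      sum (λ m → sum (λ x → r c′ x m k * e c i j x * E c′ m l a b))
        ≈⟨ sum-cong (λ m → trans (sym (*-sumʳ (E c′ m l a b) _)) (*-congʳ (schur c′ m k c i j))) ⟩
      sum (λ m → [ c′ ≐ c ] * (r c′ ε m i * r c′ ε j k) * E c′ m l a b)
        ≈⟨ sum-cong (λ m → trans (*-congʳ (x∙yz≈xz∙y _ _ _)) (*-assoc _ _ _)) ⟩
      sum (λ m → [ c′ ≐ c ] * r c′ ε j k * (r c′ ε m i * E c′ m l a b))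
        ≈⟨ *-sumˡ _ _ ⟨
      [ c′ ≐ c ] * r c′ ε j k * sum (λ m → r c′ ε m i * E c′ m l a b)
        ≈⟨ *-congˡ (ε-E c′ i l a b) ⟩
      [ c′ ≐ c ] * r c′ ε j k * E c′ i l a b ∎

    -- The coefficient of ρ(x) is the Plancherel sum at x⁻¹, so only the term at ε survives.
    ΣE : Σᴹ (λ c → Σᴹ (λ i → E c i i)) ≋ Id
    ΣE a b = begin
      sum (λ c → sum (λ i → sum (λ x → e c i i x * ρ x a b)))
        ≈⟨ sum-cong (λ c → sum-comm _) ⟩
      sum (λ c → sum (λ x → sum (λ i → e c i i x * ρ x a b)))
        ≈⟨ sum-comm _ ⟩
      sum (λ x → sum (λ c → sum (λ i → e c i i x * ρ x a b)))
        ≈⟨ sum-cong (λ x → sum-cong λ c → sym (*-sumʳ (ρ x a b) _)) ⟩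
      sum (λ x → sum (λ c → sum (λ i → e c i i x) * ρ x a b))
        ≈⟨ sum-cong (λ x → trans (sym (*-sumʳ (ρ x a b) _)) (*-congʳ (sum-cong λ c → sym (*-sumˡ (w c) _)))) ⟩
      sum (λ x → sum (λ c → w c * tr (r c (x ⁻¹))) * ρ x a b)
        ≈⟨ sum-cong (λ x → *-congʳ (trans (plancherel (x ⁻¹))
             (≐-iff (λ p → ≡.trans (≡.sym ε⁻¹≈ε) (≡.trans (≡.cong _⁻¹ p) (⁻¹-involutive x)))
                    (λ { ≡.refl → ≡.sym ε⁻¹≈ε })))) ⟩
      sum (λ x → [ ε ≐ x ] * ρ x a b)
        ≈⟨ ≐-sumˡ ε (λ x → ρ x a b) ⟩
      ρ ε a b
        ≈⟨ ρ-ε a b ⟩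
      Id a b ∎

    -- The hypothesis says that `o` lies within every degree: row `o` of each padded identity is a
    -- row of the true identity. This makes each `E c o o` a genuine idempotent.
    module _ (o : Fin q) (ε-row : ∀ c j → r c ε o j ≈ [ o ≐ j ]) where

      private
        ε-oo : ∀ c → r c ε o o ≈ 1#
        ε-oo c = trans (ε-row c o) (≐-refl o)

        E-oE : ∀ c i l → E c i o ⊡ E c o l ≋ E c i l
        E-oE c i l a b = trans (E-E c i o c o l a b)
          (trans (*-congʳ (trans (*-cong (≐-refl c) (ε-oo c)) (*-identityˡ 1#))) (*-identityˡ _))

      idempotent : ∀ c → E c o o ⊡ E c o o ≋ E c o o
      idempotent c = E-oE c o o

      -- The multiplicity of c is obtained by pairing the character of ρ with a single diagonal
      -- coefficient of `r c` instead of its whole character.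
      tr-E : ∀ c → tr (E c o o) ≈ w c * sum (λ x → r c (x ⁻¹) o o * tr (ρ x))
      tr-E c = begin
        sum (λ i → sum (λ x → e c o o x * ρ x i i))  ≈⟨ sum-comm _ ⟩
        sum (λ x → sum (λ i → e c o o x * ρ x i i))  ≈⟨ sum-cong (λ x → trans (sym (*-sumˡ (e c o o x) _)) (*-assoc _ _ _)) ⟩
        sum (λ x → w c * (r c (x ⁻¹) o o * tr (ρ x))) ≈⟨ *-sumˡ (w c) _ ⟨
        w c * sum (λ x → r c (x ⁻¹) o o * tr (ρ x))  ∎

      -- Only the images of the `E c o o` need bases; the matrix units `E c j o` and `E c o j` carry
      -- these to and from the other copies. Everything then follows from the multiplication rule
      -- `E-E`.
      decompose : ∀ {m : Fin C → ℕ} → (∀ c → Splitting (E c o o) (m c)) → Decomposition o r ρ m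
      decompose {m} split = record
        { A = A′ ; B = B′
        ; intertwineˡ = λ c x j a b → begin
            (ρ x ⊡ A′ c j) a b                                 ≈⟨ ⊡-assoc (ρ x) (E c j o) (A c) a b ⟨
            ((ρ x ⊡ E c j o) ⊡ A c) a b                        ≈⟨ ⊡-congʳ {B = A c} (ρ-E c x j o) a b ⟩
            (Σᴹ (λ l → r c x l j ◂ E c l o) ⊡ A c) a b         ≈⟨ ⊡-Σˡ (λ l → r c x l j ◂ E c l o) (A c) a b ⟩
            sum (λ l → ((r c x l j ◂ E c l o) ⊡ A c) a b)      ≈⟨ sum-cong (λ l → ⊡-◂ˡ (r c x l j) (E c l o) (A c) a b) ⟩
            sum (λ l → r c x l j * A′ c l a b)                 ∎
        ; intertwineʳ = λ c x l a b → begin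
            (B′ c l ⊡ ρ x) a b                                 ≈⟨ ⊡-assoc (B c) (E c o l) (ρ x) a b ⟩
            (B c ⊡ (E c o l ⊡ ρ x)) a b                        ≈⟨ ⊡-congˡ {A = B c} (E-ρ c x o l) a b ⟩
            (B c ⊡ Σᴹ (λ j → r c x l j ◂ E c o j)) a b         ≈⟨ ⊡-Σʳ (B c) (λ j → r c x l j ◂ E c o j) a b ⟩
            sum (λ j → (B c ⊡ (r c x l j ◂ E c o j)) a b)      ≈⟨ sum-cong (λ j → ⊡-◂ʳ (r c x l j) (B c) (E c o j) a b) ⟩
            sum (λ j → r c x l j * B′ c j a b)                 ∎
        ; dual = λ c j a b → trans (B′A′ c c j a b)
            (*-cong (trans (*-cong (≐-refl c) (ε-row c j)) (*-identityˡ _)) (BPA c a b))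
        ; orthogonal = λ c c′ j c≢c′ a b → trans (B′A′ c c′ j a b)
            (trans (*-congʳ (trans (*-congʳ (≐-≢ (c≢c′ ∘ ≡.sym))) (zeroˡ _))) (zeroˡ _))
        ; complete = λ a b → trans (sum-cong λ c → sum-cong λ j → A′B′ c j j a b) (ΣE a b)
        ; coeff = λ c j → e c j o
        ; spanned = λ c j → A′B′ c j o
        }
        where
        A : ∀ c → Mat N (m c)
        A c = Splitting.A (split c)
        B : ∀ c → Mat (m c) N
        B c = Splitting.B (split c)
        A′ : ∀ c → Fin q → Mat N (m c)
        A′ c j = E c j o ⊡ A c
        B′ : ∀ c → Fin q → Mat (m c) N
        B′ c j = B c ⊡ E c o j

        A′B′ : ∀ c i j → A′ c i ⊡ B′ c j ≋ E c i j
        A′B′ c i j a b = begin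
          ((E c i o ⊡ A c) ⊡ (B c ⊡ E c o j)) a b   ≈⟨ ⊡-assoc (E c i o) (A c) (B c ⊡ E c o j) a b ⟩
          (E c i o ⊡ (A c ⊡ (B c ⊡ E c o j))) a b   ≈⟨ ⊡-congˡ {A = E c i o} (≋-sym (⊡-assoc (A c) (B c) (E c o j))) a b ⟩
          (E c i o ⊡ ((A c ⊡ B c) ⊡ E c o j)) a b   ≈⟨ ⊡-congˡ {A = E c i o} (⊡-congʳ {B = E c o j} (Splitting.AB≋P (split c))) a b ⟩
          (E c i o ⊡ (E c o o ⊡ E c o j)) a b       ≈⟨ ⊡-congˡ {A = E c i o} (E-oE c o j) a b ⟩
          (E c i o ⊡ E c o j) a b                   ≈⟨ E-oE c i j a b ⟩
          E c i j a b                               ∎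

        BPA : ∀ c → B c ⊡ (E c o o ⊡ A c) ≋ Id
        BPA c a b = begin
          (B c ⊡ (E c o o ⊡ A c)) a b    ≈⟨ ⊡-congˡ {A = B c} (⊡-congʳ {B = A c} (≋-sym (Splitting.AB≋P (split c)))) a b ⟩
          (B c ⊡ ((A c ⊡ B c) ⊡ A c)) a b ≈⟨ ⊡-congˡ {A = B c} (≋-trans (⊡-assoc (A c) (B c) (A c)) (⊡-congˡ BA)) a b ⟩
          (B c ⊡ (A c ⊡ Id)) a b          ≈⟨ ⊡-congˡ {A = B c} (⊡-identityʳ (A c)) a b ⟩
          (B c ⊡ A c) a b                 ≈⟨ BA a b ⟩
          Id a b                          ∎
          where BA = Splitting.BA≋1 (split c)

        B′A′ : ∀ c c′ j a b → (B′ c o ⊡ A′ c′ j) a b ≈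
               ([ c′ ≐ c ] * r c′ ε o j) * (B c ⊡ (E c′ o o ⊡ A c′)) a b
        B′A′ c c′ j a b = begin
          ((B c ⊡ E c o o) ⊡ (E c′ j o ⊡ A c′)) a b  ≈⟨ ⊡-assoc (B c) (E c o o) (E c′ j o ⊡ A c′) a b ⟩
          (B c ⊡ (E c o o ⊡ (E c′ j o ⊡ A c′))) a b  ≈⟨ ⊡-congˡ {A = B c} (≋-sym (⊡-assoc (E c o o) (E c′ j o) (A c′))) a b ⟩
          (B c ⊡ ((E c o o ⊡ E c′ j o) ⊡ A c′)) a b  ≈⟨ ⊡-congˡ {A = B c} (⊡-congʳ {B = A c′} (E-E c o o c′ j o)) a b ⟩
          (B c ⊡ ((s ◂ E c′ o o) ⊡ A c′)) a b        ≈⟨ ⊡-congˡ {A = B c} (⊡-◂ˡ s (E c′ o o) (A c′)) a b ⟩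
          (B c ⊡ (s ◂ (E c′ o o ⊡ A c′))) a b        ≈⟨ ⊡-◂ʳ s (B c) (E c′ o o ⊡ A c′) a b ⟩
          s * (B c ⊡ (E c′ o o ⊡ A c′)) a b          ∎
          where s = [ c′ ≐ c ] * r c′ ε o j

-- Commuting matrices and their blocks.

module Commutant {c ℓ : Level} (R : CommutativeRing c ℓ) {C q g N : ℕ} {o : Fin q}
  {r : Fin C → Fin g → LinearAlgebra.Mat R q q} {ρ : Fin g → LinearAlgebra.Mat R N N} {m : Fin C → ℕ}
  (D : LinearAlgebra.Decomposition R o r ρ m) where

  open LinearAlgebra R
  open Decomposition D
  open import Relation.Binary.Reasoning.Setoid setoid

  Commutes : Mat N N → Set ℓ
  Commutes X = ∀ x → X ⊡ ρ x ≋ ρ x ⊡ X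

  block : ∀ c → Mat N N → Mat (m c) (m c)
  block c X = B c o ⊡ (X ⊡ A c o)

  block-cong : ∀ c {X Y} → X ≋ Y → block c X ≋ block c Y
  block-cong c p = ⊡-congˡ (⊡-congʳ p)

  BA≋1 : ∀ c → B c o ⊡ A c o ≋ Id
  BA≋1 c a b = trans (dual c o a b) (trans (*-congʳ (≐-refl o)) (*-identityˡ _))

  -- X commutes with `A c j ⊡ B c o`, a combination of group matrices; multiply by `A c o` on the
  -- right and use `B c o ⊡ A c o = 1`. One block of X thereby governs its action on all copies of
  -- c.
  commutes-A : ∀ X → Commutes X → ∀ c j → X ⊡ A c j ≋ A c j ⊡ block c X
  commutes-A X X-ρ c j a b = begin
    (X ⊡ A c j) a b                           ≈⟨ ⊡-congˡ {A = X} (≋-sym AA≋A) a b ⟩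
    (X ⊡ ((A c j ⊡ B c o) ⊡ A c o)) a b       ≈⟨ ⊡-assoc X (A c j ⊡ B c o) (A c o) a b ⟨
    ((X ⊡ (A c j ⊡ B c o)) ⊡ A c o) a b       ≈⟨ ⊡-congʳ {B = A c o} X-AB a b ⟩
    (((A c j ⊡ B c o) ⊡ X) ⊡ A c o) a b       ≈⟨ ⊡-assoc (A c j ⊡ B c o) X (A c o) a b ⟩
    ((A c j ⊡ B c o) ⊡ (X ⊡ A c o)) a b       ≈⟨ ⊡-assoc (A c j) (B c o) (X ⊡ A c o) a b ⟩
    (A c j ⊡ block c X) a b                   ∎
    where
    AA≋A : (A c j ⊡ B c o) ⊡ A c o ≋ A c j
    AA≋A = ≋-trans (⊡-assoc (A c j) (B c o) (A c o)) (≋-trans (⊡-congˡ (BA≋1 c)) (⊡-identityʳ (A c j)))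
    X-AB : X ⊡ (A c j ⊡ B c o) ≋ (A c j ⊡ B c o) ⊡ X
    X-AB a b = begin
      (X ⊡ (A c j ⊡ B c o)) a b                       ≈⟨ ⊡-congˡ {A = X} (spanned c j) a b ⟩
      (X ⊡ Σᴹ (λ x → coeff c j x ◂ ρ x)) a b          ≈⟨ ⊡-Σʳ X (λ x → coeff c j x ◂ ρ x) a b ⟩
      sum (λ x → (X ⊡ (coeff c j x ◂ ρ x)) a b)       ≈⟨ sum-cong (λ x → trans (⊡-◂ʳ (coeff c j x) X (ρ x) a b)
                                                           (trans (*-congˡ (X-ρ x a b)) (sym (⊡-◂ˡ (coeff c j x) (ρ x) X a b)))) ⟩
      sum (λ x → ((coeff c j x ◂ ρ x) ⊡ X) a b)       ≈⟨ ⊡-Σˡ (λ x → coeff c j x ◂ ρ x) X a b ⟨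
      (Σᴹ (λ x → coeff c j x ◂ ρ x) ⊡ X) a b          ≈⟨ ⊡-congʳ {B = X} (spanned c j) a b ⟨
      ((A c j ⊡ B c o) ⊡ X) a b                       ∎

  block-⊡ : ∀ c X Y → Commutes Y → block c (X ⊡ Y) ≋ block c X ⊡ block c Y
  block-⊡ c X Y Y-ρ a b = begin
    (B c o ⊡ ((X ⊡ Y) ⊡ A c o)) a b           ≈⟨ ⊡-congˡ {A = B c o} (⊡-assoc X Y (A c o)) a b ⟩
    (B c o ⊡ (X ⊡ (Y ⊡ A c o))) a b           ≈⟨ ⊡-congˡ {A = B c o} (⊡-congˡ {A = X} (commutes-A Y Y-ρ c o)) a b ⟩
    (B c o ⊡ (X ⊡ (A c o ⊡ block c Y))) a b   ≈⟨ ⊡-congˡ {A = B c o} (⊡-assoc X (A c o) (block c Y)) a b ⟨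
    (B c o ⊡ ((X ⊡ A c o) ⊡ block c Y)) a b   ≈⟨ ⊡-assoc (B c o) (X ⊡ A c o) (block c Y) a b ⟨
    (block c X ⊡ block c Y) a b               ∎

  block-Id : ∀ c → block c Id ≋ Id
  block-Id c = ≋-trans (⊡-congˡ (⊡-identityˡ (A c o))) (BA≋1 c)

  block-⊞ : ∀ c X Y → block c (X ⊞ Y) ≋ block c X ⊞ block c Y
  block-⊞ c X Y = ≋-trans (⊡-congˡ (⊡-⊞ˡ X Y (A c o))) (⊡-⊞ʳ (B c o) (X ⊡ A c o) (Y ⊡ A c o))

  block-◂ : ∀ c s X → block c (s ◂ X) ≋ s ◂ block c X
  block-◂ c s X = ≋-trans (⊡-congˡ (⊡-◂ˡ s X (A c o))) (⊡-◂ʳ s (B c o) (X ⊡ A c o))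

  -- The matrix that acts on each multiplicity space by `Y c` and trivially on the factor carrying
  -- the representation.
  assemble : (∀ c → Mat (m c) (m c)) → Mat N N
  assemble Y = Σᴹ λ c → Σᴹ λ j → A c j ⊡ (Y c ⊡ B c j)

  assemble-cong : ∀ {Y Y′} → (∀ c → Y c ≋ Y′ c) → assemble Y ≋ assemble Y′
  assemble-cong p a b = sum-cong λ c → sum-cong λ j → ⊡-congˡ {A = A c j} (⊡-congʳ {B = B c j} (p c)) a b

  assemble-block : ∀ X → Commutes X → assemble (λ c → block c X) ≋ X
  assemble-block X X-ρ a b = begin
    assemble (λ c → block c X) a b
      ≈⟨ sum-cong (λ c → sum-cong λ j → term c j) ⟩
    sum (λ c → sum (λ j → (X ⊡ (A c j ⊡ B c j)) a b))
      ≈⟨ sum-cong (λ c → ⊡-Σʳ X (λ j → A c j ⊡ B c j) a b) ⟨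
    sum (λ c → (X ⊡ Σᴹ (λ j → A c j ⊡ B c j)) a b)
      ≈⟨ ⊡-Σʳ X (λ c → Σᴹ (λ j → A c j ⊡ B c j)) a b ⟨
    (X ⊡ Σᴹ (λ c → Σᴹ (λ j → A c j ⊡ B c j))) a b
      ≈⟨ ⊡-congˡ {A = X} complete a b ⟩
    (X ⊡ Id) a b
      ≈⟨ ⊡-identityʳ X a b ⟩
    X a b ∎
    where
    term : ∀ c j → (A c j ⊡ (block c X ⊡ B c j)) a b ≈ (X ⊡ (A c j ⊡ B c j)) a b
    term c j = begin
      (A c j ⊡ (block c X ⊡ B c j)) a b  ≈⟨ ⊡-assoc (A c j) (block c X) (B c j) a b ⟨
      ((A c j ⊡ block c X) ⊡ B c j) a b  ≈⟨ ⊡-congʳ {B = B c j} (commutes-A X X-ρ c j) a b ⟨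
      ((X ⊡ A c j) ⊡ B c j) a b          ≈⟨ ⊡-assoc X (A c j) (B c j) a b ⟩
      (X ⊡ (A c j ⊡ B c j)) a b          ∎

  -- Both products expand into the same double sum of `r c x l j` times `A c l ⊡ (Y c ⊡ B c j)`: on
  -- the right of `assemble Y` the index j arises from `intertwineʳ`, on the left the index l from
  -- `intertwineˡ`.
  assemble-commutes : ∀ Y → Commutes (assemble Y)
  assemble-commutes Y x a b = begin
    (assemble Y ⊡ ρ x) a b
      ≈⟨ ⊡-Σˡ (λ c → Σᴹ λ j → A c j ⊡ (Y c ⊡ B c j)) (ρ x) a b ⟩
    sum (λ c → (Σᴹ (λ j → A c j ⊡ (Y c ⊡ B c j)) ⊡ ρ x) a b)
      ≈⟨ sum-cong (λ c → ⊡-Σˡ (λ j → A c j ⊡ (Y c ⊡ B c j)) (ρ x) a b) ⟩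
    sum (λ c → sum (λ l → ((A c l ⊡ (Y c ⊡ B c l)) ⊡ ρ x) a b))
      ≈⟨ sum-cong (λ c → sum-cong λ l → right c l) ⟩
    sum (λ c → sum (λ l → sum (λ j → r c x l j * (A c l ⊡ (Y c ⊡ B c j)) a b)))
      ≈⟨ sum-cong (λ c → sum-comm _) ⟩
    sum (λ c → sum (λ j → sum (λ l → r c x l j * (A c l ⊡ (Y c ⊡ B c j)) a b)))
      ≈⟨ sum-cong (λ c → sum-cong λ j → left c j) ⟨
    sum (λ c → sum (λ j → (ρ x ⊡ (A c j ⊡ (Y c ⊡ B c j))) a b))
      ≈⟨ sum-cong (λ c → ⊡-Σʳ (ρ x) (λ j → A c j ⊡ (Y c ⊡ B c j)) a b) ⟨
    sum (λ c → (ρ x ⊡ Σᴹ (λ j → A c j ⊡ (Y c ⊡ B c j))) a b)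
      ≈⟨ ⊡-Σʳ (ρ x) (λ c → Σᴹ λ j → A c j ⊡ (Y c ⊡ B c j)) a b ⟨
    (ρ x ⊡ assemble Y) a b ∎
    where
    right : ∀ c l → ((A c l ⊡ (Y c ⊡ B c l)) ⊡ ρ x) a b ≈ sum (λ j → r c x l j * (A c l ⊡ (Y c ⊡ B c j)) a b)
    right c l = begin
      ((A c l ⊡ (Y c ⊡ B c l)) ⊡ ρ x) a b
        ≈⟨ ⊡-assoc (A c l) (Y c ⊡ B c l) (ρ x) a b ⟩
      (A c l ⊡ ((Y c ⊡ B c l) ⊡ ρ x)) a b
        ≈⟨ ⊡-congˡ {A = A c l} (≋-trans (⊡-assoc (Y c) (B c l) (ρ x)) (≋-trans (⊡-congˡ {A = Y c} (intertwineʳ c x l))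
             (⊡-Σʳ (Y c) (λ j → r c x l j ◂ B c j)))) a b ⟩
      (A c l ⊡ Σᴹ (λ j → Y c ⊡ (r c x l j ◂ B c j))) a b
        ≈⟨ ⊡-Σʳ (A c l) (λ j → Y c ⊡ (r c x l j ◂ B c j)) a b ⟩
      sum (λ j → (A c l ⊡ (Y c ⊡ (r c x l j ◂ B c j))) a b)
        ≈⟨ sum-cong (λ j → trans (⊡-congˡ {A = A c l} (⊡-◂ʳ (r c x l j) (Y c) (B c j)) a b)
             (⊡-◂ʳ (r c x l j) (A c l) (Y c ⊡ B c j) a b)) ⟩
      sum (λ j → r c x l j * (A c l ⊡ (Y c ⊡ B c j)) a b) ∎
    left : ∀ c j → (ρ x ⊡ (A c j ⊡ (Y c ⊡ B c j))) a b ≈ sum (λ l → r c x l j * (A c l ⊡ (Y c ⊡ B c j)) a b)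
    left c j = begin
      (ρ x ⊡ (A c j ⊡ (Y c ⊡ B c j))) a b
        ≈⟨ ⊡-assoc (ρ x) (A c j) (Y c ⊡ B c j) a b ⟨
      ((ρ x ⊡ A c j) ⊡ (Y c ⊡ B c j)) a b
        ≈⟨ ⊡-congʳ {B = Y c ⊡ B c j} (intertwineˡ c x j) a b ⟩
      (Σᴹ (λ l → r c x l j ◂ A c l) ⊡ (Y c ⊡ B c j)) a b
        ≈⟨ ⊡-Σˡ (λ l → r c x l j ◂ A c l) (Y c ⊡ B c j) a b ⟩
      sum (λ l → ((r c x l j ◂ A c l) ⊡ (Y c ⊡ B c j)) a b)
        ≈⟨ sum-cong (λ l → ⊡-◂ˡ (r c x l j) (A c l) (Y c ⊡ B c j) a b) ⟩
      sum (λ l → r c x l j * (A c l ⊡ (Y c ⊡ B c j)) a b) ∎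

  block-assemble : ∀ Y c → block c (assemble Y) ≋ Y c
  block-assemble Y c a b = begin
    (B c o ⊡ (assemble Y ⊡ A c o)) a b
      ≈⟨ ⊡-assoc (B c o) (assemble Y) (A c o) a b ⟨
    ((B c o ⊡ assemble Y) ⊡ A c o) a b
      ≈⟨ ⊡-congʳ {B = A c o} B-assemble a b ⟩
    ((Y c ⊡ B c o) ⊡ A c o) a b
      ≈⟨ ⊡-assoc (Y c) (B c o) (A c o) a b ⟩
    (Y c ⊡ (B c o ⊡ A c o)) a b
      ≈⟨ ⊡-congˡ {A = Y c} (BA≋1 c) a b ⟩
    (Y c ⊡ Id) a b
      ≈⟨ ⊡-identityʳ (Y c) a b ⟩
    Y c a b ∎
    where
    B-assemble : B c o ⊡ assemble Y ≋ Y c ⊡ B c o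
    B-assemble a b = begin
      (B c o ⊡ assemble Y) a b
        ≈⟨ ⊡-Σʳ (B c o) (λ c′ → Σᴹ λ j → A c′ j ⊡ (Y c′ ⊡ B c′ j)) a b ⟩
      sum (λ c′ → (B c o ⊡ Σᴹ (λ j → A c′ j ⊡ (Y c′ ⊡ B c′ j))) a b)
        ≈⟨ sum-cong (λ c′ → ⊡-Σʳ (B c o) (λ j → A c′ j ⊡ (Y c′ ⊡ B c′ j)) a b) ⟩
      sum (λ c′ → sum (λ j → (B c o ⊡ (A c′ j ⊡ (Y c′ ⊡ B c′ j))) a b))
        ≈⟨ sum-cong (λ c′ → sum-cong λ j → ⊡-assoc (B c o) (A c′ j) (Y c′ ⊡ B c′ j) a b) ⟨
      sum (λ c′ → sum (λ j → ((B c o ⊡ A c′ j) ⊡ (Y c′ ⊡ B c′ j)) a b))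
        ≈⟨ sum-single c _ (λ c′ c′≢c → sum-zero λ j → sum-zero λ k →
             trans (*-congʳ (orthogonal c c′ j (c′≢c ∘ ≡.sym) a k)) (zeroˡ _)) ⟩
      sum (λ j → ((B c o ⊡ A c j) ⊡ (Y c ⊡ B c j)) a b)
        ≈⟨ sum-cong (λ j → trans (⊡-congʳ {B = Y c ⊡ B c j} (dual c j) a b)
             (trans (⊡-◂ˡ [ o ≐ j ] Id (Y c ⊡ B c j) a b) (*-congˡ (⊡-identityˡ (Y c ⊡ B c j) a b)))) ⟩
      sum (λ j → [ o ≐ j ] * (Y c ⊡ B c j) a b)
        ≈⟨ ≐-sumˡ o (λ j → (Y c ⊡ B c j) a b) ⟩
      (Y c ⊡ B c o) a b ∎

-- Change of scalars.

module BaseChange {c ℓ c′ ℓ′ : Level} (K : CommutativeRing c ℓ) (L : CommutativeRing c′ ℓ′) where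

  private
    module K = LinearAlgebra K
    module L = LinearAlgebra L

  module Along (ι : K.Carrier → L.Carrier)
      (ι-cong : ∀ {x y} → x K.≈ y → ι x L.≈ ι y)
      (ι-+ : ∀ x y → ι (x K.+ y) L.≈ ι x L.+ ι y)
      (ι-* : ∀ x y → ι (x K.* y) L.≈ ι x L.* ι y)
      (ι-0 : ι K.0# L.≈ L.0#) (ι-1 : ι K.1# L.≈ L.1#)
    where

    ιᴹ : ∀ {m n} → K.Mat m n → L.Mat m n
    ιᴹ A i j = ι (A i j)

    ι-sum : ∀ {n} (f : Fin n → K.Carrier) → ι (K.sum f) L.≈ L.sum (λ i → ι (f i))
    ι-sum {zero}  f = L.trans (ι-cong (K.sum-[] f)) (L.trans ι-0 (L.sym (L.sum-[] _)))
    ι-sum {suc n} f = L.trans (ι-cong (K.sum-∷ f)) (L.trans (ι-+ _ _)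
      (L.trans (L.+-congˡ (ι-sum (f ∘ suc))) (L.sym (L.sum-∷ _))))

    ι-≐ : ∀ {n} (i j : Fin n) → ι K.[ i ≐ j ] L.≈ L.[ i ≐ j ]
    ι-≐ i j with i ≟ j
    ... | yes _ = ι-1
    ... | no  _ = ι-0

    ι-⊡ : ∀ {l m n} (A : K.Mat l m) (B : K.Mat m n) → ιᴹ (A K.⊡ B) L.≋ ιᴹ A L.⊡ ιᴹ B
    ι-⊡ A B i j = L.trans (ι-sum _) (L.sum-cong λ k → ι-* _ _)

    module _ {C q g N : ℕ} {o : Fin q} {r : Fin C → Fin g → K.Mat q q}
      {ρ : Fin g → K.Mat N N} {m : Fin C → ℕ} (D : K.Decomposition o r ρ m)
      (ρ′ : Fin g → L.Mat N N) (ρ≋ρ′ : ∀ x → ιᴹ (ρ x) L.≋ ρ′ x) where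
      private module D = K.Decomposition D

      -- A decomposition consists of equations between matrices, so a ring homomorphism carries it
      -- along with the multiplicities unchanged.
      transport : L.Decomposition o (λ c x → ιᴹ (r c x)) ρ′ m
      transport = record
        { A = λ c j → ιᴹ (D.A c j)
        ; B = λ c j → ιᴹ (D.B c j)
        ; intertwineˡ = λ c x j a b → L.trans (L.⊡-congʳ {B = ιᴹ (D.A c j)} (L.≋-sym (ρ≋ρ′ x)) a b)
            (L.trans (L.sym (ι-⊡ (ρ x) (D.A c j) a b)) (L.trans (ι-cong (D.intertwineˡ c x j a b))
              (L.trans (ι-sum _) (L.sum-cong λ l → ι-* _ _))))
        ; intertwineʳ = λ c x l a b → L.trans (L.⊡-congˡ {A = ιᴹ (D.B c l)} (L.≋-sym (ρ≋ρ′ x)) a b)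
            (L.trans (L.sym (ι-⊡ (D.B c l) (ρ x) a b)) (L.trans (ι-cong (D.intertwineʳ c x l a b))
              (L.trans (ι-sum _) (L.sum-cong λ l → ι-* _ _))))
        ; dual = λ c j a b → L.trans (L.sym (ι-⊡ (D.B c o) (D.A c j) a b)) (L.trans (ι-cong (D.dual c j a b))
            (L.trans (ι-* _ _) (L.*-cong (ι-≐ o j) (ι-≐ a b))))
        ; orthogonal = λ c c′ j c≢c′ a b → L.trans (L.sym (ι-⊡ (D.B c o) (D.A c′ j) a b))
            (L.trans (ι-cong (D.orthogonal c c′ j c≢c′ a b)) ι-0)
        ; complete = λ a b → L.trans (L.sum-cong λ c → L.trans (L.sum-cong λ j → L.sym (ι-⊡ (D.A c j) (D.B c j) a b))
            (L.sym (ι-sum _))) (L.trans (L.sym (ι-sum _)) (L.trans (ι-cong (D.complete a b)) (ι-≐ a b)))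
        ; coeff = λ c j x → ι (D.coeff c j x)
        ; spanned = λ c j a b → L.trans (L.sym (ι-⊡ (D.A c j) (D.B c o) a b)) (L.trans (ι-cong (D.spanned c j a b))
            (L.trans (ι-sum _) (L.sum-cong λ x → L.trans (ι-* _ _) (L.*-congˡ (ρ≋ρ′ x a b)))))
        }

-- Permutation matrices and their tensor powers.

module PermutationMatrices {c ℓ : Level} (R : CommutativeRing c ℓ) where

  open import Data.Fin.Properties using (combine-remQuot)
  open TensorPowers
  open LinearAlgebra R
  open import Relation.Binary.Reasoning.Setoid setoid

  permute : ∀ {n} → (Fin n → Fin n) → Mat n n
  permute f i j = [ f i ≐ j ]

  permute-∘ : ∀ {n} (f g : Fin n → Fin n) → permute f ⊡ permute g ≋ permute (g ∘ f)
  permute-∘ f g i j = ≐-sumˡ (f i) (λ k → [ g k ≐ j ])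

  ≐-combine : ∀ {m n} (a : Fin m) (b : Fin n) p → [ combine a b ≐ p ] ≈ [ a ≐ quotient {m} n p ] * [ b ≐ remainder {m} n p ]
  ≐-combine {m} {n} a b p with a ≟ quotient {m} n p
  ... | no a≢ = trans (≐-≢ λ r → a≢ (≡.trans (≡.sym (quotient-combine a b)) (≡.cong (quotient {m} n) r))) (sym (zeroˡ _))
  ... | yes ≡.refl = trans (≐-iff {k = b} {l = remainder {m} n p}
          (λ r → ≡.trans (≡.sym (remainder-combine (quotient {m} n p) b)) (≡.cong (remainder {m} n) r))
          (λ r → ≡.trans (≡.cong (combine (quotient {m} n p)) r) (combine-remQuot {m} n p)))
        (sym (*-identityˡ _))

  -- A tuple is fixed exactly when all its coordinates are, so the number of fixed points is
  -- multiplicative.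
  tr-tensor : ∀ {n} k (f : Fin n → Fin n) t → tr (permute f) ≈ fromℕ t →
              (∀ a b → fromℕ (a ℕ.* b) ≈ fromℕ a * fromℕ b) → tr (permute (tensor k f)) ≈ fromℕ (t ℕ.^ k)
  tr-tensor zero        f t f-t fromℕ-* = tr-Id 1
  tr-tensor {n} (suc k) f t f-t fromℕ-* = begin
    sum (λ p → [ tensor (suc k) f p ≐ p ])
      ≈⟨ sum-cong (λ p → ≐-combine (f (quotient {n} (n ℕ.^ k) p)) (tensor k f (remainder {n} (n ℕ.^ k) p)) p) ⟩
    sum (λ p → [ f (quotient {n} (n ℕ.^ k) p) ≐ quotient {n} (n ℕ.^ k) p ] *
               [ tensor k f (remainder {n} (n ℕ.^ k) p) ≐ remainder {n} (n ℕ.^ k) p ])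
      ≈⟨ sum-remQuot n (n ℕ.^ k) (λ a b → [ f a ≐ a ] * [ tensor k f b ≐ b ]) ⟩
    sum (λ a → sum (λ b → [ f a ≐ a ] * [ tensor k f b ≐ b ]))
      ≈⟨ sum-*-sum _ _ ⟩
    tr (permute f) * tr (permute (tensor k f))
      ≈⟨ *-cong f-t (tr-tensor k f t f-t fromℕ-*) ⟩
    fromℕ t * fromℕ (t ℕ.^ k)
      ≈⟨ fromℕ-* t (t ℕ.^ k) ⟨
    fromℕ (t ℕ.^ suc k) ∎

-- Centralizer algebras as products of matrix algebras.

module Centralizers where

  open import Defs
  open import Data.Fin.Base using (splitAt; _↑ˡ_; _↑ʳ_)
  open import Data.Fin.Properties using (splitAt-↑ˡ; splitAt-↑ʳ; splitAt-join; join-splitAt)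
  open LinearAlgebra ℂ-commutativeRing
  open import Algebra.Properties.Ring ring using (-1*x≈-x)
  open import Relation.Binary.Reasoning.Setoid setoid

  ∑≈sum : ∀ {n} (f : Fin n → ℂ) → ∑ f ≈ sum f
  ∑≈sum f = reflexive (≡.sym (sum≡Sum f))

  *ᴹ≋⊡ : ∀ {l m n} (X : Matrix l m) (Y : Matrix m n) → X *ᴹ Y ≋ X ⊡ Y
  *ᴹ≋⊡ X Y i j = ∑≈sum _

  -- Coordinates that exhibit B as a product of n matrix algebras. A nested sum of `⊕` and `⊠`
  -- becomes one family indexed by `Fin n`, against which the isomorphism can be built uniformly.
  record Blocks (B : ℂ-Algebra) (n : ℕ) (d : Fin n → ℕ) : Set where
    private module B = ℂ-Algebra B
    field
      π     : ∀ c → B.Carrier → Matrix (d c) (d c)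
      build : (∀ c → Matrix (d c) (d c)) → B.Carrier
      π-cong      : ∀ c {x y} → x B.≈ y → π c x ≋ π c y
      π-injective : ∀ {x y} → (∀ c → π c x ≋ π c y) → x B.≈ y
      π-build     : ∀ Y c → π c (build Y) ≋ Y c
      π-+ : ∀ c x y → π c (x B.+ y) ≋ π c x ⊞ π c y
      π-* : ∀ c x y → π c (x B.* y) ≋ π c x *ᴹ π c y
      π-1 : ∀ c → π c B.1# ≋ Id
      π-· : ∀ c s x → π c (s B.· x) ≋ s ◂ π c x
      π-0 : ∀ c i j → π c B.0# i j ≈ 0#
      π-neg : ∀ c x i j → π c (B.- x) i j ≈ - π c x i j

  M-blocks : ∀ d → Blocks (M d) 1 (λ _ → d)
  M-blocks d = record
    { π = λ _ X → X ; build = λ Y → Y zero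
    ; π-cong = λ _ p → p ; π-injective = λ p → p zero ; π-build = λ { Y zero i j → refl }
    ; π-+ = λ _ _ _ _ _ → refl ; π-* = λ _ _ _ _ _ → refl ; π-1 = λ _ _ _ → refl
    ; π-· = λ _ _ _ _ _ → refl ; π-0 = λ _ _ _ → refl ; π-neg = λ _ _ _ _ → refl }

  ⊠-blocks : ∀ n d → Blocks (n ⊠ M d) n (λ _ → d)
  ⊠-blocks n d = record
    { π = λ c x → x c ; build = λ Y → Y
    ; π-cong = λ c p → p c ; π-injective = λ p → p ; π-build = λ _ _ _ _ → refl
    ; π-+ = λ _ _ _ _ _ → refl ; π-* = λ _ _ _ _ _ → refl ; π-1 = λ _ _ _ → refl
    ; π-· = λ _ _ _ _ _ → refl ; π-0 = λ _ _ _ → refl ; π-neg = λ _ _ _ _ → refl }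

  join : ∀ {A : Set} m {n} → (Fin m → A) → (Fin n → A) → Fin (m ℕ.+ n) → A
  join m f g c = [ f , g ]′ (splitAt m c)

  module Join {A B : ℂ-Algebra} {m n : ℕ} {d : Fin m → ℕ} {e : Fin n → ℕ}
              (a : Blocks A m d) (b : Blocks B n e) where
    private
      module a = Blocks a
      module b = Blocks b
      module AB = ℂ-Algebra (A ⊕ B)

    dim : Fin m ⊎ Fin n → ℕ
    dim = [ d , e ]′

    Block : Fin m ⊎ Fin n → Set
    Block s = Matrix (dim s) (dim s)

    π′ : ∀ s → AB.Carrier → Block s
    π′ (inj₁ c) (x , _) = a.π c x
    π′ (inj₂ c) (_ , y) = b.π c y

    -- The size of a block depends on its index, so the block has to be transported along the
    -- equation saying that `splitAt` undoes `Fin.join`.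
    at : (∀ c → Matrix (join m d e c) (join m d e c)) → ∀ s → Block s
    at Y s = ≡.subst Block (splitAt-join m n s) (Y (Fin.join m n s))

    at-splitAt : ∀ (Y : ∀ c → Matrix (join m d e c) (join m d e c)) {c c′} → c′ ≡ c → (q : splitAt m c′ ≡ splitAt m c) → ≡.subst Block q (Y c′) ≋ Y c
    at-splitAt Y ≡.refl ≡.refl i j = refl

    build′ : (∀ c → Matrix (join m d e c) (join m d e c)) → AB.Carrier
    build′ Y = a.build (at Y ∘ inj₁) , b.build (at Y ∘ inj₂)

    π′-build : ∀ Y s → π′ s (build′ Y) ≋ at Y s
    π′-build Y (inj₁ c) = a.π-build (at Y ∘ inj₁) c
    π′-build Y (inj₂ c) = b.π-build (at Y ∘ inj₂) c

    injective : ∀ {x y} → (∀ c → π′ (splitAt m c) x ≋ π′ (splitAt m c) y) → x AB.≈ y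
    injective {x} {y} p =
      a.π-injective (λ c → ≡.subst (λ s → π′ s x ≋ π′ s y) (splitAt-↑ˡ m c n) (p (c ↑ˡ n))) ,
      b.π-injective (λ c → ≡.subst (λ s → π′ s x ≋ π′ s y) (splitAt-↑ʳ m n c) (p (m ↑ʳ c)))

    both : {P : Fin m ⊎ Fin n → Set} → (∀ c → P (inj₁ c)) → (∀ c → P (inj₂ c)) → ∀ c → P (splitAt m c)
    both {P} f g c = Sum.[_,_] {C = P} f g (splitAt m c)

  infixr 5 _⊕-blocks_

  _⊕-blocks_ : ∀ {A B m n d e} → Blocks A m d → Blocks B n e → Blocks (A ⊕ B) (m ℕ.+ n) (join m d e)
  _⊕-blocks_ {A} {B} {m} {n} {d} {e} a b = record
    { π = λ c → π′ (splitAt m c)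
    ; build = build′
    ; π-cong = λ c {x} {y} p → both {λ s → π′ s x ≋ π′ s y} (λ c → a.π-cong c (proj₁ p)) (λ c → b.π-cong c (proj₂ p)) c
    ; π-injective = injective
    ; π-build = λ Y c → ≋-trans (π′-build Y (splitAt m c)) (at-splitAt Y (join-splitAt m n c) (splitAt-join m n (splitAt m c)))
    ; π-+ = λ c (x , x′) (y , y′) → both {λ s → π′ s _ ≋ π′ s _ ⊞ π′ s _} (λ c → a.π-+ c x y) (λ c → b.π-+ c x′ y′) c
    ; π-* = λ c (x , x′) (y , y′) → both {λ s → π′ s _ ≋ π′ s _ *ᴹ π′ s _} (λ c → a.π-* c x y) (λ c → b.π-* c x′ y′) c
    ; π-1 = both {λ s → π′ s _ ≋ Id} a.π-1 b.π-1
    ; π-· = λ c s (x , x′) → both {λ t → π′ t _ ≋ s ◂ π′ t _} (λ c → a.π-· c s x) (λ c → b.π-· c s x′) c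
    ; π-0 = both {λ s → ∀ i j → π′ s _ i j ≈ 0#} a.π-0 b.π-0
    ; π-neg = λ c (x , x′) → both {λ s → ∀ i j → π′ s _ i j ≈ - π′ s _ i j} (λ c → a.π-neg c x) (λ c → b.π-neg c x′) c
    }
    where
    open Join a b
    module a = Blocks a
    module b = Blocks b

  -- The theorem indexes the representation by the elements of a group, the decomposition by
  -- numbers. The maps `el` and `ix` connect the two, and `ρ-ix` ensures that commuting with the
  -- numbered matrices is commuting with all.
  module _ {C q g N : ℕ} {o : Fin q} {r : Fin C → Fin g → Mat q q} {m : Fin C → ℕ}
    {I : Set} (ρ : I → Matrix N N) (el : Fin g → I) (ix : I → Fin g)
    (ρ-ix : ∀ h → ρ (el (ix h)) ≋ ρ h) (D : Decomposition o r (ρ ∘ el) m)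
    {B : ℂ-Algebra} (blocks : Blocks B C m) where

    open Commutant ℂ-commutativeRing D
    open Blocks blocks
    open CommutingEndomorphism
    private
      module B = ℂ-Algebra B
      End = centralizerAlgebra ρ
      module End = ℂ-Algebra End

      toMat : CommutingEndomorphism ρ → Mat N N
      toMat f i j = fun f (λ k → Id k j) i

      fun-sum : ∀ (f : CommutingEndomorphism ρ) {n} (F : Fin n → Fin N → ℂ) i →
                fun f (λ k → sum (λ a → F a k)) i ≈ sum (λ a → fun f (F a) i)
      fun-sum f {zero}  F i = trans (⟦⟧-cong f (λ k → sum-[] _) i) (trans (0ᴹ-homo f i) (sym (sum-[] _)))
      fun-sum f {suc n} F i = trans (⟦⟧-cong f (λ k → sum-∷ _) i) (trans (+ᴹ-homo f _ _ i)
        (trans (+-congˡ (fun-sum f (F ∘ suc) i)) (sym (sum-∷ _))))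

      -- A commuting endomorphism is a mere function with linearity laws; expanding v in the
      -- standard basis shows that its matrix determines it.
      toMat-fun : ∀ (f : CommutingEndomorphism ρ) v i → fun f v i ≈ sum (λ k → toMat f i k * v k)
      toMat-fun f v i = begin
        fun f v i                                       ≈⟨ ⟦⟧-cong f (λ k → sym (trans (sum-cong λ a → *-comm _ _) (≐-sumˡ k v))) i ⟩
        fun f (λ k → sum (λ a → v a * [ k ≐ a ])) i     ≈⟨ fun-sum f (λ a k → v a * [ k ≐ a ]) i ⟩
        sum (λ a → fun f (λ k → v a * [ k ≐ a ]) i)     ≈⟨ sum-cong (λ a → trans (*ₗ-homo f (v a) _ i) (*-comm _ _)) ⟩
        sum (λ k → toMat f i k * v k)                   ∎

      toMat-commutes : ∀ (f : CommutingEndomorphism ρ) → Commutes (toMat f)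
      toMat-commutes f x i j = begin
        sum (λ k → toMat f i k * ρ (el x) k j)          ≈⟨ toMat-fun f (λ k → ρ (el x) k j) i ⟨
        fun f (λ k → ρ (el x) k j) i                    ≈⟨ ⟦⟧-cong f (λ k → sym (trans (∑≈sum _) (≐-sumʳ j (ρ (el x) k)))) i ⟩
        fun f (ρ (el x) *ᵛ (λ k → Id k j)) i            ≈⟨ commutes f (el x) (λ k → Id k j) i ⟩
        (ρ (el x) *ᵛ fun f (λ k → Id k j)) i            ≈⟨ ∑≈sum _ ⟩
        (ρ (el x) ⊡ toMat f) i j                        ∎

      app : Mat N N → (Fin N → ℂ) → Fin N → ℂ
      app X v i = sum λ k → X i k * v k

      app-cong : ∀ X {v w} → (∀ i → v i ≈ w i) → ∀ i → app X v i ≈ app X w i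
      app-cong X p i = sum-cong λ k → *-congˡ {x = X i k} (p k)

      app-+ : ∀ X v w i → app X (λ k → v k + w k) i ≈ app X v i + app X w i
      app-+ X v w i = trans (sum-cong λ k → distribˡ (X i k) (v k) (w k))
        (sum-+ (λ k → X i k * v k) (λ k → X i k * w k))

      app-0 : ∀ X i → app X (λ _ → 0#) i ≈ 0#
      app-0 X i = sum-zero λ k → zeroʳ (X i k)

      app-◂ : ∀ X s v i → app X (λ k → s * v k) i ≈ s * app X v i
      app-◂ X s v i = trans (sum-cong λ k → x∙yz≈y∙xz (X i k) s (v k)) (sym (*-sumˡ s (λ k → X i k * v k)))

      app-neg : ∀ X v i → app X (λ k → - v k) i ≈ - app X v i
      app-neg X v i = trans (app-cong X (λ k → sym (-1*x≈-x (v k))) i)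
        (trans (app-◂ X (- 1#) v i) (-1*x≈-x (app X v i)))

      app-app : ∀ X Y v i → app X (app Y v) i ≈ app (X ⊡ Y) v i
      app-app X Y v i = sym (⊡-assoc X Y (λ k (_ : Fin 1) → v k) i zero)

      app-commutes : ∀ X → Commutes X → ∀ h v i → app X (ρ h *ᵛ v) i ≈ (ρ h *ᵛ app X v) i
      app-commutes X X-ρ h v i = begin
        app X (ρ h *ᵛ v) i               ≈⟨ app-cong X (λ k → ∑≈sum (λ l → ρ h k l * v l)) i ⟩
        app X (app (ρ h) v) i            ≈⟨ app-app X (ρ h) v i ⟩
        app (X ⊡ ρ h) v i                ≈⟨ sum-cong (λ k → *-congʳ {x = v k} (X-ρh i k)) ⟩
        app (ρ h ⊡ X) v i                ≈⟨ app-app (ρ h) X v i ⟨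
        app (ρ h) (app X v) i            ≈⟨ ∑≈sum (λ l → ρ h i l * app X v l) ⟨
        (ρ h *ᵛ app X v) i               ∎
        where
        X-ρh : X ⊡ ρ h ≋ ρ h ⊡ X
        X-ρh = ≋-trans (⊡-congˡ {A = X} (≋-sym (ρ-ix h)))
          (≋-trans (X-ρ (ix h)) (⊡-congʳ {B = X} (ρ-ix h)))

      fromMat : (X : Mat N N) → Commutes X → CommutingEndomorphism ρ
      fromMat X X-ρ = record
        { fun = app X
        ; isLinear = record
          { +ᴹ-isGroupHomomorphism = record
            { isMonoidHomomorphism = record
              { isMagmaHomomorphism = record
                { isRelHomomorphism = record { cong = app-cong X }
                ; homo = app-+ X }
              ; ε-homo = app-0 X }
            ; ⁻¹-homo = app-neg X }
          ; *ₗ-homo = app-◂ X }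
        ; commutes = app-commutes X X-ρ }

      toMat-fromMat : ∀ X X-ρ → toMat (fromMat X X-ρ) ≋ X
      toMat-fromMat X X-ρ i j = ⊡-identityʳ X i j

      toMat-cong : ∀ (f f′ : CommutingEndomorphism ρ) → f End.≈ f′ → toMat f ≋ toMat f′
      toMat-cong f f′ p i j = p (λ k → Id k j) i

      toMat-injective : ∀ (f f′ : CommutingEndomorphism ρ) → toMat f ≋ toMat f′ → f End.≈ f′
      toMat-injective f f′ p v i = trans (toMat-fun f v i)
        (trans (sum-cong λ k → *-congʳ (p i k)) (sym (toMat-fun f′ v i)))

      toMat-* : ∀ (f f′ : CommutingEndomorphism ρ) → toMat (f End.* f′) ≋ toMat f ⊡ toMat f′
      toMat-* f f′ i j = toMat-fun f (fun f′ (λ k → Id k j)) i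

      coords : CommutingEndomorphism ρ → ∀ c → Mat (m c) (m c)
      coords f c = block c (toMat f)

      ⟦_⟧ : CommutingEndomorphism ρ → B.Carrier
      ⟦ f ⟧ = build (coords f)

      π⟦⟧ : ∀ (f : CommutingEndomorphism ρ) c → π c ⟦ f ⟧ ≋ coords f c
      π⟦⟧ f = π-build (coords f)

      coords-injective : ∀ (f f′ : CommutingEndomorphism ρ) → (∀ c → coords f c ≋ coords f′ c) → f End.≈ f′
      coords-injective f f′ p = toMat-injective f f′ (≋-trans (≋-sym (assemble-block (toMat f) (toMat-commutes f)))
        (≋-trans (assemble-cong p) (assemble-block (toMat f′) (toMat-commutes f′))))

      ⟦⟧-· : ∀ s (f : CommutingEndomorphism ρ) → ⟦ s End.· f ⟧ B.≈ s B.· ⟦ f ⟧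
      ⟦⟧-· s f = π-injective λ c → ≋-trans (π⟦⟧ (s End.· f) c) (≋-trans (block-◂ c s (toMat f))
        (≋-trans (λ i j → *-congˡ (sym (π⟦⟧ f c i j))) (≋-sym (π-· c s ⟦ f ⟧))))

      ⟦⟧-+ : ∀ (f f′ : CommutingEndomorphism ρ) → ⟦ f End.+ f′ ⟧ B.≈ ⟦ f ⟧ B.+ ⟦ f′ ⟧
      ⟦⟧-+ f f′ = π-injective λ c → ≋-trans (π⟦⟧ (f End.+ f′) c) (≋-trans (block-⊞ c (toMat f) (toMat f′))
        (≋-trans (λ i j → +-cong (sym (π⟦⟧ f c i j)) (sym (π⟦⟧ f′ c i j))) (≋-sym (π-+ c ⟦ f ⟧ ⟦ f′ ⟧))))

      hom-cong : ∀ {f f′ : CommutingEndomorphism ρ} → f End.≈ f′ → ⟦ f ⟧ B.≈ ⟦ f′ ⟧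
      hom-cong {f} {f′} p = π-injective λ c → ≋-trans (π⟦⟧ f c) (≋-trans (block-cong c (toMat-cong f f′ p))
        (≋-sym (π⟦⟧ f′ c)))

      ⟦⟧-* : ∀ (f f′ : CommutingEndomorphism ρ) → ⟦ f End.* f′ ⟧ B.≈ ⟦ f ⟧ B.* ⟦ f′ ⟧
      ⟦⟧-* f f′ = π-injective λ c → ≋-trans (π⟦⟧ (f End.* f′) c) (≋-trans (block-cong c (toMat-* f f′))
        (≋-trans (block-⊡ c (toMat f) (toMat f′) (toMat-commutes f′)) (≋-trans
          (⊡-cong (≋-sym (π⟦⟧ f c)) (≋-sym (π⟦⟧ f′ c))) (≋-trans (≋-sym (*ᴹ≋⊡ (π c ⟦ f ⟧) (π c ⟦ f′ ⟧)))
            (≋-sym (π-* c ⟦ f ⟧ ⟦ f′ ⟧))))))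

      ⟦⟧-1 : ⟦ End.1# ⟧ B.≈ B.1#
      ⟦⟧-1 = π-injective λ c → ≋-trans (π⟦⟧ End.1# c) (≋-trans (block-Id c) (≋-sym (π-1 c)))

      ⟦⟧-0 : ⟦ End.0# ⟧ B.≈ B.0#
      ⟦⟧-0 = π-injective λ c → ≋-trans (π⟦⟧ End.0# c) λ i j → trans
        (sum-zero λ k → trans (*-congˡ (sum-zero λ l → zeroˡ _)) (zeroʳ _)) (sym (π-0 c i j))

      ⟦⟧-neg : ∀ (f : CommutingEndomorphism ρ) → ⟦ End.- f ⟧ B.≈ B.- ⟦ f ⟧
      ⟦⟧-neg f = π-injective λ c → ≋-trans (π⟦⟧ (End.- f) c) λ i j → begin
        block c (λ i j → - toMat f i j) i j  ≈⟨ block-cong c (λ i j → sym (-1*x≈-x _)) i j ⟩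
        block c (- 1# ◂ toMat f) i j         ≈⟨ block-◂ c (- 1#) (toMat f) i j ⟩
        - 1# * coords f c i j                ≈⟨ -1*x≈-x _ ⟩
        - coords f c i j                     ≈⟨ -‿cong (π⟦⟧ f c i j) ⟨
        - π c ⟦ f ⟧ i j                      ≈⟨ π-neg c ⟦ f ⟧ i j ⟨
        π c (B.- ⟦ f ⟧) i j                  ∎

      preimage : B.Carrier → CommutingEndomorphism ρ
      preimage y = fromMat (assemble (λ c → π c y)) (assemble-commutes (λ c → π c y))

      ⟦preimage⟧ : ∀ y → ⟦ preimage y ⟧ B.≈ y
      ⟦preimage⟧ y = π-injective λ c → ≋-trans (π⟦⟧ (preimage y) c) (≋-trans
        (block-cong c (toMat-fromMat _ (assemble-commutes (λ c → π c y)))) (block-assemble (λ c → π c y) c))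

    -- The map sends an endomorphism to the element of B with the same blocks. As blocks separate
    -- the elements of either side, each law is verified block by block; `assemble` supplies
    -- preimages.
    centralizer≃ : centralizerAlgebra ρ ≃ B
    centralizer≃ = record
      { ⟦_⟧ = ⟦_⟧
      ; isRingIsomorphism = record
        { isRingMonomorphism = record
          { isRingHomomorphism = record
            { isSemiringHomomorphism = record
              { isNearSemiringHomomorphism = record
                { +-isMonoidHomomorphism = record
                  { isMagmaHomomorphism = record
                    { isRelHomomorphism = record { cong = λ {f} {f′} → hom-cong {f} {f′} } ; homo = ⟦⟧-+ }
                  ; ε-homo = ⟦⟧-0 }
                ; *-homo = ⟦⟧-* }
              ; 1#-homo = ⟦⟧-1 }
            ; -‿homo = ⟦⟧-neg }
          ; injective = λ {f} {f′} p → coords-injective f f′ λ c →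
              ≋-trans (≋-sym (π⟦⟧ f c)) (≋-trans (π-cong c p) (π⟦⟧ f′ c)) }
        ; surjective = λ y → preimage y , λ {f} p → B.trans (hom-cong {f} {preimage y} p) (⟦preimage⟧ y) }
      ; ·-homo = ⟦⟧-· }

-- The field ℚ(i), the ring ℤ[i] and their embedding into ℂ.

module GaussianNumbers where

  open import Defs using (ℂ; fromℚ; fromℚ²; _≈ℂ_; _≈ℝ_; re≈; im≈; vanishing; eventually; pointwise⇒≈ℂ; _+ℂ_; _*ℂ_; 0ℂ; 1ℂ)
  import Defs
  open import Data.Integer.Base using (+_)
  open import Data.Nat.Properties using (≤-refl)
  open import Data.Rational.Base using (∣_∣; _/_; _+_; _*_; _-_; -_; toℚᵘ)
  open import Data.Rational.Unnormalised.Base as ℚᵘ using (mkℚᵘ; *≡*)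
  import Data.Rational.Unnormalised.Properties as ℚᵘₚ
  open import Data.Rational.Solver using (module +-*-Solver)
  open import Relation.Binary.PropositionalEquality
  open +-*-Solver using (solve; con; _:+_; _:*_; _:-_; :-_; _:=_)

  infix 5 _+i_

  record ℚi : Set where
    constructor _+i_
    field re im : ℚ

  open ℚi public

  _+ᵢ_ _*ᵢ_ : ℚi → ℚi → ℚi
  (a +i b) +ᵢ (c +i d) = (a + c) +i (b + d)
  (a +i b) *ᵢ (c +i d) = (a * c - b * d) +i (a * d + b * c)

  ℚi-ring : CommutativeRing 0ℓ 0ℓ
  ℚi-ring = record
    { Carrier = ℚi ; _≈_ = _≡_ ; _+_ = _+ᵢ_ ; _*_ = _*ᵢ_
    ; -_ = λ (a +i b) → (- a) +i (- b) ; 0# = 0ℚ +i 0ℚ ; 1# = 1ℚ +i 0ℚ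
    ; isCommutativeRing = record
      { isRing = record
        { +-isAbelianGroup = record
          { isGroup = record
            { isMonoid = record
              { isSemigroup = record
                { isMagma = record { isEquivalence = isEquivalence ; ∙-cong = cong₂ _+ᵢ_ }
                ; assoc = λ x y z → cong₂ _+i_ (ℚₚ.+-assoc (re x) (re y) (re z)) (ℚₚ.+-assoc (im x) (im y) (im z)) }
              ; identity = (λ x → cong₂ _+i_ (ℚₚ.+-identityˡ (re x)) (ℚₚ.+-identityˡ (im x))) ,
                           (λ x → cong₂ _+i_ (ℚₚ.+-identityʳ (re x)) (ℚₚ.+-identityʳ (im x))) }
            ; inverse = (λ x → cong₂ _+i_ (ℚₚ.+-inverseˡ (re x)) (ℚₚ.+-inverseˡ (im x))) ,
                        (λ x → cong₂ _+i_ (ℚₚ.+-inverseʳ (re x)) (ℚₚ.+-inverseʳ (im x)))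
            ; ⁻¹-cong = cong (λ x → (- re x) +i (- im x)) }
          ; comm = λ x y → cong₂ _+i_ (ℚₚ.+-comm (re x) (re y)) (ℚₚ.+-comm (im x) (im y)) }
        ; *-cong = cong₂ _*ᵢ_
        ; *-assoc = λ (a +i b) (c +i d) (e +i f) → cong₂ _+i_
            (solve 6 (λ a b c d e f → (a :* c :- b :* d) :* e :- (a :* d :+ b :* c) :* f :=
              a :* (c :* e :- d :* f) :- b :* (c :* f :+ d :* e)) refl a b c d e f)
            (solve 6 (λ a b c d e f → (a :* c :- b :* d) :* f :+ (a :* d :+ b :* c) :* e :=
              a :* (c :* f :+ d :* e) :+ b :* (c :* e :- d :* f)) refl a b c d e f)
        ; *-identity = *-identityˡ , λ x → trans (*-comm x (1ℚ +i 0ℚ)) (*-identityˡ x)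
        ; distrib = *-distribˡ , λ x y z → trans (*-comm (y +ᵢ z) x)
            (trans (*-distribˡ x y z) (cong₂ _+ᵢ_ (*-comm x y) (*-comm x z))) }
      ; *-comm = *-comm } }
    where
    *-comm : ∀ x y → x *ᵢ y ≡ y *ᵢ x
    *-comm (a +i b) (c +i d) = cong₂ _+i_
      (cong₂ _-_ (ℚₚ.*-comm a c) (ℚₚ.*-comm b d))
      (trans (ℚₚ.+-comm (a * d) (b * c)) (cong₂ _+_ (ℚₚ.*-comm b c) (ℚₚ.*-comm a d)))
    *-identityˡ : ∀ x → (1ℚ +i 0ℚ) *ᵢ x ≡ x
    *-identityˡ (a +i b) = cong₂ _+i_
      (solve 2 (λ a b → con 1ℚ :* a :- con 0ℚ :* b := a) refl a b)
      (solve 2 (λ a b → con 1ℚ :* b :+ con 0ℚ :* a := b) refl a b)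
    *-distribˡ : ∀ x y z → x *ᵢ (y +ᵢ z) ≡ (x *ᵢ y) +ᵢ (x *ᵢ z)
    *-distribˡ (a +i b) (c +i d) (e +i f) = cong₂ _+i_
      (solve 6 (λ a b c d e f → a :* (c :+ e) :- b :* (d :+ f) := (a :* c :- b :* d) :+ (a :* e :- b :* f)) refl a b c d e f)
      (solve 6 (λ a b c d e f → a :* (d :+ f) :+ b :* (c :+ e) := (a :* d :+ b :* c) :+ (a :* f :+ b :* e)) refl a b c d e f)

  private
    square-nonneg : ∀ a → 0ℚ ℚ.≤ a * a
    square-nonneg a with ℚₚ.≤-total 0ℚ a
    ... | inj₁ 0≤a = subst (ℚ._≤ a * a) (ℚₚ.*-zeroˡ a) (ℚₚ.*-monoʳ-≤-nonNeg a {{ℚ.nonNegative 0≤a}} 0≤a)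
    ... | inj₂ a≤0 = subst (ℚ._≤ a * a) (ℚₚ.*-zeroˡ a) (ℚₚ.*-monoʳ-≤-nonPos a {{ℚ.nonPositive a≤0}} a≤0)

    square≡0 : ∀ a → a * a ≡ 0ℚ → a ≡ 0ℚ
    square≡0 a aa≡0 with a ℚₚ.≟ 0ℚ
    ... | yes a≡0 = a≡0
    ... | no  a≢0 = trans (sym (ℚₚ.*-identityˡ a)) (trans (cong (_* a) (sym (ℚₚ.*-inverseˡ a)))
          (trans (ℚₚ.*-assoc (ℚ.1/ a) a a) (trans (cong (ℚ.1/ a *_) aa≡0) (ℚₚ.*-zeroʳ (ℚ.1/ a)))))
      where instance _ = ℚ.≢-nonZero a≢0

    norm≡0 : ∀ a b → a * a + b * b ≡ 0ℚ → a ≡ 0ℚ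
    norm≡0 a b p = square≡0 a (ℚₚ.≤-antisym
      (subst (a * a ℚ.≤_) p (subst (ℚ._≤ a * a + b * b) (ℚₚ.+-identityʳ (a * a)) (ℚₚ.+-monoʳ-≤ (a * a) (square-nonneg b))))
      (square-nonneg a))

  -- The inverse is the conjugate divided by the norm a² + b², which vanishes only at 0 because
  -- squares of rationals are nonnegative.
  zero⊎unit : ∀ x → x ≡ 0ℚ +i 0ℚ ⊎ ∃ λ y → y *ᵢ x ≡ 1ℚ +i 0ℚ
  zero⊎unit (a +i b) with (a * a + b * b) ℚₚ.≟ 0ℚ
  ... | yes p = inj₁ (cong₂ _+i_ (norm≡0 a b p) (norm≡0 b a (trans (ℚₚ.+-comm (b * b) (a * a)) p)))
  ... | no ¬p = inj₂ ((n⁻¹ * a) +i (- (n⁻¹ * b)) , cong₂ _+i_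
        (trans (solve 3 (λ a b n → n :* a :* a :- (:- (n :* b)) :* b := n :* (a :* a :+ b :* b)) refl a b n⁻¹) (ℚₚ.*-inverseˡ (a * a + b * b)))
        (solve 3 (λ a b n → n :* a :* b :+ (:- (n :* b)) :* a := con 0ℚ) refl a b n⁻¹))
    where
    instance _ = ℚ.≢-nonZero ¬p
    n⁻¹ = ℚ.1/ (a * a + b * b)

  fromℤ : ℤ → ℚ
  fromℤ z = z / 1

  private
    -- Identities of integers inside ℚ are proved on unnormalised fractions, where z / 1 is not
    -- subject to cancellation of a gcd.
    fromℤ≃ : ∀ z → toℚᵘ (fromℤ z) ℚᵘ.≃ mkℚᵘ z 0
    fromℤ≃ z = ℚₚ.toℚᵘ-fromℚᵘ (mkℚᵘ z 0)

  fromℤ-+ : ∀ i j → fromℤ (i ℤ.+ j) ≡ fromℤ i + fromℤ j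
  fromℤ-+ i j = ℚₚ.toℚᵘ-injective (ℚᵘₚ.≃-trans (fromℤ≃ (i ℤ.+ j)) (ℚᵘₚ.≃-trans
    (*≡* (cong₂ ℤ._*_ (sym (cong₂ ℤ._+_ (ℤₚ.*-identityʳ i) (ℤₚ.*-identityʳ j))) refl))
    (ℚᵘₚ.≃-sym (ℚᵘₚ.≃-trans (ℚₚ.toℚᵘ-homo-+ (fromℤ i) (fromℤ j)) (ℚᵘₚ.+-cong (fromℤ≃ i) (fromℤ≃ j))))))

  fromℤ-* : ∀ i j → fromℤ (i ℤ.* j) ≡ fromℤ i * fromℤ j
  fromℤ-* i j = ℚₚ.toℚᵘ-injective (ℚᵘₚ.≃-trans (fromℤ≃ (i ℤ.* j)) (ℚᵘₚ.≃-sym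
    (ℚᵘₚ.≃-trans (ℚₚ.toℚᵘ-homo-* (fromℤ i) (fromℤ j)) (ℚᵘₚ.*-cong (fromℤ≃ i) (fromℤ≃ j)))))

  fromℤ-neg : ∀ i → fromℤ (ℤ.- i) ≡ - fromℤ i
  fromℤ-neg i = ℚₚ.toℚᵘ-injective (ℚᵘₚ.≃-trans (fromℤ≃ (ℤ.- i)) (ℚᵘₚ.≃-sym
    (ℚᵘₚ.≃-trans (ℚₚ.toℚᵘ-homo‿- (fromℤ i)) (ℚᵘₚ.-‿cong (fromℤ≃ i)))))

  fromℤ-injective : ∀ {i j} → fromℤ i ≡ fromℤ j → i ≡ j
  fromℤ-injective {i} {j} p with *≡* q ← ℚᵘₚ.≃-trans (ℚᵘₚ.≃-sym (fromℤ≃ i)) (ℚᵘₚ.≃-trans (ℚᵘₚ.≃-reflexive (cong toℚᵘ p)) (fromℤ≃ j))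
    = trans (sym (ℤₚ.*-identityʳ i)) (trans q (ℤₚ.*-identityʳ j))

  module Kᴸ = LinearAlgebra ℚi-ring

  fromℕ≡ : ∀ n → Kᴸ.fromℕ n ≡ fromℤ (+ n) +i 0ℚ
  fromℕ≡ zero    = refl
  fromℕ≡ (suc n) = trans (cong ((1ℚ +i 0ℚ) +ᵢ_) (fromℕ≡ n)) (cong₂ _+i_ (sym (fromℤ-+ (+ 1) (+ n))) refl)

  characteristic-0 : ∀ n → Kᴸ.fromℕ n ≡ 0ℚ +i 0ℚ → n ≡ 0
  characteristic-0 n p = ℤₚ.+-injective (fromℤ-injective (cong re (trans (sym (fromℕ≡ n)) p)))

  infix 5 _⊕i_

  -- The representations have entries in ℤ[i]; computing their tables there needs no reduction of
  -- fractions.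
  record ℤi : Set where
    constructor _⊕i_
    field re im : ℤ

  addᶻ mulᶻ : ℤi → ℤi → ℤi
  addᶻ (a ⊕i b) (c ⊕i d) = (a ℤ.+ c) ⊕i (b ℤ.+ d)
  mulᶻ (a ⊕i b) (c ⊕i d) = (a ℤ.* c ℤ.- b ℤ.* d) ⊕i (a ℤ.* d ℤ.+ b ℤ.* c)

  fromℤi : ℤi → ℚi
  fromℤi (a ⊕i b) = fromℤ a +i fromℤ b

  fromℤi-+ : ∀ x y → fromℤi (addᶻ x y) ≡ fromℤi x +ᵢ fromℤi y
  fromℤi-+ (a ⊕i b) (c ⊕i d) = cong₂ _+i_ (fromℤ-+ a c) (fromℤ-+ b d)

  fromℤi-* : ∀ x y → fromℤi (mulᶻ x y) ≡ fromℤi x *ᵢ fromℤi y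
  fromℤi-* (a ⊕i b) (c ⊕i d) = cong₂ _+i_
    (trans (fromℤ-+ (a ℤ.* c) (ℤ.- (b ℤ.* d))) (cong₂ _+_ (fromℤ-* a c) (trans (fromℤ-neg (b ℤ.* d)) (cong -_ (fromℤ-* b d)))))
    (trans (fromℤ-+ (a ℤ.* d) (b ℤ.* c)) (cong₂ _+_ (fromℤ-* a d) (fromℤ-* b c)))

  fromℤi-injective : ∀ {x y} → fromℤi x ≡ fromℤi y → x ≡ y
  fromℤi-injective p = cong₂ _⊕i_ (fromℤ-injective (cong re p)) (fromℤ-injective (cong im p))

  ι : ℚi → ℂ
  ι (a +i b) = fromℚ² a b

  ι-+ : ∀ x y → ι (x +ᵢ y) ≈ℂ ι x +ℂ ι y
  ι-+ _ _ = pointwise⇒≈ℂ (λ _ → refl) (λ _ → refl)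

  ι-* : ∀ x y → ι (x *ᵢ y) ≈ℂ ι x *ℂ ι y
  ι-* _ _ = pointwise⇒≈ℂ (λ _ → refl) (λ _ → refl)

  private
    -- If p and q differed, the convergence condition with ε = ∣p - q∣ would give ∣p - q∣ < ∣p - q∣.
    fromℚ-injective : ∀ {p q} → fromℚ p ≈ℝ fromℚ q → p ≡ q
    fromℚ-injective {p} {q} p≈q with p - q ℚₚ.≟ 0ℚ
    ... | yes p-q≡0 = trans (solve 2 (λ p q → p := (p :- q) :+ q) refl p q)
          (trans (cong (_+ q) p-q≡0) (ℚₚ.+-identityˡ q))
    ... | no  p-q≢0 = contradiction (proj₂ close (proj₁ close) ≤-refl) (ℚₚ.<-irrefl refl)
      where
      ∣p-q∣>0 : 0ℚ ℚ.< ∣ p - q ∣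
      ∣p-q∣>0 = ℚₚ.≰⇒> (λ ∣p-q∣≤0 → p-q≢0 (ℚₚ.∣p∣≡0⇒p≡0 (p - q) (ℚₚ.≤-antisym ∣p-q∣≤0 (ℚₚ.0≤∣p∣ (p - q)))))
      close = eventually (vanishing p≈q) ∣ p - q ∣ ∣p-q∣>0

  ι-injective : ∀ {x y} → ι x ≈ℂ ι y → x ≡ y
  ι-injective p = cong₂ _+i_ (fromℚ-injective (re≈ p)) (fromℚ-injective (im≈ p))

  ι-cong : ∀ {x y} → x ≡ y → ι x ≈ℂ ι y
  ι-cong refl = pointwise⇒≈ℂ (λ _ → refl) (λ _ → refl)

  ι-0 : ι (0ℚ +i 0ℚ) ≈ℂ 0ℂ
  ι-0 = pointwise⇒≈ℂ (λ _ → refl) (λ _ → refl)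

  ι-1 : ι (1ℚ +i 0ℚ) ≈ℂ 1ℂ
  ι-1 = pointwise⇒≈ℂ (λ _ → refl) (λ _ → refl)

-- Induced characters and orders of stabilisers.

module Counting {c ℓ : Level} (R : CommutativeRing c ℓ)
  {g : ℕ} {mul : Fin g → Fin g → Fin g} {ε : Fin g} {inv : Fin g → Fin g}
  (isGroup : IsGroup _≡_ mul ε inv) where

  open import Data.Fin.Base using (fromℕ<; punchOut; splitAt; join)
  open import Data.Fin.Properties using (any?; all?; punchOut-injective; injective⇒≤; join-splitAt; toℕ<n; toℕ-fromℕ<)
  open import Data.Nat.DivMod using (_%_; _/_; m%n<n; m≡m%n+[m/n]*n)
  open import Relation.Nullary.Decidable using (¬?)
  open LinearAlgebra R
  open import Relation.Binary.Reasoning.Setoid setoid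

  private
    module G = IsGroup isGroup

    group : Group 0ℓ 0ℓ
    group = record { isGroup = isGroup }

  open import Algebra.Properties.Group group
    using (∙-cancelˡ; ∙-cancelʳ; ⁻¹-anti-homo-∙; ε⁻¹≈ε)
    renaming ( \\-leftDividesˡ to cancelˡ; \\-leftDividesʳ to cancelˡ′
             ; //-rightDividesˡ to cancelʳ; //-rightDividesʳ to cancelʳ′)

  infixl 8 _∙_
  infix  9 _⁻¹

  _∙_ : Fin g → Fin g → Fin g
  _∙_ = mul

  _⁻¹ : Fin g → Fin g
  _⁻¹ = inv

  infix 10 _^_
  infixl 8 _⊲_

  _^_ : Fin g → ℕ → Fin g
  y ^ zero  = ε
  y ^ suc n = y ∙ y ^ n

  ^-+ : ∀ y a b → y ^ (a ℕ.+ b) ≡ y ^ a ∙ y ^ b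
  ^-+ y zero    b = ≡.sym (G.identityˡ (y ^ b))
  ^-+ y (suc a) b = ≡.trans (≡.cong (y ∙_) (^-+ y a b)) (≡.sym (G.assoc y (y ^ a) (y ^ b)))

  _⊲_ : Fin g → Fin g → Fin g
  h ⊲ x = x ⁻¹ ∙ h ∙ x

  ⊲-∙ : ∀ a b x → (a ∙ b) ⊲ x ≡ (a ⊲ x) ∙ (b ⊲ x)
  ⊲-∙ a b x = ≡.sym (≡.trans (G.assoc (x ⁻¹ ∙ a) x (b ⊲ x)) (≡.trans
    (≡.cong (x ⁻¹ ∙ a ∙_) (≡.trans (≡.cong (x ∙_) (G.assoc (x ⁻¹) b x)) (cancelˡ x (b ∙ x))))
    (≡.trans (≡.sym (G.assoc (x ⁻¹ ∙ a) b x)) (≡.cong (_∙ x) (G.assoc (x ⁻¹) a b)))))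

  ⊲-ε : ∀ x → ε ⊲ x ≡ ε
  ⊲-ε x = ≡.trans (≡.cong (_∙ x) (G.identityʳ (x ⁻¹))) (G.inverseˡ x)

  ⊲-^ : ∀ y x n → (y ^ n) ⊲ x ≡ (y ⊲ x) ^ n
  ⊲-^ y x zero    = ⊲-ε x
  ⊲-^ y x (suc n) = ≡.trans (⊲-∙ y (y ^ n) x) (≡.cong ((y ⊲ x) ∙_) (⊲-^ y x n))

  ⊲-⊲ : ∀ h x y → (h ⊲ x) ⊲ y ≡ h ⊲ (x ∙ y)
  ⊲-⊲ h x y = ≡.sym (≡.trans (≡.cong (λ z → z ∙ h ∙ (x ∙ y)) (⁻¹-anti-homo-∙ x y)) (≡.trans
    (≡.sym (G.assoc (y ⁻¹ ∙ x ⁻¹ ∙ h) x y)) (≡.cong (_∙ y)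
      (≡.trans (≡.cong (_∙ x) (G.assoc (y ⁻¹) (x ⁻¹) h)) (G.assoc (y ⁻¹) (x ⁻¹ ∙ h) x)))))

  ⊲-injective : ∀ {a b} x → a ⊲ x ≡ b ⊲ x → a ≡ b
  ⊲-injective {a} {b} x p = ∙-cancelˡ (x ⁻¹) a b (∙-cancelʳ x (x ⁻¹ ∙ a) (x ⁻¹ ∙ b) p)

  conjugates : Fin g → Fin g → Carrier
  conjugates x h = sum λ y → [ x ≐ h ⊲ y ]

  -- Replacing h by a conjugate only permutes the y that are counted; this is what reduces an
  -- arbitrary stabiliser to a chosen generator.
  conjugates-⊲ : ∀ x h z → conjugates x (h ⊲ z) ≈ conjugates x h
  conjugates-⊲ x h z = trans (sum-cong λ y → reflexive (≡.cong [ x ≐_] (⊲-⊲ h z y)))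
    (sum-reindex (z ∙_) (z ⁻¹ ∙_) (cancelˡ z) (cancelˡ′ z) (λ y → [ x ≐ h ⊲ y ]))

  injective⇒onto : ∀ {n} (f : Fin n → Fin n) → (∀ {i j} → f i ≡ f j → i ≡ j) → ∀ i → ∃ λ j → f j ≡ i
  injective⇒onto {suc n} f f-inj i with any? (λ j → f j ≟ i)
  ... | yes p = p
  ... | no ¬p = contradiction (injective⇒≤ {f = λ j → punchOut (i≢f j)}
          (λ {j} {k} q → f-inj (punchOut-injective (i≢f j) (i≢f k) q))) ℕₚ.1+n≰n
    where
    i≢f : ∀ j → i ≢ f j
    i≢f j i≡fj = ¬p (j , ≡.sym i≡fj)

  sum-injective : ∀ {n} (p : Fin n → Fin n) → (∀ {i j} → p i ≡ p j → i ≡ j) →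
                  (f : Fin n → Carrier) → sum (f ∘ p) ≈ sum f
  sum-injective p p-inj = sum-reindex p (proj₁ ∘ onto) (proj₂ ∘ onto) (λ i → p-inj (proj₂ (onto (p i))))
    where onto = injective⇒onto p p-inj

  -- A transitive action on Fin n with base point stabiliser the image of h.
  record CosetAction (n m : ℕ) : Set where
    field
      q     : Fin g → Fin n
      s     : Fin n → Fin g
      q-s   : ∀ i → q (s i) ≡ i
      σ     : Fin g → Fin n → Fin n
      σ-q   : ∀ x y → σ x (q y) ≡ q (y ∙ x)
      h     : Fin m → Fin g
      h-inj : ∀ {i j} → h i ≡ h j → i ≡ j
      q⇒h   : ∀ x y → q x ≡ q y → ∃ λ j → x ∙ y ⁻¹ ≡ h j
      h⇒q   : ∀ x y j → x ∙ y ⁻¹ ≡ h j → q x ≡ q y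

    private
      indicator : ∀ x y → [ q x ≐ q y ] ≈ sum (λ j → [ x ∙ y ⁻¹ ≐ h j ])
      indicator x y with q x ≟ q y
      ... | yes p = let j , e = q⇒h x y p in sym (trans
              (sum-cong λ i → ≐-iff {k = j} {l = i} (λ r → h-inj (≡.trans (≡.sym e) r)) (λ r → ≡.trans e (≡.cong h r)))
              (trans (sum-cong λ i → sym (*-identityʳ _)) (≐-sumˡ j (λ _ → 1#))))
      ... | no ¬p = sym (sum-zero λ j → ≐-≢ λ r → ¬p (h⇒q x y j r))

      fibre : ∀ i → sum (λ y → [ q y ≐ i ]) ≈ fromℕ m
      fibre i = begin
        sum (λ y → [ q y ≐ i ])
          ≈⟨ sum-cong (λ y → reflexive (≡.cong [ q y ≐_] (q-s i))) ⟨
        sum (λ y → [ q y ≐ q (s i) ])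
          ≈⟨ sum-cong (λ y → indicator y (s i)) ⟩
        sum (λ y → sum (λ j → [ y ∙ s i ⁻¹ ≐ h j ]))
          ≈⟨ sum-comm _ ⟩
        sum (λ j → sum (λ y → [ y ∙ s i ⁻¹ ≐ h j ]))
          ≈⟨ sum-cong (λ j → sum-reindex (_∙ s i ⁻¹) (_∙ s i) (cancelʳ′ (s i)) (cancelʳ (s i)) (λ y → [ y ≐ h j ])) ⟩
        sum (λ j → sum (λ y → [ y ≐ h j ]))
          ≈⟨ sum-cong (λ j → trans (sum-cong λ y → trans (≐-sym y (h j)) (sym (*-identityʳ _))) (≐-sumˡ (h j) (λ _ → 1#))) ⟩
        sum {m} (λ j → 1#)
          ≈⟨ sum-cong (λ j → ≐-refl j) ⟨
        tr (Id {m})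
          ≈⟨ tr-Id m ⟩
        fromℕ m ∎

    fixedPoints : Fin g → Carrier
    fixedPoints x = sum λ i → [ σ x i ≐ i ]

    -- The formula for an induced character. Each point is q(y) for exactly m elements y, so the sum
    -- over points becomes a sum over the group; and x fixes q(y) exactly when y x y⁻¹ is some
    -- `h j`, that is, when x is `h j` conjugated by y.
    m*fixedPoints : ∀ x → fromℕ m * fixedPoints x ≈ sum (λ j → conjugates x (h j))
    m*fixedPoints x = begin
      fromℕ m * sum (λ i → [ σ x i ≐ i ])
        ≈⟨ *-sumˡ (fromℕ m) _ ⟩
      sum (λ i → fromℕ m * [ σ x i ≐ i ])
        ≈⟨ sum-cong (λ i → trans (*-congʳ (sym (fibre i))) (*-sumʳ _ _)) ⟩
      sum (λ i → sum (λ y → [ q y ≐ i ] * [ σ x i ≐ i ]))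
        ≈⟨ sum-comm _ ⟩
      sum (λ y → sum (λ i → [ q y ≐ i ] * [ σ x i ≐ i ]))
        ≈⟨ sum-cong (λ y → ≐-sumˡ (q y) (λ i → [ σ x i ≐ i ])) ⟩
      sum (λ y → [ σ x (q y) ≐ q y ])
        ≈⟨ sum-cong (λ y → trans (reflexive (≡.cong [_≐ q y ] (σ-q x y))) (indicator (y ∙ x) y)) ⟩
      sum (λ y → sum (λ j → [ y ∙ x ∙ y ⁻¹ ≐ h j ]))
        ≈⟨ sum-cong (λ y → sum-cong λ j → ≐-iff (to y j) (from y j)) ⟩
      sum (λ y → sum (λ j → [ x ≐ h j ⊲ y ]))
        ≈⟨ sum-comm _ ⟩
      sum (λ j → conjugates x (h j)) ∎
      where
      to : ∀ y j → y ∙ x ∙ y ⁻¹ ≡ h j → x ≡ h j ⊲ y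
      to y j r = ≡.sym (≡.trans (≡.cong (_⊲ y) (≡.sym r)) (≡.trans (≡.cong (_∙ y)
        (≡.trans (≡.cong (y ⁻¹ ∙_) (G.assoc y x (y ⁻¹))) (cancelˡ′ y (x ∙ y ⁻¹)))) (cancelʳ y x)))
      from : ∀ y j → x ≡ h j ⊲ y → y ∙ x ∙ y ⁻¹ ≡ h j
      from y j r = ≡.trans (≡.cong (λ z → y ∙ z ∙ y ⁻¹) r) (≡.trans (≡.cong (_∙ y ⁻¹)
        (≡.trans (≡.cong (y ∙_) (G.assoc (y ⁻¹) (h j) y)) (cancelˡ y (h j ∙ y)))) (cancelʳ′ y (h j)))

    Stabiliser : Fin g → Set
    Stabiliser x = ∃ λ j → x ≡ h j

    stab⇒q : ∀ {x} → Stabiliser x → q x ≡ q ε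
    stab⇒q {x} (j , p) = h⇒q x ε j (≡.trans (≡.cong (x ∙_) ε⁻¹≈ε) (≡.trans (G.identityʳ x) p))

    q⇒stab : ∀ {x} → q x ≡ q ε → Stabiliser x
    q⇒stab {x} p = let j , e = q⇒h x ε p in j , ≡.trans (≡.sym (≡.trans (≡.cong (x ∙_) ε⁻¹≈ε) (G.identityʳ x))) e

    stab-ε : Stabiliser ε
    stab-ε = q⇒stab ≡.refl

    stab-∙ : ∀ {x y} → Stabiliser x → Stabiliser y → Stabiliser (x ∙ y)
    stab-∙ {x} {y} a b = q⇒stab (≡.trans (≡.sym (σ-q y x)) (≡.trans (≡.cong (σ y) (stab⇒q a))
      (≡.trans (σ-q y ε) (≡.trans (≡.cong q (G.identityˡ y)) (stab⇒q b)))))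

    stab-^ : ∀ {x} → Stabiliser x → ∀ n → Stabiliser (x ^ n)
    stab-^ a zero    = stab-ε
    stab-^ a (suc n) = stab-∙ a (stab-^ a n)

    -- Lagrange's theorem, as far as it is needed: if the powers of y do not
    -- exhaust the stabiliser, a further element z gives the disjoint coset y ⁱ z.
    module Order {y : Fin g} (y∈ : Stabiliser y) (o : ℕ) .{{_ : ℕ.NonZero o}} (y^o : y ^ o ≡ ε)
                 (distinct : ∀ {i j : Fin o} → y ^ toℕ i ≡ y ^ toℕ j → i ≡ j) where

      power-in-range : ∀ n → ∃ λ (i : Fin o) → y ^ n ≡ y ^ toℕ i
      power-in-range n = fromℕ< (m%n<n n o) , ≡.trans (≡.cong (y ^_) (m≡m%n+[m/n]*n n o))
        (≡.trans (^-+ y (n % o) (n / o ℕ.* o)) (≡.trans (≡.cong (y ^ (n % o) ∙_) (periods (n / o)))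
          (≡.trans (G.identityʳ _) (≡.cong (y ^_) (≡.sym (toℕ-fromℕ< (m%n<n n o)))))))
        where
        periods : ∀ k → y ^ (k ℕ.* o) ≡ ε
        periods zero    = ≡.refl
        periods (suc k) = ≡.trans (^-+ y o (k ℕ.* o)) (≡.trans (≡.cong₂ _∙_ y^o (periods k)) (G.identityˡ ε))

      outside : o ℕ.< m → ∃ λ z → Stabiliser z × ∀ (i : Fin o) → z ≢ y ^ toℕ i
      outside o<m with any? (λ j → all? (λ (i : Fin o) → ¬? (h j ≟ y ^ toℕ i)))
      ... | yes (j , p) = h j , (j , ≡.refl) , p
      ... | no ¬p = contradiction (injective⇒≤ {f = f} f-inj) (ℕₚ.<⇒≱ o<m)
        where
        inside : ∀ j → ∃ λ (i : Fin o) → h j ≡ y ^ toℕ i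
        inside j with any? (λ (i : Fin o) → h j ≟ y ^ toℕ i)
        ... | yes p = p
        ... | no ¬q = contradiction (j , λ i r → ¬q (i , r)) ¬p
        f : Fin m → Fin o
        f j = proj₁ (inside j)
        f-inj : ∀ {j k} → f j ≡ f k → j ≡ k
        f-inj {j} {k} r = h-inj (≡.trans (proj₂ (inside j))
          (≡.trans (≡.cong (λ i → y ^ toℕ i) r) (≡.sym (proj₂ (inside k)))))

      index : Fin o → Fin m
      index i = proj₁ (stab-^ y∈ (toℕ i))

      index-h : ∀ i → y ^ toℕ i ≡ h (index i)
      index-h i = proj₂ (stab-^ y∈ (toℕ i))

      index-inj : ∀ {i j} → index i ≡ index j → i ≡ j
      index-inj {i} {j} r = distinct (≡.trans (index-h i) (≡.trans (≡.cong h r) (≡.sym (index-h j))))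

      o≤m : o ℕ.≤ m
      o≤m = injective⇒≤ {f = index} index-inj

      outside⇒2o≤m : ∀ {z} → Stabiliser z → (∀ (i : Fin o) → z ≢ y ^ toℕ i) → o ℕ.+ o ℕ.≤ m
      outside⇒2o≤m {z} z∈ z∉ = injective⇒≤ {f = f ∘ splitAt o} λ {i} {j} r →
        ≡.trans (≡.sym (join-splitAt o o i)) (≡.trans (≡.cong (join o o) (f-inj (splitAt o i) (splitAt o j) r)) (join-splitAt o o j))
        where
        element : Fin o ⊎ Fin o → Fin g
        element (inj₁ i) = y ^ toℕ i
        element (inj₂ i) = y ^ toℕ i ∙ z
        stab : ∀ s → Stabiliser (element s)
        stab (inj₁ i) = stab-^ y∈ (toℕ i)
        stab (inj₂ i) = stab-∙ (stab-^ y∈ (toℕ i)) z∈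
        f : Fin o ⊎ Fin o → Fin m
        f s = proj₁ (stab s)
        disjoint : ∀ i j → y ^ toℕ i ∙ z ≢ y ^ toℕ j
        -- Multiplying y ⁱ z = y ʲ by y ^ (o - i) on the left exhibits z as a power of y.
        disjoint i j r = let k , e = power-in-range (o ℕ.∸ toℕ i ℕ.+ toℕ j) in z∉ k
          (≡.trans (≡.sym (≡.trans (≡.cong (_∙ z) full) (G.identityˡ z)))
            (≡.trans (G.assoc (y ^ (o ℕ.∸ toℕ i)) (y ^ toℕ i) z) (≡.trans (≡.cong (y ^ (o ℕ.∸ toℕ i) ∙_) r)
              (≡.trans (≡.sym (^-+ y (o ℕ.∸ toℕ i) (toℕ j))) e))))
          where
          full : y ^ (o ℕ.∸ toℕ i) ∙ y ^ toℕ i ≡ ε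
          full = ≡.trans (≡.sym (^-+ y (o ℕ.∸ toℕ i) (toℕ i)))
            (≡.trans (≡.cong (y ^_) (ℕₚ.m∸n+n≡m (ℕₚ.<⇒≤ (toℕ<n i)))) y^o)
        element-inj : ∀ s t → element s ≡ element t → s ≡ t
        element-inj (inj₁ i) (inj₁ j) r = ≡.cong inj₁ (distinct r)
        element-inj (inj₁ i) (inj₂ j) r = contradiction (≡.sym r) (disjoint j i)
        element-inj (inj₂ i) (inj₁ j) r = contradiction r (disjoint i j)
        element-inj (inj₂ i) (inj₂ j) r = ≡.cong inj₂ (distinct (∙-cancelʳ z _ _ r))
        f-inj : ∀ s t → f s ≡ f t → s ≡ t
        f-inj s t r = element-inj s t (≡.trans (proj₂ (stab s)) (≡.trans (≡.cong h r) (≡.sym (proj₂ (stab t)))))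

      sum-powers : o ≡ m → (f : Fin g → Carrier) → sum (λ j → f (h j)) ≈ sum {o} (λ i → f (y ^ toℕ i))
      sum-powers ≡.refl f = trans (sym (sum-injective index index-inj (f ∘ h)))
        (sum-cong λ i → reflexive (≡.cong f (≡.sym (index-h i))))

-- Tables of the group of order 96 and its representations.

module Tables where

  open import Data.Bool.ListAction using () renaming (any to any′)
  open import Data.Integer.Base using (+_; -[1+_])
  open import Data.List.Base as List using (List; []; _∷_)
  open import Data.Nat.DivMod using (_mod_)
  open import Data.Vec.Base using (concat)
  open import Relation.Binary.PropositionalEquality
  open GaussianNumbers using (ℤi; module ℤi; _⊕i_; addᶻ; mulᶻ)

  data Gen : Set where
    gT gD : Gen

  G : Set
  G = Fin 96

  -- The number 4 p + q stands for wₚ Dᑫ, where the wₚ represent the left cosets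
  -- of ⟨ D ⟩; rt, rd and inverses are T, D on the right and inversion in these terms.
  transversal : Vec (List Gen) 24
  transversal =
    [] ∷ (gT ∷ []) ∷ (gT ∷ gT ∷ []) ∷ (gD ∷ gT ∷ []) ∷ (gT ∷ gT ∷ gT ∷ []) ∷ (gT ∷ gD ∷ gT ∷ []) ∷
    (gD ∷ gD ∷ gT ∷ []) ∷ (gT ∷ gT ∷ gT ∷ gT ∷ []) ∷ (gD ∷ gT ∷ gT ∷ gT ∷ []) ∷ (gT ∷ gD ∷ gD ∷ gT ∷ []) ∷
    (gD ∷ gD ∷ gD ∷ gT ∷ []) ∷ (gT ∷ gT ∷ gT ∷ gT ∷ gT ∷ []) ∷ (gT ∷ gD ∷ gT ∷ gT ∷ gT ∷ []) ∷
    (gD ∷ gD ∷ gT ∷ gT ∷ gT ∷ []) ∷ (gD ∷ gT ∷ gD ∷ gD ∷ gT ∷ []) ∷ (gT ∷ gT ∷ gT ∷ gT ∷ gT ∷ gT ∷ []) ∷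
    (gD ∷ gT ∷ gT ∷ gT ∷ gT ∷ gT ∷ []) ∷ (gT ∷ gD ∷ gT ∷ gD ∷ gD ∷ gT ∷ []) ∷ (gD ∷ gD ∷ gT ∷ gD ∷ gD ∷ gT ∷ []) ∷
    (gT ∷ gT ∷ gT ∷ gT ∷ gT ∷ gT ∷ gT ∷ []) ∷ (gT ∷ gD ∷ gT ∷ gT ∷ gT ∷ gT ∷ gT ∷ []) ∷ (gT ∷ gD ∷ gD ∷ gT ∷ gD ∷ gD ∷ gT ∷ []) ∷
    (gD ∷ gD ∷ gD ∷ gT ∷ gD ∷ gD ∷ gT ∷ []) ∷ (gD ∷ gT ∷ gT ∷ gT ∷ gT ∷ gT ∷ gT ∷ gT ∷ []) ∷ []

  words : Vec (List Gen) 96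
  words = concat {m = 4} {n = 24} (Vec.map (λ w → w ∷ (w List.++ (gD ∷ [])) ∷ (w List.++ (gD ∷ gD ∷ [])) ∷ (w List.++ (gD ∷ gD ∷ gD ∷ [])) ∷ []) transversal)

  word : G → List Gen
  word = lookup words

  private
    rt rd inverses : Vec ℕ 96
    rt =
      4 ∷ 12 ∷ 24 ∷ 40 ∷ 8 ∷ 20 ∷ 36 ∷ 13 ∷ 16 ∷ 32 ∷ 52 ∷ 21 ∷ 9 ∷ 19 ∷ 56 ∷ 25 ∷
      28 ∷ 48 ∷ 57 ∷ 33 ∷ 17 ∷ 31 ∷ 68 ∷ 37 ∷ 10 ∷ 35 ∷ 72 ∷ 41 ∷ 44 ∷ 64 ∷ 69 ∷ 49 ∷
      29 ∷ 47 ∷ 73 ∷ 53 ∷ 18 ∷ 51 ∷ 84 ∷ 14 ∷ 11 ∷ 55 ∷ 88 ∷ 5 ∷ 60 ∷ 80 ∷ 74 ∷ 65 ∷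
      45 ∷ 63 ∷ 85 ∷ 58 ∷ 30 ∷ 67 ∷ 89 ∷ 22 ∷ 34 ∷ 46 ∷ 83 ∷ 26 ∷ 76 ∷ 92 ∷ 86 ∷ 81 ∷
      61 ∷ 79 ∷ 90 ∷ 70 ∷ 50 ∷ 62 ∷ 95 ∷ 38 ∷ 54 ∷ 66 ∷ 78 ∷ 42 ∷ 0 ∷ 43 ∷ 91 ∷ 93 ∷
      77 ∷ 3 ∷ 27 ∷ 75 ∷ 59 ∷ 82 ∷ 2 ∷ 15 ∷ 23 ∷ 71 ∷ 94 ∷ 6 ∷ 1 ∷ 7 ∷ 39 ∷ 87 ∷ []
    rd =
      1 ∷ 2 ∷ 3 ∷ 0 ∷ 5 ∷ 6 ∷ 7 ∷ 4 ∷ 9 ∷ 10 ∷ 11 ∷ 8 ∷ 13 ∷ 14 ∷ 15 ∷ 12 ∷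
      17 ∷ 18 ∷ 19 ∷ 16 ∷ 21 ∷ 22 ∷ 23 ∷ 20 ∷ 25 ∷ 26 ∷ 27 ∷ 24 ∷ 29 ∷ 30 ∷ 31 ∷ 28 ∷
      33 ∷ 34 ∷ 35 ∷ 32 ∷ 37 ∷ 38 ∷ 39 ∷ 36 ∷ 41 ∷ 42 ∷ 43 ∷ 40 ∷ 45 ∷ 46 ∷ 47 ∷ 44 ∷
      49 ∷ 50 ∷ 51 ∷ 48 ∷ 53 ∷ 54 ∷ 55 ∷ 52 ∷ 57 ∷ 58 ∷ 59 ∷ 56 ∷ 61 ∷ 62 ∷ 63 ∷ 60 ∷
      65 ∷ 66 ∷ 67 ∷ 64 ∷ 69 ∷ 70 ∷ 71 ∷ 68 ∷ 73 ∷ 74 ∷ 75 ∷ 72 ∷ 77 ∷ 78 ∷ 79 ∷ 76 ∷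
      81 ∷ 82 ∷ 83 ∷ 80 ∷ 85 ∷ 86 ∷ 87 ∷ 84 ∷ 89 ∷ 90 ∷ 91 ∷ 88 ∷ 93 ∷ 94 ∷ 95 ∷ 92 ∷ []
    inverses =
      0 ∷ 3 ∷ 2 ∷ 1 ∷ 76 ∷ 81 ∷ 86 ∷ 92 ∷ 60 ∷ 63 ∷ 62 ∷ 61 ∷ 79 ∷ 80 ∷ 85 ∷ 95 ∷
      44 ∷ 49 ∷ 69 ∷ 64 ∷ 65 ∷ 45 ∷ 50 ∷ 70 ∷ 78 ∷ 83 ∷ 84 ∷ 94 ∷ 28 ∷ 31 ∷ 30 ∷ 29 ∷
      47 ∷ 48 ∷ 68 ∷ 67 ∷ 74 ∷ 58 ∷ 38 ∷ 90 ∷ 77 ∷ 82 ∷ 87 ∷ 93 ∷ 16 ∷ 21 ∷ 52 ∷ 32 ∷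
      33 ∷ 17 ∷ 22 ∷ 53 ∷ 46 ∷ 51 ∷ 71 ∷ 66 ∷ 73 ∷ 57 ∷ 37 ∷ 89 ∷ 8 ∷ 11 ∷ 10 ∷ 9 ∷
      19 ∷ 20 ∷ 55 ∷ 35 ∷ 34 ∷ 18 ∷ 23 ∷ 54 ∷ 72 ∷ 56 ∷ 36 ∷ 88 ∷ 4 ∷ 40 ∷ 24 ∷ 12 ∷
      13 ∷ 5 ∷ 41 ∷ 25 ∷ 26 ∷ 14 ∷ 6 ∷ 42 ∷ 75 ∷ 59 ∷ 39 ∷ 91 ∷ 7 ∷ 43 ∷ 27 ∷ 15 ∷ []
    at : Vec ℕ 96 → G → G
    at v a = lookup v a mod 96

  step : Gen → G → G
  step gT = at rt
  step gD = at rd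

  opaque
    inv : G → G
    inv = at inverses

  act : List Gen → G → G
  act []      a = a
  act (s ∷ w) a = act w (step s a)

  infixl 7 _⋆_

  opaque
    -- The product follows the word of b through the two tables of right multiplication by T and D,
    -- in place of a 96 × 96 table.
    _⋆_ : G → G → G
    a ⋆ b = act (word b) a

    ⋆-word : ∀ a b → a ⋆ b ≡ act (word b) a
    ⋆-word a b = refl

  Mat4 : Set
  Mat4 = Vec (Vec ℤi 4) 4

  0ᵍ 1ᵍ iᵍ -1ᵍ -iᵍ : ℤi
  0ᵍ  = + 0 ⊕i + 0
  1ᵍ  = + 1 ⊕i + 0
  iᵍ  = + 0 ⊕i + 1
  -1ᵍ = -[1+ 0 ] ⊕i + 0
  -iᵍ = + 0 ⊕i -[1+ 0 ]

  entry : Mat4 → Fin 4 → Fin 4 → ℤi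
  entry A i j = lookup (lookup A i) j

  sumᶻ : ∀ {n} → (Fin n → ℤi) → ℤi
  sumᶻ {zero}  f = 0ᵍ
  sumᶻ {suc n} f = addᶻ (f zero) (sumᶻ (λ k → f (suc k)))

  mul4 : Mat4 → Mat4 → Mat4
  mul4 A B = Vec.tabulate λ i → Vec.tabulate λ j → sumᶻ λ k → mulᶻ (entry A i k) (entry B k j)

  scale : ℤi → Mat4 → Mat4
  scale s = Vec.map (Vec.map (mulᶻ s))

  pow : ℤi → ℕ → ℤi
  pow x zero    = 1ᵍ
  pow x (suc n) = mulᶻ x (pow x n)

  λ-image : Gen → ℤi
  λ-image gT = -iᵍ
  λ-image gD = iᵍ

  private
    𝟙 V W U V⊗W : Gen → Mat4
    𝟙 _ = (1ᵍ ∷ 0ᵍ ∷ 0ᵍ ∷ 0ᵍ ∷ []) ∷ (0ᵍ ∷ 0ᵍ ∷ 0ᵍ ∷ 0ᵍ ∷ []) ∷ (0ᵍ ∷ 0ᵍ ∷ 0ᵍ ∷ 0ᵍ ∷ []) ∷ (0ᵍ ∷ 0ᵍ ∷ 0ᵍ ∷ 0ᵍ ∷ []) ∷ []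
    V gT = (0ᵍ ∷ iᵍ ∷ 0ᵍ ∷ 0ᵍ ∷ []) ∷ (1ᵍ ∷ 0ᵍ ∷ 0ᵍ ∷ 0ᵍ ∷ []) ∷ (0ᵍ ∷ 0ᵍ ∷ 0ᵍ ∷ 0ᵍ ∷ []) ∷ (0ᵍ ∷ 0ᵍ ∷ 0ᵍ ∷ 0ᵍ ∷ []) ∷ []
    V gD = (1ᵍ ∷ 1ᵍ ∷ 0ᵍ ∷ 0ᵍ ∷ []) ∷ (0ᵍ ∷ iᵍ ∷ 0ᵍ ∷ 0ᵍ ∷ []) ∷ (0ᵍ ∷ 0ᵍ ∷ 0ᵍ ∷ 0ᵍ ∷ []) ∷ (0ᵍ ∷ 0ᵍ ∷ 0ᵍ ∷ 0ᵍ ∷ []) ∷ []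
    W gT = (0ᵍ ∷ 1ᵍ ∷ 0ᵍ ∷ 0ᵍ ∷ []) ∷ (1ᵍ ∷ 0ᵍ ∷ 0ᵍ ∷ 0ᵍ ∷ []) ∷ (0ᵍ ∷ 0ᵍ ∷ 0ᵍ ∷ 0ᵍ ∷ []) ∷ (0ᵍ ∷ 0ᵍ ∷ 0ᵍ ∷ 0ᵍ ∷ []) ∷ []
    W gD = (1ᵍ ∷ -1ᵍ ∷ 0ᵍ ∷ 0ᵍ ∷ []) ∷ (0ᵍ ∷ -1ᵍ ∷ 0ᵍ ∷ 0ᵍ ∷ []) ∷ (0ᵍ ∷ 0ᵍ ∷ 0ᵍ ∷ 0ᵍ ∷ []) ∷ (0ᵍ ∷ 0ᵍ ∷ 0ᵍ ∷ 0ᵍ ∷ []) ∷ []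
    U gT = (0ᵍ ∷ 0ᵍ ∷ iᵍ ∷ 0ᵍ ∷ []) ∷ (0ᵍ ∷ 1ᵍ ∷ 0ᵍ ∷ 0ᵍ ∷ []) ∷ (-iᵍ ∷ 0ᵍ ∷ 0ᵍ ∷ 0ᵍ ∷ []) ∷ (0ᵍ ∷ 0ᵍ ∷ 0ᵍ ∷ 0ᵍ ∷ []) ∷ []
    U gD = (iᵍ ∷ iᵍ ∷ iᵍ ∷ 0ᵍ ∷ []) ∷ (0ᵍ ∷ -1ᵍ ∷ (-[1+ 1 ] ⊕i + 0) ∷ 0ᵍ ∷ []) ∷ (0ᵍ ∷ 0ᵍ ∷ -iᵍ ∷ 0ᵍ ∷ []) ∷ (0ᵍ ∷ 0ᵍ ∷ 0ᵍ ∷ 0ᵍ ∷ []) ∷ []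
    V⊗W gT = (0ᵍ ∷ 0ᵍ ∷ 0ᵍ ∷ iᵍ ∷ []) ∷ (0ᵍ ∷ 0ᵍ ∷ iᵍ ∷ 0ᵍ ∷ []) ∷ (0ᵍ ∷ 1ᵍ ∷ 0ᵍ ∷ 0ᵍ ∷ []) ∷ (1ᵍ ∷ 0ᵍ ∷ 0ᵍ ∷ 0ᵍ ∷ []) ∷ []
    V⊗W gD = (1ᵍ ∷ -1ᵍ ∷ 1ᵍ ∷ -1ᵍ ∷ []) ∷ (0ᵍ ∷ -1ᵍ ∷ 0ᵍ ∷ -1ᵍ ∷ []) ∷ (0ᵍ ∷ 0ᵍ ∷ iᵍ ∷ -iᵍ ∷ []) ∷ (0ᵍ ∷ 0ᵍ ∷ 0ᵍ ∷ -iᵍ ∷ []) ∷ []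

  unit4 : ℕ → Mat4
  unit4 n = row 0 ∷ row 1 ∷ row 2 ∷ row 3 ∷ []
    where
    cell : ℕ → ℕ → ℤi
    cell a b = if (a ℕ.≡ᵇ b) ∧ (a ℕ.<ᵇ n) then 1ᵍ else 0ᵍ
    row : ℕ → Vec ℤi 4
    row a = cell a 0 ∷ cell a 1 ∷ cell a 2 ∷ cell a 3 ∷ []

  -- The triple (degree , n , X) stands for λⁿ ⊗ X with the linear character
  -- λ = det; V is the given representation in another basis, U is λ ⊗ Sym² V,
  -- and W factors through S₃.
  irreps : Vec (ℕ × ℕ × (Gen → Mat4)) 16
  irreps =
    (1 , 0 , 𝟙) ∷ (1 , 1 , 𝟙) ∷ (1 , 2 , 𝟙) ∷ (1 , 3 , 𝟙) ∷
    (2 , 0 , V) ∷ (2 , 1 , V) ∷ (2 , 2 , V) ∷ (2 , 3 , V) ∷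
    (2 , 0 , W) ∷ (2 , 1 , W) ∷
    (3 , 0 , U) ∷ (3 , 1 , U) ∷ (3 , 2 , U) ∷ (3 , 3 , U) ∷
    (4 , 0 , V⊗W) ∷ (4 , 1 , V⊗W) ∷ []

  V₀ : Fin 16
  V₀ = suc (suc (suc (suc zero)))

  degree : Fin 16 → ℕ
  degree c = proj₁ (lookup irreps c)

  image : ℕ × ℕ × (Gen → Mat4) → Gen → Mat4
  image (_ , n , X) s = scale (pow (λ-image s) n) (X s)

  private
    powers : Mat4 → ∀ n → Mat4 → Vec Mat4 n
    powers D zero    X = []
    powers D (suc n) X = X ∷ powers D n (mul4 X D)

    evaluate : (Gen → Mat4) → Mat4 → List Gen → Mat4
    evaluate g X []      = X
    evaluate g X (s ∷ w) = evaluate g (mul4 X (g s)) w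

    values : ℕ × ℕ × (Gen → Mat4) → Vec Mat4 96
    values χ = concat {m = 4} {n = 24} (Vec.map (λ w → powers (image χ gD) 4 (evaluate (image χ) (unit4 (proj₁ χ)) w)) transversal)

  opaque
   table : Vec (Vec Mat4 96) 16
   table = Vec.map values irreps

  opaque
    -- Opaque, so that a finite check is evaluated only in the blocks that unfold it.
    all : ∀ {n} → (Fin n → Bool) → Bool
    all {zero}  p = true
    all {suc n} p = p zero ∧ all (λ k → p (suc k))

    all-sound : ∀ {n} {p : Fin n → Bool} → all p ≡ true → ∀ k → p k ≡ true
    all-sound {suc n} {p} eq k with p zero in e | k
    ... | true | zero  = e
    ... | true | suc k = all-sound eq k

    any : ∀ {n} → (Fin n → Bool) → Bool
    any {zero}  p = false
    any {suc n} p = p zero ∨ any (λ k → p (suc k))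

    any-sound : ∀ {n} {p : Fin n → Bool} → any p ≡ true → ∃ λ k → p k ≡ true
    any-sound {suc n} {p} eq with p zero in e
    ... | true  = zero , e
    ... | false = let k , q = any-sound eq in suc k , q

  ∧-sound : ∀ {a b} → a ∧ b ≡ true → a ≡ true × b ≡ true
  ∧-sound {true} {true} _ = refl , refl

  ∨-sound : ∀ {a b} → a ∨ b ≡ true → a ≡ true ⊎ b ≡ true
  ∨-sound {true}  _ = inj₁ refl
  ∨-sound {false} p = inj₂ p

  does-sound : ∀ {P : Set} (p? : Dec P) → does p? ≡ true → P
  does-sound (yes p) _ = p

  infix 4 _==_

  _==_ : ∀ {n} → Fin n → Fin n → Bool
  a == b = does (a ≟ b)

  eqℤi : ℤi → ℤi → Bool
  eqℤi x y = does (ℤi.re x ℤₚ.≟ ℤi.re y) ∧ does (ℤi.im x ℤₚ.≟ ℤi.im y)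

  eqℤi-sound : ∀ x y → eqℤi x y ≡ true → x ≡ y
  eqℤi-sound x y p = let q , r = ∧-sound p in cong₂ _⊕i_ (does-sound (_ ℤₚ.≟ _) q) (does-sound (_ ℤₚ.≟ _) r)

  eqVec : ∀ {A : Set} (eq : A → A → Bool) {n} → Vec A n → Vec A n → Bool
  eqVec eq []       []       = true
  eqVec eq (x ∷ xs) (y ∷ ys) = eq x y ∧ eqVec eq xs ys

  eqVec-sound : ∀ {A : Set} {eq : A → A → Bool} → (∀ x y → eq x y ≡ true → x ≡ y) →
                ∀ {n} (xs ys : Vec A n) → eqVec eq xs ys ≡ true → xs ≡ ys
  eqVec-sound s []       []       _ = refl
  eqVec-sound s (x ∷ xs) (y ∷ ys) p = let q , r = ∧-sound p in cong₂ _∷_ (s x y q) (eqVec-sound s xs ys r)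

  eq4 : Mat4 → Mat4 → Bool
  eq4 = eqVec (eqVec eqℤi)

  eq4-sound : ∀ A B → eq4 A B ≡ true → A ≡ B
  eq4-sound = eqVec-sound (eqVec-sound eqℤi-sound)

  trace4 : Mat4 → ℤi
  trace4 A = sumᶻ λ k → entry A k k

  firstIndex : ∀ {n} {A : Set} → (A → Bool) → Vec A (suc n) → Fin (suc n)
  firstIndex {zero}  p _        = zero
  firstIndex {suc n} p (x ∷ xs) = if p x then zero else suc (firstIndex p xs)

  infix 4 _∈ᵇ_

  _∈ᵇ_ : G → List ℕ → Bool
  a ∈ᵇ xs = any′ (toℕ a ℕ.≡ᵇ_) xs

  -- The stabilisers are, up to conjugacy, K₁, K₃, K₄, K₈ and K₉, in this order.
  -- The identity fixes all points, the elements numbered in the support fix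
  -- fixed of them and the others none; sums are the sums over the support of
  -- the upper left entries of the irreducible representations.
  points fixed : Fin 5 → ℕ
  points = lookup (96 ∷ 48 ∷ 32 ∷ 24 ∷ 24 ∷ [])
  fixed  = lookup (0 ∷ 8 ∷ 8 ∷ 4 ∷ 4 ∷ [])

  support : Fin 5 → List ℕ
  support = lookup
    ([] ∷
     (2 ∷ 30 ∷ 38 ∷ 57 ∷ 72 ∷ 91 ∷ []) ∷
     (19 ∷ 21 ∷ 34 ∷ 45 ∷ 51 ∷ 53 ∷ 64 ∷ 68 ∷ []) ∷
     (1 ∷ 2 ∷ 3 ∷ 6 ∷ 11 ∷ 13 ∷ 24 ∷ 30 ∷ 38 ∷ 43 ∷ 57 ∷ 61 ∷ 72 ∷ 78 ∷ 80 ∷ 86 ∷ 91 ∷ 93 ∷ []) ∷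
     (2 ∷ 9 ∷ 18 ∷ 20 ∷ 29 ∷ 30 ∷ 31 ∷ 33 ∷ 38 ∷ 46 ∷ 48 ∷ 52 ∷ 57 ∷ 63 ∷ 65 ∷ 69 ∷ 72 ∷ 91 ∷ []) ∷ [])

  sums : Fin 5 → Vec ℤ 16
  sums = lookup
    (Vec.replicate 16 (+ 0) ∷
     (+ 6 ∷ -[1+ 5 ] ∷ + 6 ∷ -[1+ 5 ] ∷ + 0 ∷ + 0 ∷ + 0 ∷ + 0 ∷ + 6 ∷ -[1+ 5 ] ∷ -[1+ 1 ] ∷ + 2 ∷ -[1+ 1 ] ∷ + 2 ∷ + 0 ∷ + 0 ∷ []) ∷
     (+ 8 ∷ + 8 ∷ + 8 ∷ + 8 ∷ -[1+ 3 ] ∷ -[1+ 3 ] ∷ -[1+ 3 ] ∷ -[1+ 3 ] ∷ -[1+ 3 ] ∷ -[1+ 3 ] ∷ + 0 ∷ + 0 ∷ + 0 ∷ + 0 ∷ + 2 ∷ + 2 ∷ []) ∷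
     (+ 18 ∷ -[1+ 5 ] ∷ -[1+ 5 ] ∷ -[1+ 5 ] ∷ + 6 ∷ -[1+ 5 ] ∷ -[1+ 5 ] ∷ + 6 ∷ + 6 ∷ -[1+ 5 ] ∷ -[1+ 5 ] ∷ + 2 ∷ + 2 ∷ + 2 ∷ + 0 ∷ + 0 ∷ []) ∷
     (+ 18 ∷ -[1+ 5 ] ∷ -[1+ 5 ] ∷ -[1+ 5 ] ∷ -[1+ 5 ] ∷ + 6 ∷ + 6 ∷ -[1+ 5 ] ∷ + 6 ∷ -[1+ 5 ] ∷ -[1+ 5 ] ∷ + 2 ∷ + 2 ∷ + 2 ∷ + 0 ∷ + 0 ∷ []) ∷ [])

  Table : Set
  Table = Vec (Vec Mat4 96) 16

  homoAt unitAt : Table → Fin 16 → G → Bool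
  homoAt tab c a =
    eq4 (lookup (lookup tab c) (step gT a)) (mul4 (lookup (lookup tab c) a) (image (lookup irreps c) gT)) ∧
    eq4 (lookup (lookup tab c) (step gD a)) (mul4 (lookup (lookup tab c) a) (image (lookup irreps c) gD))
  unitAt tab c a = eq4 (mul4 (lookup (lookup tab c) a) (unit4 (degree c))) (lookup (lookup tab c) a)

  traceAt indexAt : Table → G → Bool
  traceAt tab a = eqℤi
    (sumᶻ λ c → mulᶻ (+ degree c ⊕i + 0) (trace4 (lookup (lookup tab c) a)))
    (if zero == a then + 96 ⊕i + 0 else 0ᵍ)
  indexAt tab a = firstIndex (λ A → eq4 A (lookup (lookup tab V₀) a)) (lookup tab V₀) == a

  zeroAt : Table → Fin 16 → Bool
  zeroAt tab c = eq4 (lookup (lookup tab c) zero) (unit4 (degree c))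

  sumAt : Table → Fin 5 → Fin 16 → Bool
  sumAt tab k c = eqℤi
    (sumᶻ λ a → if a ∈ᵇ support k then entry (lookup (lookup tab c) (inv a)) zero zero else 0ᵍ)
    (lookup (sums k) c ⊕i + 0)

  -- The table is an argument so that it is evaluated only once.
  check : Table → Bool
  check tab = all (λ c → all (homoAt tab c)) ∧ (all (λ c → all (unitAt tab c)) ∧ (all (zeroAt tab) ∧
    (all (traceAt tab) ∧ (all (indexAt tab) ∧ all (λ k → all (sumAt tab k))))))

  module Sound (tab : Table) (checked : check tab ≡ true) where
    private
      c₁ = ∧-sound {all (λ c → all (homoAt tab c))} checked
      c₂ = ∧-sound {all (λ c → all (unitAt tab c))} (proj₂ c₁)
      c₃ = ∧-sound {all (zeroAt tab)} (proj₂ c₂)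
      c₄ = ∧-sound {all (traceAt tab)} (proj₂ c₃)
      c₅ = ∧-sound {all (indexAt tab)} (proj₂ c₄)

      homo : ∀ c a → homoAt tab c a ≡ true
      homo c = all-sound {p = homoAt tab c} (all-sound {p = λ c → all (homoAt tab c)} (proj₁ c₁) c)

      index : ∀ a → firstIndex (λ A → eq4 A (lookup (lookup tab V₀) a)) (lookup tab V₀) ≡ a
      index a = does-sound (_ ≟ _) (all-sound {p = indexAt tab} (proj₁ c₅) a)

    R : Fin 16 → G → Mat4
    R c a = lookup (lookup tab c) a

    R-step : ∀ c s a → R c (step s a) ≡ mul4 (R c a) (image (lookup irreps c) s)
    R-step c gT a = eq4-sound _ _ (proj₁ (∧-sound (homo c a)))
    R-step c gD a = eq4-sound _ _ (proj₂ (∧-sound {eq4 (R c (step gT a)) (mul4 (R c a) (image (lookup irreps c) gT))} (homo c a)))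

    R-unit : ∀ c a → mul4 (R c a) (unit4 (degree c)) ≡ R c a
    R-unit c a = eq4-sound _ _ (all-sound {p = unitAt tab c} (all-sound {p = λ c → all (unitAt tab c)} (proj₁ c₂) c) a)

    R-zero : ∀ c → R c zero ≡ unit4 (degree c)
    R-zero c = eq4-sound _ _ (all-sound {p = zeroAt tab} (proj₁ c₃) c)

    R-trace : ∀ a → sumᶻ (λ c → mulᶻ (+ degree c ⊕i + 0) (trace4 (R c a))) ≡ (if zero == a then + 96 ⊕i + 0 else 0ᵍ)
    R-trace a = eqℤi-sound _ _ (all-sound {p = traceAt tab} (proj₁ c₄) a)

    -- The check `indexAt` recovers a from its matrix as the position of the first occurrence of
    -- that matrix in the table of `V₀`.
    R-injective : ∀ a b → R V₀ a ≡ R V₀ b → a ≡ b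
    R-injective a b p = trans (sym (index a))
      (trans (cong (λ B → firstIndex (λ A → eq4 A B) (lookup tab V₀)) p) (index b))

    R-sum : ∀ k c → sumᶻ (λ a → if a ∈ᵇ support k then entry (R c (inv a)) zero zero else 0ᵍ) ≡
                    lookup (sums k) c ⊕i + 0
    R-sum k c = eqℤi-sound _ _ (all-sound {p = sumAt tab k} (all-sound {p = λ k → all (sumAt tab k)} (proj₂ c₅) k) c)

  opaque
    unfolding table all inv

    checked : check table ≡ true
    checked = refl

  open Sound table checked public

-- The group laws and the Plancherel identity for the tables.

module Model where

  open import Data.Integer.Base using (+_)
  open import Data.List.Base using ([]; _∷_)
  open import Data.Vec.Properties using (lookup∘tabulate)
  open import Relation.Binary.PropositionalEquality
  open import Relation.Nullary.Decidable using (map′; _×-dec_)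
  open GaussianNumbers
  open Tables
  open Kᴸ using (Mat; _⊡_; ⊡-assoc; [_≐_]; tr)
    renaming (sum to ∑; sum-cong to ∑-cong; sum-[] to ∑-[]; sum-∷ to ∑-∷)

  fromℤi-sum : ∀ {n} (f : Fin n → ℤi) → fromℤi (sumᶻ f) ≡ ∑ (fromℤi ∘ f)
  fromℤi-sum {zero}  f = sym (∑-[] _)
  fromℤi-sum {suc n} f = trans (fromℤi-+ (f zero) _) (trans (cong (fromℤi (f zero) +ᵢ_) (fromℤi-sum (f ∘ suc))) (sym (∑-∷ _)))

  ⟦_⟧ : Mat4 → Mat 4 4
  ⟦ A ⟧ i j = fromℤi (entry A i j)

  ⟦mul4⟧ : ∀ A B i j → ⟦ mul4 A B ⟧ i j ≡ (⟦ A ⟧ ⊡ ⟦ B ⟧) i j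
  ⟦mul4⟧ A B i j = trans
    (cong fromℤi (trans (cong (λ v → lookup v j) (lookup∘tabulate (λ i → Vec.tabulate λ j → product i j) i)) (lookup∘tabulate (product i) j)))
    (trans (fromℤi-sum λ k → mulᶻ (entry A i k) (entry B k j)) (∑-cong λ k → fromℤi-* (entry A i k) (entry B k j)))
    where
    product : Fin 4 → Fin 4 → ℤi
    product i j = sumᶻ λ k → mulᶻ (entry A i k) (entry B k j)

  rep : Fin 16 → G → Mat 4 4
  rep c a = ⟦ R c a ⟧

  gen : Fin 16 → Gen → Mat 4 4
  gen c s = ⟦ image (lookup irreps c) s ⟧

  rep-step : ∀ c s a i j → rep c (step s a) i j ≡ (rep c a ⊡ gen c s) i j
  rep-step c s a i j = trans (cong (λ A → ⟦ A ⟧ i j) (R-step c s a)) (⟦mul4⟧ (R c a) (image (lookup irreps c) s) i j)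

  rep-unit : ∀ c a i j → (rep c a ⊡ rep c zero) i j ≡ rep c a i j
  rep-unit c a i j = trans (cong (λ A → (rep c a ⊡ ⟦ A ⟧) i j) (R-zero c))
    (trans (sym (⟦mul4⟧ (R c a) (unit4 (degree c)) i j)) (cong (λ A → ⟦ A ⟧ i j) (R-unit c a)))

  -- The tables are checked on single generators; induction on the word extends this, used once at
  -- `step s a` and once at `step s zero`. The padded identity `rep c zero` is absorbed by
  -- `rep-unit`.
  rep-act : ∀ c w a i j → rep c (act w a) i j ≡ (rep c a ⊡ rep c (act w zero)) i j
  rep-act c []      a i j = sym (rep-unit c a i j)
  rep-act c (s ∷ w) a i j = trans (rep-act c w (step s a) i j) (trans
    (Kᴸ.⊡-congʳ {B = rep c (act w zero)} shift i j) (trans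
      (⊡-assoc (rep c a) (rep c (step s zero)) (rep c (act w zero)) i j)
      (Kᴸ.⊡-congˡ {A = rep c a} (λ i j → sym (rep-act c w (step s zero) i j)) i j)))
    where
    shift : ∀ i j → rep c (step s a) i j ≡ (rep c a ⊡ rep c (step s zero)) i j
    shift i j = trans (rep-step c s a i j) (sym (trans
      (Kᴸ.⊡-congˡ {A = rep c a} (rep-step c s zero) i j) (trans
        (sym (⊡-assoc (rep c a) (rep c zero) (gen c s) i j))
        (Kᴸ.⊡-congʳ {B = gen c s} (rep-unit c a) i j))))

  private
    groupAt : G → Bool
    groupAt b = (zero ⋆ b == b) ∧ ((b ⋆ inv b == zero) ∧ (inv b ⋆ b == zero))

    opaque
      unfolding all _⋆_ inv

      groupChecked′ : all groupAt ≡ true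
      groupChecked′ = refl

      ⋆-identityʳ′ : ∀ b → b ⋆ zero ≡ b
      ⋆-identityʳ′ b = refl

    groupChecked : ∀ b → groupAt b ≡ true
    groupChecked = all-sound {p = groupAt} groupChecked′

  ⋆-identityˡ : ∀ b → zero ⋆ b ≡ b
  ⋆-identityˡ b = does-sound (_ ≟ _) (proj₁ (∧-sound (groupChecked b)))

  ⋆-inverseʳ : ∀ b → b ⋆ inv b ≡ zero
  ⋆-inverseʳ b = does-sound (_ ≟ _) (proj₁ (∧-sound (proj₂ (∧-sound {zero ⋆ b == b} (groupChecked b)))))

  ⋆-inverseˡ : ∀ b → inv b ⋆ b ≡ zero
  ⋆-inverseˡ b = does-sound (_ ≟ _) (proj₂ (∧-sound {b ⋆ inv b == zero} (proj₂ (∧-sound {zero ⋆ b == b} (groupChecked b)))))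

  rep-⋆ : ∀ c a b i j → rep c (a ⋆ b) i j ≡ (rep c a ⊡ rep c b) i j
  rep-⋆ c a b i j = trans (cong (λ x → rep c x i j) (⋆-word a b)) (trans (rep-act c (word b) a i j)
    (cong (λ x → (rep c a ⊡ rep c x) i j) (trans (sym (⋆-word zero b)) (⋆-identityˡ b))))

  rep-injective : ∀ a b → (∀ i j → rep V₀ a i j ≡ rep V₀ b i j) → a ≡ b
  rep-injective a b p = R-injective a b (ext (λ i → ext (λ j → fromℤi-injective (p i j))))
    where
    ext : ∀ {A : Set} {n} {v w : Vec A n} → (∀ i → lookup v i ≡ lookup w i) → v ≡ w
    ext {v = []}    {[]}    q = refl
    ext {v = x ∷ v} {y ∷ w} q = cong₂ _∷_ (q zero) (ext (q ∘ suc))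

  -- Associativity is inherited from matrices along the faithful representation `V₀`, which avoids a
  -- check of 96³ triples.
  ⋆-assoc : ∀ a b c → (a ⋆ b) ⋆ c ≡ a ⋆ (b ⋆ c)
  ⋆-assoc a b c = rep-injective _ _ λ i j → begin
    rep V₀ ((a ⋆ b) ⋆ c) i j                      ≡⟨ rep-⋆ V₀ (a ⋆ b) c i j ⟩
    (rep V₀ (a ⋆ b) ⊡ rep V₀ c) i j               ≡⟨ Kᴸ.⊡-congʳ {B = rep V₀ c} (rep-⋆ V₀ a b) i j ⟩
    ((rep V₀ a ⊡ rep V₀ b) ⊡ rep V₀ c) i j        ≡⟨ ⊡-assoc (rep V₀ a) (rep V₀ b) (rep V₀ c) i j ⟩
    (rep V₀ a ⊡ (rep V₀ b ⊡ rep V₀ c)) i j        ≡⟨ Kᴸ.⊡-congˡ {A = rep V₀ a} (rep-⋆ V₀ b c) i j ⟨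
    (rep V₀ a ⊡ rep V₀ (b ⋆ c)) i j               ≡⟨ rep-⋆ V₀ a (b ⋆ c) i j ⟨
    rep V₀ (a ⋆ (b ⋆ c)) i j                      ∎
    where open ≡-Reasoning

  ⋆-isGroup : IsGroup _≡_ _⋆_ zero inv
  ⋆-isGroup = record
    { isMonoid = record
      { isSemigroup = record
        { isMagma = record { isEquivalence = isEquivalence ; ∙-cong = cong₂ _⋆_ }
        ; assoc = ⋆-assoc }
      ; identity = ⋆-identityˡ , ⋆-identityʳ′ }
    ; inverse = ⋆-inverseˡ , ⋆-inverseʳ
    ; ⁻¹-cong = cong inv }

  _≟ᵢ_ : (x y : ℚi) → Dec (x ≡ y)
  x ≟ᵢ y = map′ (λ (p , q) → cong₂ _+i_ p q) (λ p → cong re p , cong im p) ((re x ℚₚ.≟ re y) ×-dec (im x ℚₚ.≟ im y))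

  equal : ∀ {m n} → Mat m n → Mat m n → Bool
  equal X Y = all λ i → all λ j → does (X i j ≟ᵢ Y i j)

  equal-sound : ∀ {m n} {X Y : Mat m n} → equal X Y ≡ true → ∀ i j → X i j ≡ Y i j
  equal-sound {X = X} {Y} p i j = does-sound (X i j ≟ᵢ Y i j) (all-sound {p = λ j → does (X i j ≟ᵢ Y i j)}
    (all-sound {p = λ i → all λ j → does (X i j ≟ᵢ Y i j)} p i) j)

  private
    rowAt : Fin 16 → Bool
    rowAt c = equal {1} (λ _ → ⟦ unit4 (degree c) ⟧ zero) (λ _ → [ zero ≐_])

    unitTraceAt : Fin 16 → Bool
    unitTraceAt c = eqℤi (trace4 (unit4 (degree c))) (+ degree c ⊕i + 0)

    opaque
      unfolding all

      rowChecked : all rowAt ≡ true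
      rowChecked = refl

      unitTraceChecked : all unitTraceAt ≡ true
      unitTraceChecked = refl

    1/96 : ℚi
    1/96 = (+ 1 ℚ./ 96) +i 0ℚ

    96-trace : ∀ c → Kᴸ.fromℕ (degree c) ≡ tr (rep c zero)
    96-trace c = trans (fromℕ≡ (degree c)) (trans
      (cong fromℤi (sym (eqℤi-sound (trace4 (unit4 (degree c))) (+ degree c ⊕i + 0) (all-sound {p = unitTraceAt} unitTraceChecked c))))
      (trans (fromℤi-sum λ k → entry (unit4 (degree c)) k k) (∑-cong λ k → cong (λ A → ⟦ A ⟧ k k) (sym (R-zero c)))))

  rep-row : ∀ c j → rep c zero zero j ≡ [ zero ≐ j ]
  rep-row c j = trans (cong (λ A → ⟦ A ⟧ zero j) (R-zero c))
    (equal-sound {X = λ (_ : Fin 1) → ⟦ unit4 (degree c) ⟧ zero} (all-sound {p = rowAt} rowChecked c) zero j)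

  weight : Fin 16 → ℚi
  weight c = Kᴸ.fromℕ (degree c) *ᵢ 1/96

  96*weight : ∀ c → Kᴸ.fromℕ 96 *ᵢ weight c ≡ tr (rep c zero)
  96*weight c = trans (Kᴸ.x∙yz≈y∙xz (Kᴸ.fromℕ 96) (Kᴸ.fromℕ (degree c)) 1/96)
    (trans (Kᴸ.*-identityʳ _) (96-trace c))

  plancherel : ∀ x → ∑ (λ c → weight c *ᵢ tr (rep c x)) ≡ [ zero ≐ x ]
  plancherel x = begin
    ∑ (λ c → weight c *ᵢ tr (rep c x))
      ≡⟨ ∑-cong (λ c → trans (Kᴸ.xy∙z≈xz∙y (Kᴸ.fromℕ (degree c)) 1/96 (tr (rep c x)))
           (cong (_*ᵢ 1/96) (cong₂ _*ᵢ_ (fromℕ≡ (degree c)) (sym (fromℤi-sum λ k → entry (R c x) k k))))) ⟩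
    ∑ (λ c → (fromℤi (+ degree c ⊕i + 0) *ᵢ fromℤi (trace4 (R c x))) *ᵢ 1/96)
      ≡⟨ ∑-cong (λ c → cong (_*ᵢ 1/96) (sym (fromℤi-* (+ degree c ⊕i + 0) (trace4 (R c x))))) ⟩
    ∑ (λ c → fromℤi (mulᶻ (+ degree c ⊕i + 0) (trace4 (R c x))) *ᵢ 1/96)
      ≡⟨ Kᴸ.*-sumʳ 1/96 _ ⟨
    ∑ (λ c → fromℤi (mulᶻ (+ degree c ⊕i + 0) (trace4 (R c x)))) *ᵢ 1/96
      ≡⟨ cong (_*ᵢ 1/96) (fromℤi-sum λ c → mulᶻ (+ degree c ⊕i + 0) (trace4 (R c x))) ⟨
    fromℤi (sumᶻ (λ c → mulᶻ (+ degree c ⊕i + 0) (trace4 (R c x)))) *ᵢ 1/96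
      ≡⟨ cong (λ z → fromℤi z *ᵢ 1/96) (R-trace x) ⟩
    fromℤi (if zero == x then + 96 ⊕i + 0 else 0ᵍ) *ᵢ 1/96
      ≡⟨ by-cases (zero == x) ⟩
    [ zero ≐ x ] ∎
    where
    open ≡-Reasoning
    by-cases : ∀ b → fromℤi (if b then + 96 ⊕i + 0 else 0ᵍ) *ᵢ 1/96 ≡ (if b then 1ℚ +i 0ℚ else 0ℚ +i 0ℚ)
    by-cases true  = refl
    by-cases false = refl

  open Counting ℚi-ring ⋆-isGroup public

-- Conjugacy classes and the possible stabilisers.

module FixedPoints where

  open import Data.Bool.Base using (not; T)
  open import Data.Unit.Base using (tt)
  open import Data.Empty using (⊥; ⊥-elim)
  open import Data.Nat.DivMod using (_mod_)
  open import Data.Integer.Base using (+_)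
  open import Data.List.Base using ([]; _∷_)
  open import Data.Vec.Properties using (lookup∘tabulate)
  open import Relation.Binary.PropositionalEquality
  open import Relation.Nullary.Decidable using (dec-true)
  open GaussianNumbers
  open Tables
  open Model
  open Kᴸ using (Mat; _⊡_; ⊡-assoc; [_≐_]; tr)
    renaming (sum to ∑; sum-cong to ∑-cong; sum-[] to ∑-[]; sum-∷ to ∑-∷)

  private
    count : ∀ {n} → (G → Bool) → Vec G n → ℕ
    count p []       = 0
    count p (x ∷ xs) = if p x then suc (count p xs) else count p xs

    count-sum : ∀ {n} (x : G) (v : Vec G n) → ∑ (λ y → [ x ≐ lookup v y ]) ≡ Kᴸ.fromℕ (count (x ==_) v)
    count-sum x []      = ∑-[] _
    count-sum x (z ∷ v) = trans (∑-∷ _) (trans (cong ([ x ≐ z ] +ᵢ_) (count-sum x v)) (by-cases (x == z)))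
      where
      c = count (x ==_) v
      by-cases : ∀ b → (if b then 1ℚ +i 0ℚ else 0ℚ +i 0ℚ) +ᵢ Kᴸ.fromℕ c ≡ Kᴸ.fromℕ (if b then suc c else c)
      by-cases true  = refl
      by-cases false = Kᴸ.+-identityˡ _

  fromℕ-+ : ∀ a b → Kᴸ.fromℕ (a ℕ.+ b) ≡ Kᴸ.fromℕ a +ᵢ Kᴸ.fromℕ b
  fromℕ-+ zero    b = sym (Kᴸ.+-identityˡ _)
  fromℕ-+ (suc a) b = trans (cong ((1ℚ +i 0ℚ) +ᵢ_) (fromℕ-+ a b)) (sym (Kᴸ.+-assoc (1ℚ +i 0ℚ) (Kᴸ.fromℕ a) (Kᴸ.fromℕ b)))

  fromℕ-* : ∀ a b → Kᴸ.fromℕ (a ℕ.* b) ≡ Kᴸ.fromℕ a *ᵢ Kᴸ.fromℕ b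
  fromℕ-* zero    b = sym (Kᴸ.zeroˡ (Kᴸ.fromℕ b))
  fromℕ-* (suc a) b = trans (fromℕ-+ b (a ℕ.* b)) (trans
    (cong₂ _+ᵢ_ (sym (Kᴸ.*-identityˡ (Kᴸ.fromℕ b))) (fromℕ-* a b))
    (sym (Kᴸ.distribʳ (Kᴸ.fromℕ b) (1ℚ +i 0ℚ) (Kᴸ.fromℕ a))))

  fromℕ-cancel : ∀ n .{{_ : ℕ.NonZero n}} {x y} → Kᴸ.fromℕ n *ᵢ x ≡ Kᴸ.fromℕ n *ᵢ y → x ≡ y
  fromℕ-cancel n {x} {y} p with zero⊎unit (Kᴸ.fromℕ n)
  ... | inj₁ n≡0 = contradiction (characteristic-0 n n≡0) (ℕ.≢-nonZero⁻¹ n)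
  ... | inj₂ (u , un≡1) = trans (sym (cancel x)) (trans (cong (u *ᵢ_) p) (cancel y))
    where
    cancel : ∀ x → u *ᵢ (Kᴸ.fromℕ n *ᵢ x) ≡ x
    cancel x = trans (sym (Kᴸ.*-assoc u (Kᴸ.fromℕ n) x)) (trans (cong (_*ᵢ x) un≡1) (Kᴸ.*-identityˡ x))

  -- Generators of the stabilisers, one for each conjugacy class of generators.
  period : Fin 7 → ℕ
  period = lookup (1 ∷ 2 ∷ 3 ∷ 4 ∷ 4 ∷ 4 ∷ 4 ∷ [])

  -- Since T² is the scalar i, the number 28 + q stands for -Dᑫ. The entries are 1, D², the element
  -- T³D³ of order 3 (determinant 1, trace -1), D, D⁻¹, -D and -D⁻¹; the determinants of D and D⁻¹
  -- differ, so these are not conjugate.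
  generator : Fin 7 → G
  generator s = lookup (0 ∷ 2 ∷ 19 ∷ 1 ∷ 3 ∷ 29 ∷ 31 ∷ []) s mod 96

  kind : Fin 7 → Fin 5
  kind s = lookup (0 ∷ 1 ∷ 2 ∷ 3 ∷ 3 ∷ 4 ∷ 4 ∷ []) s mod 5

  θ : Fin 5 → G → ℕ
  θ k x = if zero == x then points k else (if x ∈ᵇ support k then fixed k else 0)

  -- The central elements i, -1, -i, and the elements with a power among them.
  central bad : G → Bool
  central z = z ∈ᵇ (8 ∷ 28 ∷ 60 ∷ [])
  bad y = central y ∨ (central (y ⋆ y) ∨ central (y ⋆ (y ⋆ y)))

  private
    opaque
      -- The conjugates are tabulated and handed to the check as an argument, so that they are
      -- shared among all the comparisons.
      classes : Vec (Vec G 96) 7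
      classes = Vec.tabulate λ s → Vec.tabulate λ x → generator s ⊲ x

      lookup-classes : ∀ s x → lookup (lookup classes s) x ≡ generator s ⊲ x
      lookup-classes s x = trans (cong (λ v → lookup v x) (lookup∘tabulate (λ s → Vec.tabulate λ x → generator s ⊲ x) s))
        (lookup∘tabulate (λ x → generator s ⊲ x) x)

    classAt : Vec (Vec G 96) 7 → G → Bool
    classAt v y = bad y ∨ any λ s → any λ x → y == lookup (lookup v s) x

    opaque
      unfolding all any _⋆_ inv classes

      classChecked : all (classAt classes) ≡ true
      classChecked = refl

  private
    class-sound : ∀ v y → classAt v y ≡ true → bad y ≡ true ⊎ ∃ λ s → ∃ λ x → y ≡ lookup (lookup v s) x
    class-sound v y p = Sum.map₂ (λ q →
        let s , r = any-sound {p = λ s → any (at s)} q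
            x , e = any-sound {p = at s} r
        in s , x , does-sound (y ≟ lookup (lookup v s) x) e)
      (∨-sound {bad y} p)
      where
      at : Fin 7 → G → Bool
      at s x = y == lookup (lookup v s) x

  classify : ∀ y → bad y ≡ true ⊎ ∃ λ s → ∃ λ x → y ≡ generator s ⊲ x
  classify y = Sum.map₂ (λ (s , x , e) → s , x , trans e (lookup-classes s x))
    (class-sound classes y (all-sound {p = classAt classes} classChecked y))

  private
    implies : Bool → Bool → Bool
    implies a b = not a ∨ b

    implies-sound : ∀ {a b} → implies a b ≡ true → a ≡ true → b ≡ true
    implies-sound {true} p _ = p

    commuteAt : G → G → Bool
    commuteAt z x = implies (central z) (z ⋆ x == x ⋆ z)

    distinctAt : Fin 7 → Bool
    distinctAt s = (generator s ^ period s == zero) ∧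
      (all {period s} λ i → all λ j → implies (generator s ^ toℕ i == generator s ^ toℕ j) (i == j))

    involution : G → Bool
    involution y = y ∈ᵇ support (suc zero)

    -- The conjugates of D² are the six matrices ± X, ± Y, ± Z with X, Y, Z the Pauli matrices. Two
    -- distinct ones have product -1 or a product whose square is -1. This is what rules out a Klein
    -- four-group.
    involutionAt : G → G → Bool
    involutionAt y z = implies (involution y) (implies (involution z) ((y == z) ∨ bad (y ⋆ z)))

  private
    imageAt : G → Bool
    imageAt x = involution (generator (suc zero) ⊲ x)

    positiveAt : Fin 7 → Bool
    positiveAt s = 1 ℕ.≤ᵇ period s

    bigAt : Fin 5 → Bool
    bigAt s = 5 ℕ.≤ᵇ period (suc (suc s)) ℕ.+ period (suc (suc s))

    opaque
      unfolding all _⋆_ inv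

      commuteChecked : all (λ z → all (commuteAt z)) ≡ true
      commuteChecked = refl

      distinctChecked : all distinctAt ≡ true
      distinctChecked = refl

      involutionChecked : all (λ y → all (involutionAt y)) ≡ true
      involutionChecked = refl

      imageChecked : all imageAt ≡ true
      imageChecked = refl

      positiveChecked : all positiveAt ≡ true
      positiveChecked = refl

      bigChecked : all bigAt ≡ true
      bigChecked = refl

  central-commutes : ∀ z → central z ≡ true → ∀ x → z ⋆ x ≡ x ⋆ z
  central-commutes z c x = does-sound (_ ≟ _) (implies-sound {central z}
    (all-sound {p = commuteAt z} (all-sound {p = λ z → all (commuteAt z)} commuteChecked z) x) c)

  generator-^period : ∀ s → generator s ^ period s ≡ zero
  generator-^period s = does-sound (_ ≟ _) (proj₁ (∧-sound (all-sound {p = distinctAt} distinctChecked s)))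

  generator-distinct : ∀ s {i j : Fin (period s)} → generator s ^ toℕ i ≡ generator s ^ toℕ j → i ≡ j
  generator-distinct s {i} {j} e = does-sound (_ ≟ _) (implies-sound {generator s ^ toℕ i == generator s ^ toℕ j}
    (all-sound {p = at i} (all-sound {p = λ i → all (at i)}
      (proj₂ (∧-sound {generator s ^ period s == zero} (all-sound {p = distinctAt} distinctChecked s))) i) j)
    (dec-true (_ ≟ _) e))
    where
    at : (i j : Fin (period s)) → Bool
    at i j = implies (generator s ^ toℕ i == generator s ^ toℕ j) (i == j)

  period≢0 : ∀ s → ℕ.NonZero (period s)
  period≢0 s = ℕ.>-nonZero (ℕₚ.≤ᵇ⇒≤ 1 (period s) (subst T (sym (all-sound {p = positiveAt} positiveChecked s)) tt))

  period-big : ∀ s → 5 ℕ.≤ period (suc (suc s)) ℕ.+ period (suc (suc s))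
  period-big s = ℕₚ.≤ᵇ⇒≤ 5 _ (subst T (sym (all-sound {p = bigAt} bigChecked s)) tt)

  private
    involution-sound : ∀ y z → involution y ≡ true → involution z ≡ true → y ≡ z ⊎ bad (y ⋆ z) ≡ true
    involution-sound y z p q = Sum.map₁ (does-sound (y ≟ z)) (∨-sound {y == z}
      (implies-sound {involution z} (implies-sound {involution y}
        (all-sound {p = involutionAt y} (all-sound {p = λ y → all (involutionAt y)} involutionChecked y) z) p) q))

  involutions-product : ∀ x x′ → let y = generator (suc zero) ⊲ x ; z = generator (suc zero) ⊲ x′ in
                        y ≡ z ⊎ bad (y ⋆ z) ≡ true
  involutions-product x x′ = involution-sound _ _ (all-sound {p = imageAt} imageChecked x) (all-sound {p = imageAt} imageChecked x′)

  private
    opaque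
      orbits : ∀ s → Vec (Vec G 96) (period s)
      orbits s = Vec.tabulate λ j → Vec.tabulate λ x → (generator s ^ toℕ j) ⊲ x

      lookup-orbits : ∀ s j x → lookup (lookup (orbits s) j) x ≡ (generator s ^ toℕ j) ⊲ x
      lookup-orbits s j x = trans (cong (λ v → lookup v x) (lookup∘tabulate (λ j → Vec.tabulate λ x → (generator s ^ toℕ j) ⊲ x) j))
        (lookup∘tabulate (λ x → (generator s ^ toℕ j) ⊲ x) x)

    total : ∀ {o} → G → Vec (Vec G 96) o → ℕ
    total x []       = 0
    total x (v ∷ vs) = count (x ==_) v ℕ.+ total x vs

    fixAt : ∀ {o} → Fin 5 → Vec (Vec G 96) o → G → Bool
    fixAt {o} k vs x = total x vs ℕ.≡ᵇ o ℕ.* θ k x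

    fixCheck : Fin 7 → Bool
    fixCheck s = all (fixAt (kind s) (orbits s))

    opaque
      unfolding all _⋆_ inv orbits

      fixChecked : all fixCheck ≡ true
      fixChecked = refl

    total-sum : ∀ {o} x (vs : Vec (Vec G 96) o) →
                ∑ (λ j → ∑ (λ y → [ x ≐ lookup (lookup vs j) y ])) ≡ Kᴸ.fromℕ (total x vs)
    total-sum x []       = ∑-[] _
    total-sum x (v ∷ vs) = trans (∑-∷ _) (trans (cong₂ _+ᵢ_ (count-sum x v) (total-sum x vs))
      (sym (fromℕ-+ (count (x ==_) v) (total x vs))))

    fix-sound : ∀ {o} k (vs : Vec (Vec G 96) o) x → fixAt k vs x ≡ true → total x vs ≡ o ℕ.* θ k x
    fix-sound {o} k vs x p = ℕₚ.≡ᵇ⇒≡ (total x vs) (o ℕ.* θ k x) (subst T (sym p) tt)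

    total-orbits : ∀ s x → total x (orbits s) ≡ period s ℕ.* θ (kind s) x
    total-orbits s x = fix-sound (kind s) (orbits s) x
      (all-sound {p = fixAt (kind s) (orbits s)} (all-sound {p = fixCheck} fixChecked s) x)

    conjugates-orbits : ∀ s x → ∑ (λ (j : Fin (period s)) → conjugates x (generator s ^ toℕ j)) ≡
                        Kᴸ.fromℕ (total x (orbits s))
    conjugates-orbits s x = trans (∑-cong λ j → ∑-cong λ y → cong [ x ≐_] (sym (lookup-orbits s j y))) (total-sum x (orbits s))

  -- The values of the induced character for each of the seven generators, confirmed by counting;
  -- the factor `period s` is the order of the stabiliser in `m*fixedPoints`.
  conjugates-total : ∀ s x → ∑ (λ (j : Fin (period s)) → conjugates x (generator s ^ toℕ j)) ≡
                     Kᴸ.fromℕ (period s ℕ.* θ (kind s) x)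
  conjugates-total s x = trans (conjugates-orbits s x) (cong Kᴸ.fromℕ (total-orbits s x))

  module Stabilisers {n m : ℕ} (A : CosetAction n m)
    (noCentral : ∀ z → central z ≡ true → ¬ CosetAction.Stabiliser A z) where
    open CosetAction A

    private
      not-bad : ∀ {y} → Stabiliser y → bad y ≢ true
      not-bad {y} y∈ b = [ (λ c → noCentral y c y∈) , (λ b′ → [ (λ c → noCentral (y ⋆ y) c (stab-∙ y∈ y∈)) ,
        (λ c → noCentral (y ⋆ (y ⋆ y)) c (stab-∙ y∈ (stab-∙ y∈ y∈))) ]′ (∨-sound {central (y ⋆ y)} b′)) ]′ (∨-sound {central y} b)

      kindOf : ∀ {y} → Stabiliser y → ∃ λ s → ∃ λ x → y ≡ generator s ⊲ x
      kindOf {y} y∈ = [ (λ b → contradiction b (not-bad y∈)) , (λ k → k) ]′ (classify y)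

      module Ord (s : Fin 7) (x : G) (y∈ : Stabiliser (generator s ⊲ x)) =
        Order y∈ (period s) {{period≢0 s}}
          (trans (sym (⊲-^ (generator s) x (period s))) (trans (cong (_⊲ x) (generator-^period s)) (⊲-ε x)))
          (λ {i} {j} e → generator-distinct s (⊲-injective x (trans (⊲-^ _ x (toℕ i)) (trans e (sym (⊲-^ _ x (toℕ j)))))))

    Generates : ℕ → Set
    Generates m = ∃ λ s → period s ≡ m × ∃ λ x → Stabiliser (generator s ⊲ x)

    -- When the powers of a conjugate of generator s fill the stabiliser, the induced character
    -- formula evaluates to m times θ, and m can be cancelled in characteristic 0.
    fixedPoints-θ : ∀ s x → period s ≡ m → Stabiliser (generator s ⊲ x) →
                    ∀ a → fixedPoints a ≡ Kᴸ.fromℕ (θ (kind s) a)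
    fixedPoints-θ s x refl y∈ a = fromℕ-cancel (period s) {{period≢0 s}} (begin
      Kᴸ.fromℕ m *ᵢ fixedPoints a
        ≡⟨ m*fixedPoints a ⟩
      ∑ (λ j → conjugates a (h j))
        ≡⟨ Ord.sum-powers s x y∈ refl (conjugates a) ⟩
      ∑ (λ (i : Fin (period s)) → conjugates a ((generator s ⊲ x) ^ toℕ i))
        ≡⟨ ∑-cong (λ i → trans (cong (conjugates a) (sym (⊲-^ (generator s) x (toℕ i)))) (conjugates-⊲ a (generator s ^ toℕ i) x)) ⟩
      ∑ (λ (i : Fin (period s)) → conjugates a (generator s ^ toℕ i))
        ≡⟨ conjugates-total s a ⟩
      Kᴸ.fromℕ (m ℕ.* θ (kind s) a)
        ≡⟨ fromℕ-* m (θ (kind s) a) ⟩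
      Kᴸ.fromℕ m *ᵢ Kᴸ.fromℕ (θ (kind s) a) ∎)
      where open ≡-Reasoning

    private
      next : ∀ s x → Stabiliser (generator s ⊲ x) → period s ≢ m →
             period s ℕ.+ period s ℕ.≤ m ×
             ∃ λ s′ → ∃ λ x′ → Stabiliser (generator s′ ⊲ x′) ×
               ∀ (i : Fin (period s)) → generator s′ ⊲ x′ ≢ (generator s ⊲ x) ^ toℕ i
      next s x y∈ o≢m = Ord.outside⇒2o≤m s x y∈ z∈ z∉ , s′ , x′ , subst Stabiliser e z∈ , λ i p → z∉ i (trans e p)
        where
        out = Ord.outside s x y∈ (ℕₚ.≤∧≢⇒< (Ord.o≤m s x y∈) o≢m)
        z  = proj₁ out
        z∈ = proj₁ (proj₂ out)
        z∉ = proj₂ (proj₂ out)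
        k  = kindOf z∈
        s′ = proj₁ k
        x′ = proj₁ (proj₂ k)
        e  : z ≡ generator s′ ⊲ x′
        e  = proj₂ (proj₂ k)

      ε-generator : Stabiliser (generator zero ⊲ zero)
      ε-generator = subst Stabiliser (sym (⊲-ε zero)) stab-ε

      too-big : ∀ s → period (suc (suc s)) ℕ.+ period (suc (suc s)) ℕ.≤ 4 → ⊥
      too-big s p = ℕₚ.<⇒≱ (period-big s) p

      -- With an involution y in the stabiliser and z not a power of y, twice the order of z being
      -- at most 4 leaves only an involution for z; then y z has a nontrivial scalar among its
      -- powers.
      third : ∀ x → Stabiliser (generator (suc zero) ⊲ x) →
              ∀ s′ x′ → Stabiliser (generator s′ ⊲ x′) →
              (∀ (i : Fin 2) → generator s′ ⊲ x′ ≢ (generator (suc zero) ⊲ x) ^ toℕ i) →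
              period s′ ℕ.+ period s′ ℕ.≤ 4 → ⊥
      third x y∈ zero          x′ z∈ z∉ 2o≤4 = z∉ zero (⊲-ε x′)
      third x y∈ (suc (suc s)) x′ z∈ z∉ 2o≤4 = too-big s 2o≤4
      third x y∈ (suc zero)    x′ z∈ z∉ 2o≤4 =
        [ (λ e → z∉ (suc zero) (trans (sym e) (sym (IsGroup.identityʳ ⋆-isGroup _)))) , not-bad (stab-∙ y∈ z∈) ]′ (involutions-product x x′)

      -- A nontrivial y that does not generate has order at most m / 2 ≤ 2, so it is an involution.
      -- An element z outside its powers then generates, or `third` refutes it.
      second : m ℕ.≤ 4 → ∀ s x → Stabiliser (generator s ⊲ x) → generator s ⊲ x ≢ zero →
               period s ℕ.+ period s ℕ.≤ m →
               ∀ s′ x′ → Stabiliser (generator s′ ⊲ x′) →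
               (∀ (i : Fin (period s)) → generator s′ ⊲ x′ ≢ (generator s ⊲ x) ^ toℕ i) →
               Dec (period s′ ≡ m) → Generates m
      second m≤4 s x y∈ y≢0 2o≤m s′ x′ z∈ z∉ (yes o≡m) = s′ , o≡m , x′ , z∈
      second m≤4 zero          x y∈ y≢0 2o≤m s′ x′ z∈ z∉ (no _) = contradiction (⊲-ε x) y≢0
      second m≤4 (suc (suc s)) x y∈ y≢0 2o≤m s′ x′ z∈ z∉ (no _) = ⊥-elim (too-big s (ℕₚ.≤-trans 2o≤m m≤4))
      second m≤4 (suc zero)    x y∈ y≢0 2o≤m s′ x′ z∈ z∉ (no o≢m) =
        ⊥-elim (third x y∈ s′ x′ z∈ z∉ (ℕₚ.≤-trans (proj₁ (next s′ x′ z∈ o≢m)) m≤4))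

      first : m ℕ.≤ 4 → ∀ s x → Stabiliser (generator s ⊲ x) → generator s ⊲ x ≢ zero →
              Dec (period s ≡ m) → Generates m
      first m≤4 s x y∈ y≢0 (yes o≡m) = s , o≡m , x , y∈
      first m≤4 s x y∈ y≢0 (no  o≢m) = let 2o≤m , s′ , x′ , z∈ , z∉ = next s x y∈ o≢m in
        second m≤4 s x y∈ y≢0 2o≤m s′ x′ z∈ z∉ (period s′ ℕₚ.≟ m)

      -- The trivial element is the first candidate: if it does not generate, `next` yields a
      -- nontrivial one.
      start : m ℕ.≤ 4 → Dec (1 ≡ m) → Generates m
      start m≤4 (yes 1≡m) = zero , 1≡m , zero , ε-generator
      start m≤4 (no  1≢m) = let _ , s , x , y∈ , y∉ = next zero zero ε-generator 1≢m in
        first m≤4 s x y∈ (y∉ zero) (period s ℕₚ.≟ m)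

    generates : m ℕ.≤ 4 → Generates m
    generates m≤4 = start m≤4 (1 ℕₚ.≟ m)

-- Multiplicities in the tensor powers.

module Multiplicities where

  open import Data.Integer.Base using (+_)
  open import Relation.Binary.PropositionalEquality
  open GaussianNumbers
  open Tables
  open Model
  open FixedPoints
  open TensorPowers using (tensor; tensor-id; tensor-∘)
  open PermutationMatrices ℚi-ring
  open IdempotentSplitting ℚi-ring zero⊎unit using (Splitting; splitting)
  open Kᴸ using (Mat; _⊡_; [_≐_]; tr; _≋_; Decomposition)
    renaming (sum to ∑; sum-cong to ∑-cong)

  -- The trace of `E c zero zero` on the power with exponent k + 1, where b is the number of points,
  -- w the number fixed by an element of the support, and s the sum of coefficients over the
  -- support. The exponent is positive, so elements without fixed points contribute 0.
  multiplicity : (b w k : ℕ) → ℕ × ℤ → ℚ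
  multiplicity b w k (deg , s) = fromℤ (+ deg) ℚ.* (+ 1 ℚ./ 96) ℚ.*
    (fromℤ (+ (b ℕ.^ suc k)) ℚ.+ fromℤ (+ (w ℕ.^ suc k)) ℚ.* fromℤ s)

  invariants : Fin 5 → Fin 16 → ℕ × ℤ
  invariants κ c = degree c , lookup (sums κ) c

  private
    real-* : ∀ a b → (a +i 0ℚ) *ᵢ (b +i 0ℚ) ≡ (a ℚ.* b) +i 0ℚ
    real-* a b = cong₂ _+i_ (ℚₚ.+-identityʳ (a ℚ.* b))
      (cong₂ ℚ._+_ (ℚₚ.*-zeroʳ a) (ℚₚ.*-zeroˡ b))

    disjointAt : Fin 5 → Bool
    disjointAt κ = does ((zero ∈ᵇ support κ) Data.Bool.Properties.≟ false)
      where import Data.Bool.Properties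

    opaque
      unfolding all

      disjointChecked : all disjointAt ≡ true
      disjointChecked = refl

    at-identity : ∀ a P W → a *ᵢ P ≡ ((1ℚ +i 0ℚ) *ᵢ (a *ᵢ P)) +ᵢ (W *ᵢ (0ℚ +i 0ℚ))
    at-identity a P W = sym (trans (cong₂ _+ᵢ_ (Kᴸ.*-identityˡ (a *ᵢ P)) (Kᴸ.zeroʳ W)) (Kᴸ.+-identityʳ (a *ᵢ P)))

    in-support : ∀ a P W → a *ᵢ W ≡ ((0ℚ +i 0ℚ) *ᵢ (a *ᵢ P)) +ᵢ (W *ᵢ a)
    in-support a P W = sym (trans (cong₂ _+ᵢ_ (Kᴸ.zeroˡ (a *ᵢ P)) (Kᴸ.*-comm W a)) (Kᴸ.+-identityˡ (a *ᵢ W)))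

    off-support : ∀ a P W → a *ᵢ (0ℚ +i 0ℚ) ≡ ((0ℚ +i 0ℚ) *ᵢ (a *ᵢ P)) +ᵢ (W *ᵢ (0ℚ +i 0ℚ))
    off-support a P W = trans (Kᴸ.zeroʳ a) (sym (trans (cong₂ _+ᵢ_ (Kᴸ.zeroˡ (a *ᵢ P)) (Kᴸ.zeroʳ W)) (Kᴸ.+-identityˡ (0ℚ +i 0ℚ))))

    inv-zero : inv zero ≡ zero
    inv-zero = trans (sym (⋆-identityˡ (inv zero))) (⋆-inverseʳ zero)

  -- A power of θ is a combination of the indicators of the identity and of the support;
  -- `disjointChecked` keeps the two from overlapping.
  θ-sum : ∀ κ c k → ∑ (λ x → rep c (inv x) zero zero *ᵢ Kᴸ.fromℕ (θ κ x ℕ.^ suc k)) ≡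
          Kᴸ.fromℕ (points κ ℕ.^ suc k) +ᵢ
          (Kᴸ.fromℕ (fixed κ ℕ.^ suc k) *ᵢ fromℤi (lookup (sums κ) c ⊕i + 0))
  θ-sum κ c k = begin
    ∑ (λ x → rep c (inv x) zero zero *ᵢ Kᴸ.fromℕ (θ κ x ℕ.^ suc k))
      ≡⟨ ∑-cong (λ x → term x (zero ≟ x) (x ∈ᵇ S) refl) ⟩
    ∑ (λ x → ([ zero ≐ x ] *ᵢ (rep c (inv x) zero zero *ᵢ P)) +ᵢ (W *ᵢ fromℤi (f x)))
      ≡⟨ Kᴸ.sum-+ (λ x → [ zero ≐ x ] *ᵢ (rep c (inv x) zero zero *ᵢ P)) (λ x → W *ᵢ fromℤi (f x)) ⟩
    ∑ (λ x → [ zero ≐ x ] *ᵢ (rep c (inv x) zero zero *ᵢ P)) +ᵢ ∑ (λ x → W *ᵢ fromℤi (f x))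
      ≡⟨ cong₂ _+ᵢ_ (Kᴸ.≐-sumˡ zero (λ x → rep c (inv x) zero zero *ᵢ P)) (sym (Kᴸ.*-sumˡ W (fromℤi ∘ f))) ⟩
    (rep c (inv zero) zero zero *ᵢ P) +ᵢ (W *ᵢ ∑ (fromℤi ∘ f))
      ≡⟨ cong₂ _+ᵢ_ (trans (cong (_*ᵢ P) (trans (cong (λ x → rep c x zero zero) inv-zero) (rep-row c zero))) (Kᴸ.*-identityˡ P))
           (cong (W *ᵢ_) (trans (sym (fromℤi-sum f)) (cong fromℤi (R-sum κ c)))) ⟩
    P +ᵢ (W *ᵢ fromℤi (lookup (sums κ) c ⊕i + 0)) ∎
    where
    open ≡-Reasoning
    import Data.Bool.Properties as Boolₚ
    S = support κ
    P W : ℚi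
    P = Kᴸ.fromℕ (points κ ℕ.^ suc k)
    W = Kᴸ.fromℕ (fixed κ ℕ.^ suc k)
    f : G → ℤi
    f x = if x ∈ᵇ S then entry (R c (inv x)) zero zero else 0ᵍ
    power : Bool → Bool → ℚi
    power a b = Kᴸ.fromℕ ((if a then points κ else (if b then fixed κ else 0)) ℕ.^ suc k)
    term : ∀ x (z : Dec (zero ≡ x)) b → (x ∈ᵇ S) ≡ b →
           rep c (inv x) zero zero *ᵢ power (does z) (x ∈ᵇ S) ≡
           ((if does z then 1ℚ +i 0ℚ else 0ℚ +i 0ℚ) *ᵢ (rep c (inv x) zero zero *ᵢ P)) +ᵢ
           (W *ᵢ fromℤi (if x ∈ᵇ S then entry (R c (inv x)) zero zero else 0ᵍ))
    term x (yes refl) b e = trans (at-identity (rep c (inv zero) zero zero) P W)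
      (cong (λ b → ((1ℚ +i 0ℚ) *ᵢ (rep c (inv zero) zero zero *ᵢ P)) +ᵢ (W *ᵢ fromℤi (if b then entry (R c (inv zero)) zero zero else 0ᵍ)))
        (sym (does-sound ((zero ∈ᵇ S) Boolₚ.≟ false) (all-sound {p = disjointAt} disjointChecked κ))))
    term x (no _) true  e rewrite e = in-support (rep c (inv x) zero zero) P W
    term x (no _) false e rewrite e = off-support (rep c (inv x) zero zero) P W

  weight*θ-sum : ∀ κ c k → weight c *ᵢ ∑ (λ x → rep c (inv x) zero zero *ᵢ Kᴸ.fromℕ (θ κ x ℕ.^ suc k)) ≡
                 multiplicity (points κ) (fixed κ) k (invariants κ c) +i 0ℚ
  weight*θ-sum κ c k = trans (cong₂ _*ᵢ_
      (trans (cong (_*ᵢ ((+ 1 ℚ./ 96) +i 0ℚ)) (fromℕ≡ (degree c))) (real-* (fromℤ (+ degree c)) (+ 1 ℚ./ 96)))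
      (trans (θ-sum κ c k) (cong₂ _+ᵢ_ (fromℕ≡ P)
        (trans (cong (_*ᵢ fromℤi (s ⊕i + 0)) (fromℕ≡ W)) (real-* (fromℤ (+ W)) (fromℤ s))))))
    (real-* (fromℤ (+ degree c) ℚ.* (+ 1 ℚ./ 96)) (fromℤ (+ P) ℚ.+ fromℤ (+ W) ℚ.* fromℤ s))
    where
    s = lookup (sums κ) c
    P = points κ ℕ.^ suc k
    W = fixed κ ℕ.^ suc k

  -- The irreducible representations are listed in the order π, to match the
  -- order of the blocks in the theorem.
  module Arrangement (π π⁻¹ : Fin 16 → Fin 16)
    (ππ⁻¹ : ∀ c → π (π⁻¹ c) ≡ c) (π⁻¹π : ∀ c → π⁻¹ (π c) ≡ c) where

    family : Kᴸ.PlancherelFamily _⋆_ zero 16 4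
    family = record
      { r = rep ∘ π ; w = weight ∘ π ; r-homo = λ c → rep-⋆ (π c) ; weight = λ c → 96*weight (π c)
      ; plancherel = λ x → trans (Kᴸ.sum-reindex π π⁻¹ ππ⁻¹ π⁻¹π (λ c → weight c *ᵢ tr (rep c x))) (plancherel x) }

    open MatrixUnits ℚi-ring zero⊎unit characteristic-0 ⋆-isGroup family public using (module Representation)

  module _ {n m : ℕ} (A : CosetAction n m) (κ : Fin 5)
    (fixed≡θ : ∀ a → CosetAction.fixedPoints A a ≡ Kᴸ.fromℕ (θ κ a)) (k : ℕ) where
    open CosetAction A using (q; s; q-s; σ; σ-q)

    private
      σ-⋆ : ∀ x y i → σ (x ⋆ y) i ≡ σ y (σ x i)
      σ-⋆ x y i = begin
        σ (x ⋆ y) i            ≡⟨ cong (σ (x ⋆ y)) (q-s i) ⟨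
        σ (x ⋆ y) (q (s i))    ≡⟨ σ-q (x ⋆ y) (s i) ⟩
        q (s i ⋆ (x ⋆ y))      ≡⟨ cong q (⋆-assoc (s i) x y) ⟨
        q ((s i ⋆ x) ⋆ y)      ≡⟨ σ-q y (s i ⋆ x) ⟨
        σ y (q (s i ⋆ x))      ≡⟨ cong (σ y) (σ-q x (s i)) ⟨
        σ y (σ x (q (s i)))    ≡⟨ cong (σ y ∘ σ x) (q-s i) ⟩
        σ y (σ x i)            ∎
        where open ≡-Reasoning

      σ-zero : ∀ i → σ zero i ≡ i
      σ-zero i = trans (cong (σ zero) (sym (q-s i))) (trans (σ-q zero (s i))
        (trans (cong q (IsGroup.identityʳ ⋆-isGroup (s i))) (q-s i)))

    ρ : G → Mat (n ℕ.^ suc k) (n ℕ.^ suc k)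
    ρ x = permute (tensor (suc k) (σ x))

    ρ-homo : ∀ x y → ρ (x ⋆ y) ≋ ρ x ⊡ ρ y
    ρ-homo x y i j = trans (cong [_≐ j ] (tensor-∘ (suc k) (σ-⋆ x y) i))
      (sym (permute-∘ (tensor (suc k) (σ x)) (tensor (suc k) (σ y)) i j))

    ρ-ε : ρ zero ≋ Kᴸ.Id
    ρ-ε i j = cong [_≐ j ] (tensor-id (suc k) σ-zero i)

    module _ (π π⁻¹ : Fin 16 → Fin 16) (ππ⁻¹ : ∀ c → π (π⁻¹ c) ≡ c) (π⁻¹π : ∀ c → π⁻¹ (π c) ≡ c) where
      open Arrangement π π⁻¹ ππ⁻¹ π⁻¹π
      open Representation ρ ρ-homo ρ-ε

      private
        row : ∀ c j → rep (π c) zero zero j ≡ [ zero ≐ j ]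
        row c = rep-row (π c)

      -- The rank of the idempotent is the natural number equal to the rational formula; it later
      -- serves as the witness for each dimension.
      rank : ∀ c → ∃ λ r → Splitting (E c zero zero) r × fromℤ (+ r) ≡ multiplicity (points κ) (fixed κ) k (invariants κ (π c))
      rank c = let r , split , t = splitting (E c zero zero) (idempotent zero row c) in r , split ,
        cong re (trans (sym (fromℕ≡ r)) (trans (sym t) (trans (tr-E zero row c)
          (trans (cong (weight (π c) *ᵢ_) (∑-cong λ x → cong (rep (π c) (inv x) zero zero *ᵢ_)
            (tr-tensor (suc k) (σ x) (θ κ x) (fixed≡θ x) fromℕ-*)))
            (weight*θ-sum κ (π c) k)))))

      decomposition : (m : Fin 16 → ℕ) → (∀ c → fromℤ (+ m c) ≡ multiplicity (points κ) (fixed κ) k (invariants κ (π c))) →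
                      Decomposition zero (rep ∘ π) ρ m
      decomposition m m≡ = decompose zero row λ c →
        let r , split , r≡ = rank c in
        subst (Splitting (E c zero zero)) (ℤₚ.+-injective (fromℤ-injective (trans r≡ (sym (m≡ c))))) split

-- From an enumerated coset space to a numbered action.

module CosetActions where

  import Algebra.Properties.Group as GroupProperties
  open import Data.Integer.Base using (+_)
  open import Function.Bundles using (Inverse)
  open import Relation.Binary.PropositionalEquality using (refl)
  open import Defs hiding (inv)
  open GaussianNumbers
  open Tables using (G; R; _⋆_; inv; points; fixed)
  open Model hiding (_∙_; _⁻¹)
  open FixedPoints
  open Multiplicities
  open Centralizers
  open TensorPowers using (tensor; tensor-cong)
  module ℂᴸ = LinearAlgebra ℂ-commutativeRing
  module ℂᵀ = PermutationMatrices ℂ-commutativeRing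
  open BaseChange ℚi-ring ℂ-commutativeRing
  open Along ι ι-cong ι-+ ι-* ι-0 ι-1

  ^⊗-permute : ∀ {n} (f : Fin n → Fin n) k → (λ i j → δ (f i) j) ^⊗ k ℂᴸ.≋ ℂᵀ.permute (tensor k f)
  ^⊗-permute f zero    p q = ℂᴸ.refl
  ^⊗-permute {n} f (suc k) p q = ℂᴸ.trans (ℂᴸ.*-congˡ (^⊗-permute f k _ _))
    (ℂᴸ.sym (ℂᵀ.≐-combine (f (quotient {n} (n ℕ.^ k) p)) (tensor k f (remainder {n} (n ℕ.^ k) p)) q))

  record Isomorphic (Γ : Group 0ℓ 0ℓ) : Set where
    open Group Γ
    field
      el     : G → Carrier
      ix     : Carrier → G
      el-ix  : ∀ x → el (ix x) ≈ x
      ix-el  : ∀ a → ix (el a) ≡ a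
      ix-cong : ∀ {x y} → x ≈ y → ix x ≡ ix y
      ix-∙   : ∀ x y → ix (x ∙ y) ≡ ix x ⋆ ix y
      ix-⁻¹  : ∀ x → ix (x ⁻¹) ≡ inv (ix x)
      ix-ε   : ix ε ≡ zero

  module Action {Γ : Group 0ℓ 0ℓ} (iso : Isomorphic Γ) (K : Subgroup Γ) {n m : ℕ}
    (cosets : CosetEnumeration Γ K n) (hasOrder : HasOrder Γ K m) (faithful : Faithful Γ K) where

    open Group Γ using (Carrier; _≈_; _∙_; ε; _⁻¹; ∙-cong; ∙-congˡ; ∙-congʳ; assoc; identityˡ; identityʳ; inverseˡ; inverseʳ; ⁻¹-cong)
    private
      module Γ = Group Γ
      module K = Subgroup K
      module c = Inverse cosets
      module o = Inverse hasOrder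
    open GroupProperties Γ using (⁻¹-anti-homo-∙)
    open Isomorphic iso

    el-⋆ : ∀ a b → el (a ⋆ b) ≈ el a ∙ el b
    el-⋆ a b = Γ.trans (Γ.reflexive (≡.cong el (≡.sym (≡.trans (ix-∙ (el a) (el b)) (≡.cong₂ _⋆_ (ix-el a) (ix-el b))))))
      (el-ix (el a ∙ el b))

    ix-injective : ∀ {x y} → ix x ≡ ix y → x ≈ y
    ix-injective {x} {y} p = Γ.trans (Γ.sym (el-ix x)) (Γ.trans (Γ.reflexive (≡.cong el p)) (el-ix y))

    _~_ : Carrier → Carrier → Set
    x ~ y = K.⟨_⟩ (x ∙ y ⁻¹)

    ≈⇒~ : ∀ {x y} → x ≈ y → x ~ y
    ≈⇒~ {x} {y} p = K.resp (Γ.sym (Γ.trans (∙-congʳ p) (inverseʳ y))) K.ε-closed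

    ~-∙ : ∀ {x y} h → x ~ y → (x ∙ h) ~ (y ∙ h)
    ~-∙ {x} {y} h = K.resp (Γ.sym (Γ.trans (∙-congˡ (⁻¹-anti-homo-∙ y h)) (Γ.trans (assoc x h (h ⁻¹ ∙ y ⁻¹))
      (∙-congˡ (Γ.trans (Γ.sym (assoc h (h ⁻¹) (y ⁻¹))) (Γ.trans (∙-congʳ (inverseʳ h)) (identityˡ (y ⁻¹))))))))

    act : Carrier → Fin n → Fin n
    act h i = c.from (c.to i ∙ h)

    act-cong : ∀ {g h} → g ≈ h → ∀ i → act g i ≡ act h i
    act-cong p i = c.from-cong (≈⇒~ (∙-congˡ p))

    private
      h : Fin m → G
      h j = ix (proj₁ (o.to j))

      el-h : ∀ j → K.⟨_⟩ (el (h j))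
      el-h j = K.resp (Γ.sym (el-ix (proj₁ (o.to j)))) (proj₂ (o.to j))

    action : CosetAction n m
    action = record
      { q = λ a → c.from (el a)
      ; s = λ i → ix (c.to i)
      ; q-s = λ i → ≡.trans (c.from-cong (≈⇒~ (el-ix (c.to i)))) (c.strictlyInverseʳ i)
      ; σ = λ a → act (el a)
      ; σ-q = λ x y → ≡.trans (c.from-cong (~-∙ (el x) (c.strictlyInverseˡ (el y))))
          (c.from-cong (≈⇒~ (Γ.sym (el-⋆ y x))))
      ; h = h
      ; h-inj = λ {i} {j} p → ≡.trans (≡.sym (o.strictlyInverseʳ i))
          (≡.trans (o.from-cong (ix-injective p)) (o.strictlyInverseʳ j))
      ; q⇒h = λ x y p →
          let x~y : el x ~ el y
              x~y = Cosets.trans (Cosets.sym (c.strictlyInverseˡ (el x)))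
                      (≡.subst (λ i → c.to i ~ el y) (≡.sym p) (c.strictlyInverseˡ (el y)))
              z : Γ′.Carrier
              z = el x ∙ el y ⁻¹ , x~y
          in o.from z , ≡.sym (≡.trans (ix-cong (o.strictlyInverseˡ z)) (≡.trans (ix-∙ (el x) (el y ⁻¹))
               (≡.cong₂ _⋆_ (ix-el x) (≡.trans (ix-⁻¹ (el y)) (≡.cong inv (ix-el y))))))
      ; h⇒q = λ x y j p → c.from-cong (K.resp (ix-injective (≡.trans (ix-el (h j)) (≡.trans (≡.sym p) (≡.sym
          (≡.trans (ix-∙ (el x) (el y ⁻¹)) (≡.cong₂ _⋆_ (ix-el x) (≡.trans (ix-⁻¹ (el y)) (≡.cong inv (ix-el y)))))))))
          (el-h j))
      }
      where
      import Relation.Binary.Bundles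
      module Cosets = Relation.Binary.Bundles.Setoid (rightCosets Γ K)
      module Γ′ = Group K.group

    -- A central z in K satisfies K x z = K z x = K x for all x, so faithfulness makes it trivial,
    -- whereas the listed central numbers differ from that of the identity.
    noCentral : ∀ z → central z ≡ true → ¬ CosetAction.Stabiliser action z
    noCentral z cz (j , z≡h) = central≢zero (≡.trans (≡.cong central (≡.sym z≡0)) cz)
      where
      central≢zero : ¬ (central zero ≡ true)
      central≢zero ()
      el-z∈K : K.⟨_⟩ (el z)
      el-z∈K = ≡.subst (λ a → K.⟨_⟩ (el a)) (≡.sym z≡h) (el-h j)
      commute : ∀ x → x ∙ el z ≈ el z ∙ x
      commute x = ix-injective (≡.trans (ix-∙ x (el z)) (≡.trans (≡.cong (ix x ⋆_) (ix-el z))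
        (≡.trans (≡.sym (central-commutes z cz (ix x))) (≡.sym (≡.trans (ix-∙ (el z) x) (≡.cong (_⋆ ix x) (ix-el z)))))))
      trivial : el z ≈ ε
      trivial = faithful (el z) ε λ x → K.resp (Γ.sym (Γ.trans (∙-cong (commute x) (⁻¹-cong (identityʳ x)))
        (Γ.trans (assoc (el z) x (x ⁻¹)) (Γ.trans (∙-congˡ (inverseʳ x)) (identityʳ (el z)))))) el-z∈K
      z≡0 : z ≡ zero
      z≡0 = ≡.trans (≡.sym (ix-el z)) (≡.trans (ix-cong trivial) ix-ε)

    module _ (κ : Fin 5) (fixed≡θ : ∀ a → CosetAction.fixedPoints action a ≡ Kᴸ.fromℕ (θ κ a)) (k : ℕ)
      (π π⁻¹ : Fin 16 → Fin 16) (ππ⁻¹ : ∀ c → π (π⁻¹ c) ≡ c) (π⁻¹π : ∀ c → π⁻¹ (π c) ≡ c) where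

      ranks : ∀ c → ∃ λ r → fromℤ (+ r) ≡ multiplicity (points κ) (fixed κ) k (invariants κ (π c))
      ranks c = let r , _ , p = rank action κ fixed≡θ k π π⁻¹ ππ⁻¹ π⁻¹π c in r , p

      -- The decomposition found over ℚ(i) is transported to ℂ, where `^⊗-permute` matches the
      -- Kronecker power of a permutation matrix with the coordinatewise permutation.
      tensorCentralizer≃ : ∀ {B d} → Blocks B 16 d → (∀ c → fromℤ (+ d c) ≡ multiplicity (points κ) (fixed κ) k (invariants κ (π c))) →
                           tensorCentralizer Γ K cosets (suc k) ≃ B
      tensorCentralizer≃ {B} {d} blocks d≡ = centralizer≃ (λ g → permutationMatrix Γ K cosets g ^⊗ suc k) el ix
        (λ g p q → ℂᴸ.trans (^⊗-permute (act (el (ix g))) (suc k) p q)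
          (ℂᴸ.trans (ℂᴸ.reflexive (≡.cong ℂᴸ.[_≐ q ] (tensor-cong (suc k) (act-cong (el-ix g)) p)))
            (ℂᴸ.sym (^⊗-permute (act g) (suc k) p q))))
        (transport (decomposition action κ fixed≡θ k π π⁻¹ ππ⁻¹ π⁻¹π d d≡) _ λ a p q →
          ℂᴸ.trans (ι-≐ (tensor (suc k) (act (el a)) p) q) (ℂᴸ.sym (^⊗-permute (act (el a)) (suc k) p q)))
        blocks

-- Identification of H₁ with the tables.

module ReflectionGroup where

  open import Data.List.Base using (List; []; _∷_)
  open import Data.Vec.Functional using () renaming (_∷_ to _▹_; [] to ◃)
  open import Relation.Binary.PropositionalEquality using (refl)
  open import Defs hiding (inv; fromℚ; re; im; _+i_)
  open GaussianNumbers
  open Tables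
  open Model hiding (_∙_; _⁻¹; gen)
  open Centralizers using (*ᴹ≋⊡)
  open CosetActions
  open BaseChange ℚi-ring ℂ-commutativeRing
  open Along ι ι-cong ι-+ ι-* ι-0 ι-1

  private
    0ᵏ 1ᵏ : ℚi
    0ᵏ = 0ℚ +i 0ℚ
    1ᵏ = 1ℚ +i 0ℚ

    -- The change of basis from e₁, e₂ to e₁, (e₁ + e₂) / (1 - i), which makes V integral.
    basis : Kᴸ.Mat 2 4
    basis = (1ᵏ ▹ (½ +i ½) ▹ 0ᵏ ▹ 0ᵏ ▹ ◃) ▹ (0ᵏ ▹ (½ +i ½) ▹ 0ᵏ ▹ 0ᵏ ▹ ◃) ▹ ◃

    basis⁻¹ : Kᴸ.Mat 4 2
    basis⁻¹ = (1ᵏ ▹ ((ℚ.- 1ℚ) +i 0ℚ) ▹ ◃) ▹ (0ᵏ ▹ (1ℚ +i (ℚ.- 1ℚ)) ▹ ◃) ▹ (0ᵏ ▹ 0ᵏ ▹ ◃) ▹ (0ᵏ ▹ 0ᵏ ▹ ◃) ▹ ◃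

    realise : Kᴸ.Mat 4 4 → Kᴸ.Mat 2 2
    realise X = basis Kᴸ.⊡ (X Kᴸ.⊡ basis⁻¹)

    opaque
      unfolding Kᴸ.sum all

      -- The 4 × 4 format is padded, so this composite is the projection onto the first two
      -- coordinates, while the opposite one is the identity of size 2.
      basis⁻¹⊡basis : basis⁻¹ Kᴸ.⊡ basis Kᴸ.≋ ⟦ unit4 2 ⟧
      basis⁻¹⊡basis = equal-sound refl

      realise-unit : realise ⟦ unit4 2 ⟧ Kᴸ.≋ Kᴸ.Id
      realise-unit = equal-sound refl

      realise-T : realise ⟦ mul4 (unit4 2) (image (lookup irreps V₀) gT) ⟧ Kᴸ.≋
                  (((½ +i ½) ▹ (½ +i ½) ▹ ◃) ▹ ((½ +i ½) ▹ ((ℚ.- ½) +i (ℚ.- ½)) ▹ ◃) ▹ ◃)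
      realise-T = equal-sound refl

      realise-D : realise ⟦ mul4 (unit4 2) (image (lookup irreps V₀) gD) ⟧ Kᴸ.≋
                  ((1ᵏ ▹ 0ᵏ ▹ ◃) ▹ (0ᵏ ▹ (0ℚ +i 1ℚ) ▹ ◃) ▹ ◃)
      realise-D = equal-sound refl

    realise-cong : ∀ {X Y} → X Kᴸ.≋ Y → realise X Kᴸ.≋ realise Y
    realise-cong p = Kᴸ.⊡-congˡ {A = basis} (Kᴸ.⊡-congʳ {B = basis⁻¹} p)

    realised : G → Kᴸ.Mat 2 2
    realised a = realise (rep V₀ a)

    unit-V₀ : rep V₀ zero Kᴸ.≋ ⟦ unit4 2 ⟧
    unit-V₀ i j = ≡.cong (λ A → ⟦ A ⟧ i j) (R-zero V₀)

    basis⁻¹⊡realised : ∀ (X : Kᴸ.Mat 4 2) → (basis⁻¹ Kᴸ.⊡ (basis Kᴸ.⊡ X)) Kᴸ.≋ rep V₀ zero Kᴸ.⊡ X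
    basis⁻¹⊡realised X = Kᴸ.≋-trans (Kᴸ.≋-sym (Kᴸ.⊡-assoc basis⁻¹ basis X))
      (Kᴸ.⊡-congʳ {B = X} (Kᴸ.≋-trans basis⁻¹⊡basis (Kᴸ.≋-sym unit-V₀)))

    realised-⋆ : ∀ a b → realised (a ⋆ b) Kᴸ.≋ realised a Kᴸ.⊡ realised b
    realised-⋆ a b = Kᴸ.≋-sym (Kᴸ.≋-trans (Kᴸ.⊡-assoc basis (rep V₀ a Kᴸ.⊡ basis⁻¹) (realised b))
      (Kᴸ.⊡-congˡ {A = basis} (Kᴸ.≋-trans (Kᴸ.⊡-assoc (rep V₀ a) basis⁻¹ (realised b)) (Kᴸ.≋-trans
        (Kᴸ.⊡-congˡ {A = rep V₀ a} (basis⁻¹⊡realised (rep V₀ b Kᴸ.⊡ basis⁻¹)))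
        (Kᴸ.≋-trans (Kᴸ.≋-sym (Kᴸ.⊡-assoc (rep V₀ a) (rep V₀ zero) (rep V₀ b Kᴸ.⊡ basis⁻¹)))
          (Kᴸ.≋-trans (Kᴸ.⊡-congʳ {B = rep V₀ b Kᴸ.⊡ basis⁻¹} (rep-unit V₀ a))
            (Kᴸ.≋-trans (Kᴸ.≋-sym (Kᴸ.⊡-assoc (rep V₀ a) (rep V₀ b) basis⁻¹))
              (Kᴸ.⊡-congʳ {B = basis⁻¹} (Kᴸ.≋-sym (rep-⋆ V₀ a b))))))))))

    -- The padded matrix can be regained from the 2 × 2 one, so realising loses no information and
    -- injectivity of `V₀` carries over.
    recover : ∀ a → (basis⁻¹ Kᴸ.⊡ realised a) Kᴸ.⊡ basis Kᴸ.≋ rep V₀ a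
    recover a = Kᴸ.≋-trans (Kᴸ.⊡-congʳ {B = basis} (Kᴸ.≋-trans (basis⁻¹⊡realised (rep V₀ a Kᴸ.⊡ basis⁻¹))
        (Kᴸ.≋-trans (Kᴸ.≋-sym (Kᴸ.⊡-assoc (rep V₀ zero) (rep V₀ a) basis⁻¹)) (Kᴸ.⊡-congʳ {B = basis⁻¹} u-a))))
      (Kᴸ.≋-trans (Kᴸ.⊡-assoc (rep V₀ a) basis⁻¹ basis) (Kᴸ.≋-trans
        (Kᴸ.⊡-congˡ {A = rep V₀ a} (Kᴸ.≋-trans basis⁻¹⊡basis (Kᴸ.≋-sym unit-V₀))) (rep-unit V₀ a)))
      where
      u-a : rep V₀ zero Kᴸ.⊡ rep V₀ a Kᴸ.≋ rep V₀ a
      u-a i j = ≡.trans (≡.sym (rep-⋆ V₀ zero a i j)) (≡.cong (λ x → rep V₀ x i j) (⋆-identityˡ a))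

    realised-injective : ∀ a b → realised a Kᴸ.≋ realised b → a ≡ b
    realised-injective a b p = rep-injective a b (Kᴸ.≋-trans (Kᴸ.≋-sym (recover a)) (Kᴸ.≋-trans
      (Kᴸ.⊡-congʳ {B = basis} (Kᴸ.⊡-congˡ {A = basis⁻¹} p)) (recover b)))

    matrix : G → Matrix 2 2
    matrix a = ιᴹ (realised a)

    matrix-⋆ : ∀ a b → matrix (a ⋆ b) ℂᴸ.≋ matrix a *ᴹ matrix b
    matrix-⋆ a b = ℂᴸ.≋-trans (λ i j → ℂᴸ.reflexive (≡.cong ι (realised-⋆ a b i j)))
      (ℂᴸ.≋-trans (ι-⊡ (realised a) (realised b)) (ℂᴸ.≋-sym (*ᴹ≋⊡ (matrix a) (matrix b))))

    matrix-zero : matrix zero ℂᴸ.≋ δ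
    matrix-zero i j = ℂᴸ.trans (ℂᴸ.reflexive (≡.cong ι (≡.trans (realise-cong unit-V₀ i j) (realise-unit i j)))) (ι-≐ i j)

    step-unit : ∀ s → rep V₀ (step s zero) Kᴸ.≋ ⟦ mul4 (unit4 2) (image (lookup irreps V₀) s) ⟧
    step-unit s i j = ≡.cong (λ A → ⟦ A ⟧ i j) (≡.trans (R-step V₀ s zero) (≡.cong (λ A → mul4 A (image (lookup irreps V₀) s)) (R-zero V₀)))

    matrix-T : matrix (step gT zero) ℂᴸ.≋ Unit.elt T
    matrix-T i j = ℂᴸ.trans (ℂᴸ.reflexive (≡.cong ι (≡.trans (realise-cong (step-unit gT) i j) (realise-T i j)))) (entries i j)
      where
      entries : ιᴹ (((½ +i ½) ▹ (½ +i ½) ▹ ◃) ▹ ((½ +i ½) ▹ ((ℚ.- ½) +i (ℚ.- ½)) ▹ ◃) ▹ ◃) ℂᴸ.≋ Unit.elt T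
      entries zero       zero       = pointwise⇒≈ℂ (λ _ → refl) (λ _ → refl)
      entries zero       (suc zero) = pointwise⇒≈ℂ (λ _ → refl) (λ _ → refl)
      entries (suc zero) zero       = pointwise⇒≈ℂ (λ _ → refl) (λ _ → refl)
      entries (suc zero) (suc zero) = pointwise⇒≈ℂ (λ _ → refl) (λ _ → refl)

    matrix-D : matrix (step gD zero) ℂᴸ.≋ Unit.elt D
    matrix-D i j = ℂᴸ.trans (ℂᴸ.reflexive (≡.cong ι (≡.trans (realise-cong (step-unit gD) i j) (realise-D i j)))) (entries i j)
      where
      entries : ιᴹ ((1ᵏ ▹ 0ᵏ ▹ ◃) ▹ (0ᵏ ▹ (0ℚ +i 1ℚ) ▹ ◃) ▹ ◃) ℂᴸ.≋ Unit.elt D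
      entries zero       zero       = pointwise⇒≈ℂ (λ _ → refl) (λ _ → refl)
      entries zero       (suc zero) = pointwise⇒≈ℂ (λ _ → refl) (λ _ → refl)
      entries (suc zero) zero       = pointwise⇒≈ℂ (λ _ → refl) (λ _ → refl)
      entries (suc zero) (suc zero) = pointwise⇒≈ℂ (λ _ → refl) (λ _ → refl)

    matrix-injective : ∀ a b → matrix a ℂᴸ.≋ matrix b → a ≡ b
    matrix-injective a b p = realised-injective a b λ i j → ι-injective (p i j)

  module _ where
    private
      module Γ = Group H₁
      module M₂ = Ring (matrixRing 2)

      el-gen : Gen → Γ.Carrier
      el-gen gT = T , gen (inj₁ M₂.refl)
      el-gen gD = D , gen (inj₂ M₂.refl)

      elt : Γ.Carrier → Matrix 2 2
      elt x = Unit.elt (proj₁ x)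

      matrix-gen : ∀ s → matrix (step s zero) ℂᴸ.≋ elt (el-gen s)
      matrix-gen gT = matrix-T
      matrix-gen gD = matrix-D

      product : List Gen → Γ.Carrier
      product []      = Γ.ε
      product (s ∷ w) = el-gen s Γ.∙ product w

      step-⋆ : ∀ s a → step s a ≡ a ⋆ step s zero
      step-⋆ s a = rep-injective _ _ λ i j → ≡.trans (rep-act V₀ (s ∷ []) a i j) (≡.sym (rep-⋆ V₀ a (step s zero) i j))

      matrix-word : ∀ w a → matrix (act w a) M₂.≈ matrix a *ᴹ elt (product w)
      matrix-word []      a = M₂.sym (M₂.*-identityʳ (matrix a))
      matrix-word (s ∷ w) a = M₂.trans (matrix-word w (step s a)) (M₂.trans
        (M₂.*-congʳ {elt (product w)} (M₂.trans (λ i j → ℂᴸ.reflexive (≡.cong (λ b → matrix b i j) (step-⋆ s a)))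
          (M₂.trans (matrix-⋆ a (step s zero)) (M₂.*-congˡ {matrix a} (matrix-gen s)))))
        (M₂.*-assoc (matrix a) (elt (el-gen s)) (elt (product w))))

      el : G → Γ.Carrier
      el a = product (word a)

      matrix-el : ∀ a → matrix a M₂.≈ elt (el a)
      matrix-el a = M₂.trans (λ i j → ℂᴸ.reflexive (≡.cong (λ b → matrix b i j) (≡.trans (≡.sym (⋆-identityˡ a)) (⋆-word zero a))))
        (M₂.trans (matrix-word (word a) zero) (M₂.trans (M₂.*-congʳ {elt (el a)} matrix-zero) (M₂.*-identityˡ (elt (el a)))))

      -- Defined by recursion on the derivation that x is generated; by `matrix-index` and
      -- `matrix-injective` the number depends on the matrix alone. With this recursion `ix` is a
      -- homomorphism by definition.
      index : ∀ {x} → Generated (GL 2) (λ x → Group._≈_ (GL 2) x T ⊎ Group._≈_ (GL 2) x D) x → G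
      index (gen (inj₁ _))    = step gT zero
      index (gen (inj₂ _))    = step gD zero
      index one               = zero
      index (mul p q)         = index p ⋆ index q
      index (Generated.inv p) = inv (index p)
      index (resp _ p)        = index p

      matrix-index : ∀ {x} (p : Generated (GL 2) _ x) → matrix (index p) M₂.≈ Unit.elt x
      matrix-index (gen (inj₁ x≈T)) = M₂.trans matrix-T (M₂.sym x≈T)
      matrix-index (gen (inj₂ x≈D)) = M₂.trans matrix-D (M₂.sym x≈D)
      matrix-index one              = matrix-zero
      matrix-index (mul p q)        = M₂.trans (matrix-⋆ (index p) (index q)) (M₂.*-cong (matrix-index p) (matrix-index q))
      -- The matrix of the inverse number is a left inverse of x, hence equal to the inverse that
      -- the unit x comes with.
      matrix-index (Generated.inv {x} p) = M₂.trans (M₂.sym (M₂.*-identityʳ (matrix a⁻¹))) (M₂.trans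
        (M₂.*-congˡ {matrix a⁻¹} (M₂.sym (Unit.inverseʳ x))) (M₂.trans
          (M₂.sym (M₂.*-assoc (matrix a⁻¹) (Unit.elt x) (Unit.elt⁻¹ x))) (M₂.trans
            (M₂.*-congʳ {Unit.elt⁻¹ x} inverse) (M₂.*-identityˡ (Unit.elt⁻¹ x)))))
        where
        a⁻¹ = inv (index p)
        inverse : matrix a⁻¹ *ᴹ Unit.elt x M₂.≈ δ
        inverse = M₂.trans (M₂.*-congˡ {matrix a⁻¹} (M₂.sym (matrix-index p))) (M₂.trans
          (M₂.sym (matrix-⋆ a⁻¹ (index p)))
          (M₂.trans (λ i j → ℂᴸ.reflexive (≡.cong (λ b → matrix b i j) (⋆-inverseˡ (index p)))) matrix-zero))
      matrix-index (resp x≈y p)     = M₂.trans (matrix-index p) x≈y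

      ix : Γ.Carrier → G
      ix (_ , p) = index p

      matrix-ix : ∀ x → matrix (ix x) M₂.≈ elt x
      matrix-ix (_ , p) = matrix-index p

    isomorphic : Isomorphic H₁
    isomorphic = record
      { el = el
      ; ix = ix
      ; el-ix = λ x → M₂.trans (M₂.sym (matrix-el (ix x))) (matrix-ix x)
      ; ix-el = λ a → matrix-injective _ _ (M₂.trans (matrix-ix (el a)) (M₂.sym (matrix-el a)))
      ; ix-cong = λ {x} {y} p → matrix-injective _ _ (M₂.trans (matrix-ix x) (M₂.trans p (M₂.sym (matrix-ix y))))
      ; ix-∙ = λ _ _ → refl
      ; ix-⁻¹ = λ _ → refl
      ; ix-ε = refl
      }

-- The dimension formulas and the four decompositions.

module TensorCentralizers where

  open import Data.Fin.Base using (splitAt)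
  open import Data.Integer.Base using (+_; -[1+_]; _⊖_)
  open import Data.Nat.Base using (_≤_)
  open import Data.Nat.DivMod using (_mod_)
  open import Data.Product.Base using (∃-syntax)
  open import Data.Rational.Base using (_+_; _-_; _*_; _/_)
  open import Data.Rational.Solver using (module +-*-Solver)
  open import Relation.Binary.PropositionalEquality using (refl; sym; trans; cong; cong₂; subst)
  open import Defs hiding (inv)
  open GaussianNumbers using (fromℤ; fromℤ-*; module Kᴸ)
  open Tables using (all; all-sound; does-sound; ∧-sound; _==_; points; fixed)
  open Model using (module CosetAction; CosetAction)
  open FixedPoints
  open Multiplicities
  open Centralizers
  open CosetActions
  open +-*-Solver using (Polynomial; solve; con; _:+_; _:*_; _:-_; _:=_)

  join-rel : ∀ {A B : Set} {P : A → B → Set} m {n} {f : Fin m → A} {g : Fin n → A} {f′ : Fin m → B} {g′ : Fin n → B} →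
             (∀ c → P (f c) (f′ c)) → (∀ c → P (g c) (g′ c)) → ∀ c → P (join m f g c) (join m f′ g′ c)
  join-rel {P = P} m {f = f} {g} {f′} {g′} p q c = at (splitAt m c)
    where
    at : ∀ s → P ([ f , g ]′ s) ([ f′ , g′ ]′ s)
    at (inj₁ c) = p c
    at (inj₂ c) = q c

  -- The order determines the kind of the stabiliser except for order 4, the case met by the last
  -- clause, where both K₈ and K₉ are possible.
  Kinds : ℕ → Fin 5 → Set
  Kinds 1 κ = κ ≡ zero
  Kinds 2 κ = κ ≡ suc zero
  Kinds 3 κ = κ ≡ suc (suc zero)
  Kinds _ κ = κ ≡ suc (suc (suc zero)) ⊎ κ ≡ suc (suc (suc (suc zero)))

  kinds : ∀ s → Kinds (period s) (kind s)
  kinds zero                                     = refl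
  kinds (suc zero)                               = refl
  kinds (suc (suc zero))                         = refl
  kinds (suc (suc (suc zero)))                   = inj₁ refl
  kinds (suc (suc (suc (suc zero))))             = inj₁ refl
  kinds (suc (suc (suc (suc (suc zero)))))       = inj₂ refl
  kinds (suc (suc (suc (suc (suc (suc zero)))))) = inj₂ refl

  fromℕ-suc : ∀ b k → fromℕ (b ℕ.^ suc k) ≡ fromℤ (+ b) * fromℕ (b ℕ.^ k)
  fromℕ-suc b k = trans (cong fromℤ (ℤₚ.pos-* b (b ℕ.^ k))) (fromℤ-* (+ b) (+ (b ℕ.^ k)))

  private
    -- The multiplicity as a linear form in x = bᵏ and y = wᵏ, for the ring solver; one factor b and
    -- one factor w are split off from the exponents k + 1.
    polynomial : ℕ → ℕ → ℕ → ℤ → Polynomial 2 → Polynomial 2 → Polynomial 2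
    polynomial b w d s x y = con (fromℤ (+ d)) :* con (+ 1 / 96) :*
      (con (fromℤ (+ b)) :* x :+ con (fromℤ (+ w)) :* y :* con (fromℤ s))

  multiplicity-suc : ∀ b w k d s → multiplicity b w k (d , s) ≡
    fromℤ (+ d) * (+ 1 / 96) * (fromℤ (+ b) * fromℕ (b ℕ.^ k) + fromℤ (+ w) * fromℕ (w ℕ.^ k) * fromℤ s)
  multiplicity-suc b w k d s =
    cong₂ (λ x y → fromℤ (+ d) * (+ 1 / 96) * (x + y * fromℤ s)) (fromℕ-suc b k) (fromℕ-suc w k)

  -- For tensor exponent 1 the exponent of 4 in the formulas is -1, so 4ᵏ is expressed through the
  -- rational power and not the other way round.
  pow-4 : ∀ k → fromℕ (4 ℕ.^ k) ≡ fromℤ (+ 4) * pow 4 (suc k ⊖ 2)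
  pow-4 zero    = refl
  pow-4 (suc k) = fromℕ-suc 4 k

  a₁ : ∀ k → multiplicity 96 0 k (1 , (+ 0)) ≡ pow 96 (suc k ⊖ 1)
  a₁ k = trans (multiplicity-suc 96 0 k 1 (+ 0))
    (solve 2 (λ x y → polynomial 96 0 1 (+ 0) x y := (x)) refl (fromℕ (96 ℕ.^ k)) (fromℕ (0 ℕ.^ k)))

  e₁ : ∀ k → multiplicity 96 0 k (2 , (+ 0)) ≡ pow 96 (+ suc k) ÷ 48
  e₁ k = trans (multiplicity-suc 96 0 k 2 (+ 0))
    (trans (solve 2 (λ x y → polynomial 96 0 2 (+ 0) x y := (con (fromℤ (+ 96)) :* x) :* con (+ 1 / 48)) refl (fromℕ (96 ℕ.^ k)) (fromℕ (0 ℕ.^ k)))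
    (cong (λ x → x ÷ 48) (sym (fromℕ-suc 96 k))))

  l₁ : ∀ k → multiplicity 96 0 k (3 , (+ 0)) ≡ pow 96 (+ suc k) ÷ 32
  l₁ k = trans (multiplicity-suc 96 0 k 3 (+ 0))
    (trans (solve 2 (λ x y → polynomial 96 0 3 (+ 0) x y := (con (fromℤ (+ 96)) :* x) :* con (+ 1 / 32)) refl (fromℕ (96 ℕ.^ k)) (fromℕ (0 ℕ.^ k)))
    (cong (λ x → x ÷ 32) (sym (fromℕ-suc 96 k))))

  p₁ : ∀ k → multiplicity 96 0 k (4 , (+ 0)) ≡ pow 96 (+ suc k) ÷ 24
  p₁ k = trans (multiplicity-suc 96 0 k 4 (+ 0))
    (trans (solve 2 (λ x y → polynomial 96 0 4 (+ 0) x y := (con (fromℤ (+ 96)) :* x) :* con (+ 1 / 24)) refl (fromℕ (96 ℕ.^ k)) (fromℕ (0 ℕ.^ k)))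
    (cong (λ x → x ÷ 24) (sym (fromℕ-suc 96 k))))

  a₃ : ∀ k → multiplicity 48 8 k (1 , (+ 6)) ≡ pow 48 (suc k ⊖ 1) ÷ 2 + pow 8 (suc k ⊖ 1) ÷ 2
  a₃ k = trans (multiplicity-suc 48 8 k 1 (+ 6))
    (solve 2 (λ x y → polynomial 48 8 1 (+ 6) x y := (x) :* con (+ 1 / 2) :+ (y) :* con (+ 1 / 2)) refl (fromℕ (48 ℕ.^ k)) (fromℕ (8 ℕ.^ k)))

  c₃ : ∀ k → multiplicity 48 8 k (1 , -[1+ 5 ]) ≡ pow 48 (suc k ⊖ 1) ÷ 2 - pow 8 (suc k ⊖ 1) ÷ 2
  c₃ k = trans (multiplicity-suc 48 8 k 1 -[1+ 5 ])
    (solve 2 (λ x y → polynomial 48 8 1 -[1+ 5 ] x y := (x) :* con (+ 1 / 2) :- (y) :* con (+ 1 / 2)) refl (fromℕ (48 ℕ.^ k)) (fromℕ (8 ℕ.^ k)))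

  e₃ : ∀ k → multiplicity 48 8 k (2 , (+ 6)) ≡ pow 48 (suc k ⊖ 1) + pow 8 (suc k ⊖ 1)
  e₃ k = trans (multiplicity-suc 48 8 k 2 (+ 6))
    (solve 2 (λ x y → polynomial 48 8 2 (+ 6) x y := (x) :+ (y)) refl (fromℕ (48 ℕ.^ k)) (fromℕ (8 ℕ.^ k)))

  f₃ : ∀ k → multiplicity 48 8 k (2 , -[1+ 5 ]) ≡ pow 48 (suc k ⊖ 1) - pow 8 (suc k ⊖ 1)
  f₃ k = trans (multiplicity-suc 48 8 k 2 -[1+ 5 ])
    (solve 2 (λ x y → polynomial 48 8 2 -[1+ 5 ] x y := (x) :- (y)) refl (fromℕ (48 ℕ.^ k)) (fromℕ (8 ℕ.^ k)))

  g₃ : ∀ k → multiplicity 48 8 k (2 , (+ 0)) ≡ pow 48 (suc k ⊖ 1)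
  g₃ k = trans (multiplicity-suc 48 8 k 2 (+ 0))
    (solve 2 (λ x y → polynomial 48 8 2 (+ 0) x y := (x)) refl (fromℕ (48 ℕ.^ k)) (fromℕ (8 ℕ.^ k)))

  l₃ : ∀ k → multiplicity 48 8 k (3 , -[1+ 1 ]) ≡ pow 48 (+ suc k) ÷ 32 - pow 8 (suc k ⊖ 1) ÷ 2
  l₃ k = trans (multiplicity-suc 48 8 k 3 -[1+ 1 ])
    (trans (solve 2 (λ x y → polynomial 48 8 3 -[1+ 1 ] x y := (con (fromℤ (+ 48)) :* x) :* con (+ 1 / 32) :- (y) :* con (+ 1 / 2)) refl (fromℕ (48 ℕ.^ k)) (fromℕ (8 ℕ.^ k)))
    (cong (λ x → x ÷ 32 - pow 8 (suc k ⊖ 1) ÷ 2) (sym (fromℕ-suc 48 k))))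

  n₃ : ∀ k → multiplicity 48 8 k (3 , (+ 2)) ≡ pow 48 (+ suc k) ÷ 32 + pow 8 (suc k ⊖ 1) ÷ 2
  n₃ k = trans (multiplicity-suc 48 8 k 3 (+ 2))
    (trans (solve 2 (λ x y → polynomial 48 8 3 (+ 2) x y := (con (fromℤ (+ 48)) :* x) :* con (+ 1 / 32) :+ (y) :* con (+ 1 / 2)) refl (fromℕ (48 ℕ.^ k)) (fromℕ (8 ℕ.^ k)))
    (cong (λ x → x ÷ 32 + pow 8 (suc k ⊖ 1) ÷ 2) (sym (fromℕ-suc 48 k))))

  p₃ : ∀ k → multiplicity 48 8 k (4 , (+ 0)) ≡ pow 48 (+ suc k) ÷ 24
  p₃ k = trans (multiplicity-suc 48 8 k 4 (+ 0))
    (trans (solve 2 (λ x y → polynomial 48 8 4 (+ 0) x y := (con (fromℤ (+ 48)) :* x) :* con (+ 1 / 24)) refl (fromℕ (48 ℕ.^ k)) (fromℕ (8 ℕ.^ k)))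
    (cong (λ x → x ÷ 24) (sym (fromℕ-suc 48 k))))

  a₄ : ∀ k → multiplicity 32 8 k (1 , (+ 8)) ≡ pow 32 (suc k ⊖ 1) ÷ 3 + pow 8 (+ suc k) ÷ 12
  a₄ k = trans (multiplicity-suc 32 8 k 1 (+ 8))
    (trans (solve 2 (λ x y → polynomial 32 8 1 (+ 8) x y := (x) :* con (+ 1 / 3) :+ (con (fromℤ (+ 8)) :* y) :* con (+ 1 / 12)) refl (fromℕ (32 ℕ.^ k)) (fromℕ (8 ℕ.^ k)))
    (cong (λ y → pow 32 (suc k ⊖ 1) ÷ 3 + y ÷ 12) (sym (fromℕ-suc 8 k))))

  e₄ : ∀ k → multiplicity 32 8 k (2 , -[1+ 3 ]) ≡ pow 32 (+ suc k) ÷ 48 - pow 8 (+ suc k) ÷ 12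
  e₄ k = trans (multiplicity-suc 32 8 k 2 -[1+ 3 ])
    (trans (solve 2 (λ x y → polynomial 32 8 2 -[1+ 3 ] x y := (con (fromℤ (+ 32)) :* x) :* con (+ 1 / 48) :- (con (fromℤ (+ 8)) :* y) :* con (+ 1 / 12)) refl (fromℕ (32 ℕ.^ k)) (fromℕ (8 ℕ.^ k)))
    (cong₂ (λ x y → x ÷ 48 - y ÷ 12) (sym (fromℕ-suc 32 k)) (sym (fromℕ-suc 8 k))))

  l₄ : ∀ k → multiplicity 32 8 k (3 , (+ 0)) ≡ pow 32 (suc k ⊖ 1)
  l₄ k = trans (multiplicity-suc 32 8 k 3 (+ 0))
    (solve 2 (λ x y → polynomial 32 8 3 (+ 0) x y := (x)) refl (fromℕ (32 ℕ.^ k)) (fromℕ (8 ℕ.^ k)))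

  p₄ : ∀ k → multiplicity 32 8 k (4 , (+ 2)) ≡ pow 32 (+ suc k) ÷ 24 + pow 8 (+ suc k) ÷ 12
  p₄ k = trans (multiplicity-suc 32 8 k 4 (+ 2))
    (trans (solve 2 (λ x y → polynomial 32 8 4 (+ 2) x y := (con (fromℤ (+ 32)) :* x) :* con (+ 1 / 24) :+ (con (fromℤ (+ 8)) :* y) :* con (+ 1 / 12)) refl (fromℕ (32 ℕ.^ k)) (fromℕ (8 ℕ.^ k)))
    (cong₂ (λ x y → x ÷ 24 + y ÷ 12) (sym (fromℕ-suc 32 k)) (sym (fromℕ-suc 8 k))))

  a₈ : ∀ k → multiplicity 24 4 k (1 , (+ 18)) ≡ pow 24 (suc k ⊖ 1) ÷ 4 + fromℕ 3 * pow 4 (suc k ⊖ 2)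
  a₈ k = trans (trans (multiplicity-suc 24 4 k 1 (+ 18)) (cong (λ y → fromℤ (+ 1) * (+ 1 / 96) * (fromℤ (+ 24) * fromℕ (24 ℕ.^ k) + fromℤ (+ 4) * y * fromℤ (+ 18))) (pow-4 k)))
    (solve 2 (λ x y → polynomial 24 4 1 (+ 18) x (con (fromℤ (+ 4)) :* y) := (x) :* con (+ 1 / 4) :+ (con (fromℤ (+ 3)) :* y)) refl (fromℕ (24 ℕ.^ k)) (pow 4 (suc k ⊖ 2)))

  b₈ : ∀ k → multiplicity 24 4 k (1 , -[1+ 5 ]) ≡ pow 24 (suc k ⊖ 1) ÷ 4 - pow 4 (suc k ⊖ 2)
  b₈ k = trans (trans (multiplicity-suc 24 4 k 1 -[1+ 5 ]) (cong (λ y → fromℤ (+ 1) * (+ 1 / 96) * (fromℤ (+ 24) * fromℕ (24 ℕ.^ k) + fromℤ (+ 4) * y * fromℤ -[1+ 5 ])) (pow-4 k)))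
    (solve 2 (λ x y → polynomial 24 4 1 -[1+ 5 ] x (con (fromℤ (+ 4)) :* y) := (x) :* con (+ 1 / 4) :- (y)) refl (fromℕ (24 ℕ.^ k)) (pow 4 (suc k ⊖ 2)))

  e₈ : ∀ k → multiplicity 24 4 k (2 , (+ 6)) ≡ pow 24 (suc k ⊖ 1) ÷ 2 + pow 4 (suc k ⊖ 1) ÷ 2
  e₈ k = trans (multiplicity-suc 24 4 k 2 (+ 6))
    (solve 2 (λ x y → polynomial 24 4 2 (+ 6) x y := (x) :* con (+ 1 / 2) :+ (y) :* con (+ 1 / 2)) refl (fromℕ (24 ℕ.^ k)) (fromℕ (4 ℕ.^ k)))

  f₈ : ∀ k → multiplicity 24 4 k (2 , -[1+ 5 ]) ≡ pow 24 (suc k ⊖ 1) ÷ 2 - pow 4 (suc k ⊖ 1) ÷ 2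
  f₈ k = trans (multiplicity-suc 24 4 k 2 -[1+ 5 ])
    (solve 2 (λ x y → polynomial 24 4 2 -[1+ 5 ] x y := (x) :* con (+ 1 / 2) :- (y) :* con (+ 1 / 2)) refl (fromℕ (24 ℕ.^ k)) (fromℕ (4 ℕ.^ k)))

  l₈ : ∀ k → multiplicity 24 4 k (3 , -[1+ 5 ]) ≡ pow 24 (+ suc k) ÷ 32 - fromℕ 3 * pow 4 (suc k ⊖ 2)
  l₈ k = trans (trans (multiplicity-suc 24 4 k 3 -[1+ 5 ]) (cong (λ y → fromℤ (+ 3) * (+ 1 / 96) * (fromℤ (+ 24) * fromℕ (24 ℕ.^ k) + fromℤ (+ 4) * y * fromℤ -[1+ 5 ])) (pow-4 k)))
    (trans (solve 2 (λ x y → polynomial 24 4 3 -[1+ 5 ] x (con (fromℤ (+ 4)) :* y) := (con (fromℤ (+ 24)) :* x) :* con (+ 1 / 32) :- (con (fromℤ (+ 3)) :* y)) refl (fromℕ (24 ℕ.^ k)) (pow 4 (suc k ⊖ 2)))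
    (cong (λ x → x ÷ 32 - fromℕ 3 * pow 4 (suc k ⊖ 2)) (sym (fromℕ-suc 24 k))))

  m₈ : ∀ k → multiplicity 24 4 k (3 , (+ 2)) ≡ pow 24 (+ suc k) ÷ 32 + pow 4 (suc k ⊖ 2)
  m₈ k = trans (trans (multiplicity-suc 24 4 k 3 (+ 2)) (cong (λ y → fromℤ (+ 3) * (+ 1 / 96) * (fromℤ (+ 24) * fromℕ (24 ℕ.^ k) + fromℤ (+ 4) * y * fromℤ (+ 2))) (pow-4 k)))
    (trans (solve 2 (λ x y → polynomial 24 4 3 (+ 2) x (con (fromℤ (+ 4)) :* y) := (con (fromℤ (+ 24)) :* x) :* con (+ 1 / 32) :+ (y)) refl (fromℕ (24 ℕ.^ k)) (pow 4 (suc k ⊖ 2)))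
    (cong (λ x → x ÷ 32 + pow 4 (suc k ⊖ 2)) (sym (fromℕ-suc 24 k))))

  p₈ : ∀ k → multiplicity 24 4 k (4 , (+ 0)) ≡ pow 24 (suc k ⊖ 1)
  p₈ k = trans (multiplicity-suc 24 4 k 4 (+ 0))
    (solve 2 (λ x y → polynomial 24 4 4 (+ 0) x y := (x)) refl (fromℕ (24 ℕ.^ k)) (fromℕ (4 ℕ.^ k)))

  private
    tabulated : Vec ℕ 16 → Fin 16 → Fin 16
    tabulated v c = lookup v c mod 16

    inverseAt : (π π⁻¹ : Fin 16 → Fin 16) → Fin 16 → Bool
    inverseAt π π⁻¹ c = (π (π⁻¹ c) == c) ∧ (π⁻¹ (π c) == c)

  -- The values are the degrees and the sums over the support of κ, in the order π.
  record Order (κ : Fin 5) (values : Fin 16 → ℕ × ℤ) : Set where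
    field
      π π⁻¹  : Fin 16 → Fin 16
      ππ⁻¹   : ∀ c → π (π⁻¹ c) ≡ c
      π⁻¹π   : ∀ c → π⁻¹ (π c) ≡ c
      values≡ : ∀ c → invariants κ (π c) ≡ values c

  private
    valueAt : Fin 5 → (Fin 16 → Fin 16) → (Fin 16 → ℕ × ℤ) → Fin 16 → Bool
    valueAt κ π values c = does (proj₁ (invariants κ (π c)) ℕₚ.≟ proj₁ (values c)) ∧ does (proj₂ (invariants κ (π c)) ℤₚ.≟ proj₂ (values c))

    toOrder : ∀ κ values π π⁻¹ → all (inverseAt π π⁻¹) ≡ true → all (valueAt κ π values) ≡ true → Order κ values
    toOrder κ values π π⁻¹ p q = record
      { π = π ; π⁻¹ = π⁻¹
      ; ππ⁻¹ = λ c → does-sound (_ ≟ _) (proj₁ (∧-sound (all-sound {p = inverseAt π π⁻¹} p c)))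
      ; π⁻¹π = λ c → does-sound (_ ≟ _) (proj₂ (∧-sound {π (π⁻¹ c) == c} (all-sound {p = inverseAt π π⁻¹} p c)))
      ; values≡ = λ c → let r = ∧-sound {does (proj₁ (invariants κ (π c)) ℕₚ.≟ proj₁ (values c))} (all-sound {p = valueAt κ π values} q c) in
          cong₂ _,_ (does-sound (_ ℕₚ.≟ _) (proj₁ r)) (does-sound (_ ℤₚ.≟ _) (proj₂ r)) }

  -- Blocks together with their sizes, built along the same nesting as the algebra in the theorem,
  -- so that the arithmetic for each block is supplied where the block occurs.
  record Part (P : ℕ → ℕ × ℤ → Set) (B : ℂ-Algebra) (n : ℕ) (values : Fin n → ℕ × ℤ) : Set where
    field
      {dims} : Fin n → ℕ
      blocks : Blocks B n dims
      sizes  : ∀ c → P (dims c) (values c)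

  infix  7 _⊠-part_
  infixr 5 _⊕-part_

  M-part : ∀ {P d v} → P d v → Part P (M d) 1 (λ _ → v)
  M-part {d = d} p = record { blocks = M-blocks d ; sizes = λ _ → p }

  _⊠-part_ : ∀ {P d v} n → P d v → Part P (n ⊠ M d) n (λ _ → v)
  _⊠-part_ {d = d} n p = record { blocks = ⊠-blocks n d ; sizes = λ _ → p }

  _⊕-part_ : ∀ {P A B m n v w} → Part P A m v → Part P B n w → Part P (A ⊕ B) (m ℕ.+ n) (join m v w)
  _⊕-part_ {P = P} {m = m} {v = v} {w} a b = record
    { blocks = Part.blocks a ⊕-blocks Part.blocks b
    ; sizes  = join-rel {P = P} m {f = Part.dims a} {Part.dims b} {v} {w} (Part.sizes a) (Part.sizes b) }

  -- A record in place of the bare equation, so that the relation and the pair v can be read off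
  -- from its type.
  record Size (b w k r : ℕ) (v : ℕ × ℤ) : Set where
    constructor size
    field
      formula : fromℕ r ≡ multiplicity b w k v

  open Size

  values₁ : Fin 16 → ℕ × ℤ
  values₁ = join 4 (λ _ → 1 , (+ 0)) (join 6 (λ _ → 2 , (+ 0)) (join 4 (λ _ → 3 , (+ 0)) ((λ _ → 4 , (+ 0)))))

  values₃ : Fin 16 → ℕ × ℤ
  values₃ = join 2 (λ _ → 1 , (+ 6)) (join 2 (λ _ → 1 , -[1+ 5 ]) (join 1 (λ _ → 2 , (+ 6)) (join 1 (λ _ → 2 , -[1+ 5 ]) (join 4 (λ _ → 2 , (+ 0)) (join 2 (λ _ → 3 , -[1+ 1 ]) (join 2 (λ _ → 3 , (+ 2)) ((λ _ → 4 , (+ 0)))))))))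

  values₄ : Fin 16 → ℕ × ℤ
  values₄ = join 4 (λ _ → 1 , (+ 8)) (join 6 (λ _ → 2 , -[1+ 3 ]) (join 4 (λ _ → 3 , (+ 0)) ((λ _ → 4 , (+ 2)))))

  -- One list serves both subgroups of order 4: their sums differ by a permutation of the four
  -- twists of V. Degree 2 with sum 6 occurs in two groups because the theorem lists e in two
  -- places.
  values₈ : Fin 16 → ℕ × ℤ
  values₈ = join 1 (λ _ → 1 , (+ 18)) (join 3 (λ _ → 1 , -[1+ 5 ]) (join 1 (λ _ → 2 , (+ 6)) (join 3 (λ _ → 2 , -[1+ 5 ]) (join 2 (λ _ → 2 , (+ 6)) (join 1 (λ _ → 3 , -[1+ 5 ]) (join 3 (λ _ → 3 , (+ 2)) ((λ _ → 4 , (+ 0)))))))))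

  opaque
    unfolding all

    order₁ : Order zero values₁
    order₁ = toOrder _ _
      (tabulated (0 ∷ 1 ∷ 2 ∷ 3 ∷ 4 ∷ 5 ∷ 6 ∷ 7 ∷ 8 ∷ 9 ∷ 10 ∷ 11 ∷ 12 ∷ 13 ∷ 14 ∷ 15 ∷ []))
      (tabulated (0 ∷ 1 ∷ 2 ∷ 3 ∷ 4 ∷ 5 ∷ 6 ∷ 7 ∷ 8 ∷ 9 ∷ 10 ∷ 11 ∷ 12 ∷ 13 ∷ 14 ∷ 15 ∷ []))
      refl refl

    order₃ : Order (suc zero) values₃
    order₃ = toOrder _ _
      (tabulated (0 ∷ 2 ∷ 1 ∷ 3 ∷ 8 ∷ 9 ∷ 4 ∷ 5 ∷ 6 ∷ 7 ∷ 10 ∷ 12 ∷ 11 ∷ 13 ∷ 14 ∷ 15 ∷ []))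
      (tabulated (0 ∷ 2 ∷ 1 ∷ 3 ∷ 6 ∷ 7 ∷ 8 ∷ 9 ∷ 4 ∷ 5 ∷ 10 ∷ 12 ∷ 11 ∷ 13 ∷ 14 ∷ 15 ∷ []))
      refl refl

    order₄ : Order (suc (suc zero)) values₄
    order₄ = toOrder _ _
      (tabulated (0 ∷ 1 ∷ 2 ∷ 3 ∷ 4 ∷ 5 ∷ 6 ∷ 7 ∷ 8 ∷ 9 ∷ 10 ∷ 11 ∷ 12 ∷ 13 ∷ 14 ∷ 15 ∷ []))
      (tabulated (0 ∷ 1 ∷ 2 ∷ 3 ∷ 4 ∷ 5 ∷ 6 ∷ 7 ∷ 8 ∷ 9 ∷ 10 ∷ 11 ∷ 12 ∷ 13 ∷ 14 ∷ 15 ∷ []))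
      refl refl

    order₈ : Order (suc (suc (suc zero))) values₈
    order₈ = toOrder _ _
      (tabulated (0 ∷ 1 ∷ 2 ∷ 3 ∷ 4 ∷ 5 ∷ 6 ∷ 9 ∷ 7 ∷ 8 ∷ 10 ∷ 11 ∷ 12 ∷ 13 ∷ 14 ∷ 15 ∷ []))
      (tabulated (0 ∷ 1 ∷ 2 ∷ 3 ∷ 4 ∷ 5 ∷ 6 ∷ 8 ∷ 9 ∷ 7 ∷ 10 ∷ 11 ∷ 12 ∷ 13 ∷ 14 ∷ 15 ∷ []))
      refl refl

    order₉ : Order (suc (suc (suc (suc zero)))) values₈
    order₉ = toOrder _ _
      (tabulated (0 ∷ 1 ∷ 2 ∷ 3 ∷ 5 ∷ 4 ∷ 7 ∷ 9 ∷ 6 ∷ 8 ∷ 10 ∷ 11 ∷ 12 ∷ 13 ∷ 14 ∷ 15 ∷ []))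
      (tabulated (0 ∷ 1 ∷ 2 ∷ 3 ∷ 5 ∷ 4 ∷ 8 ∷ 6 ∷ 9 ∷ 7 ∷ 10 ∷ 11 ∷ 12 ∷ 13 ∷ 14 ∷ 15 ∷ []))
      refl refl

  module Result {Γ : Group 0ℓ 0ℓ} (iso : Isomorphic Γ) (K : Subgroup Γ) {N : ℕ} (cosets : CosetEnumeration Γ K N) where

    𝔄 : ℕ → ℂ-Algebra
    𝔄 k = tensorCentralizer Γ K cosets (suc k)

    -- The field `sized` gives a natural number for the formula at each position; `isomorphism`
    -- accepts any algebra whose blocks have sizes obeying the formulas.
    record Decomposable (b w k : ℕ) (values : Fin 16 → ℕ × ℤ) : Set₁ where
      field
        sized       : ∀ c → ∃ λ r → Size b w k r (values c)
        isomorphism : ∀ {B} → Part (Size b w k) B 16 values → 𝔄 k ≃ B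

    module _ {m : ℕ} (hasOrder : HasOrder Γ K m) (faithful : Faithful Γ K) where
      open Action iso K cosets hasOrder faithful

      Fixed : Fin 5 → Set
      Fixed κ = ∀ a → CosetAction.fixedPoints action a ≡ Kᴸ.fromℕ (θ κ a)

      fixed-θ : m ≤ 4 → ∃ λ κ → Kinds m κ × Fixed κ
      fixed-θ m≤4 =
        let s , o≡m , x , y∈ = Stabilisers.generates action noCentral m≤4
        in kind s , subst (λ o → Kinds o (kind s)) o≡m (kinds s) ,
           Stabilisers.fixedPoints-θ action noCentral s x o≡m y∈

      decomposable : ∀ {κ} → Fixed κ → ∀ k {values} → Order κ values →
                     Decomposable (points κ) (fixed κ) k values
      decomposable {κ} fixed≡θ k {values} order = record
        { sized = λ c → let r , p = ranks κ fixed≡θ k π π⁻¹ ππ⁻¹ π⁻¹π c in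
            r , size (trans p (cong (multiplicity b w k) (values≡ c)))
        ; isomorphism = λ {B} part → tensorCentralizer≃ κ fixed≡θ k π π⁻¹ ππ⁻¹ π⁻¹π {B} (Part.blocks part)
            (λ c → trans (formula (Part.sizes part c)) (cong (multiplicity b w k) (sym (values≡ c)))) }
        where
        open Order order
        b = points κ
        w = fixed κ

    Claim₁ : ℕ → Set
    Claim₁ k =
      ∃[ a ] ∃[ e ] ∃[ l ] ∃[ p ]
      fromℕ a ≡ pow 96 (suc k ⊖ 1) ×
      fromℕ e ≡ pow 96 (+ suc k) ÷ 48 ×
      fromℕ l ≡ pow 96 (+ suc k) ÷ 32 ×
      fromℕ p ≡ pow 96 (+ suc k) ÷ 24 ×
      𝔄 k ≃ 4 ⊠ M a ⊕ 6 ⊠ M e ⊕ 4 ⊠ M l ⊕ 2 ⊠ M p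

    result₁ : ∀ k → Decomposable 96 0 k values₁ → Claim₁ k
    result₁ k D =
      let open Decomposable D
          -- The positions 0, 4, 10 and 14 are the first ones of the four groups of equal blocks.
          a , a≡ = sized (0 mod 16)
          e , e≡ = sized (4 mod 16)
          l , l≡ = sized (10 mod 16)
          p , p≡ = sized (14 mod 16)
      in a , e , l , p ,
         trans (formula a≡) (a₁ k) , trans (formula e≡) (e₁ k) , trans (formula l≡) (l₁ k) , trans (formula p≡) (p₁ k) ,
         isomorphism (4 ⊠-part a≡ ⊕-part 6 ⊠-part e≡ ⊕-part 4 ⊠-part l≡ ⊕-part 2 ⊠-part p≡)

    Claim₃ : ℕ → Set
    Claim₃ k =
      ∃[ a ] ∃[ c ] ∃[ e ] ∃[ f ] ∃[ g ] ∃[ l ] ∃[ n ] ∃[ p ]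
      fromℕ a ≡ pow 48 (suc k ⊖ 1) ÷ 2 + pow 8 (suc k ⊖ 1) ÷ 2 ×
      fromℕ c ≡ pow 48 (suc k ⊖ 1) ÷ 2 - pow 8 (suc k ⊖ 1) ÷ 2 ×
      fromℕ e ≡ pow 48 (suc k ⊖ 1) + pow 8 (suc k ⊖ 1) ×
      fromℕ f ≡ pow 48 (suc k ⊖ 1) - pow 8 (suc k ⊖ 1) ×
      fromℕ g ≡ pow 48 (suc k ⊖ 1) ×
      fromℕ l ≡ pow 48 (+ suc k) ÷ 32 - pow 8 (suc k ⊖ 1) ÷ 2 ×
      fromℕ n ≡ pow 48 (+ suc k) ÷ 32 + pow 8 (suc k ⊖ 1) ÷ 2 ×
      fromℕ p ≡ pow 48 (+ suc k) ÷ 24 ×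
      𝔄 k ≃ 2 ⊠ M a ⊕ 2 ⊠ M c ⊕ M e ⊕ M f ⊕ 4 ⊠ M g ⊕ 2 ⊠ M l ⊕ 2 ⊠ M n ⊕ 2 ⊠ M p

    result₃ : ∀ k → Decomposable 48 8 k values₃ → Claim₃ k
    result₃ k D =
      let open Decomposable D
          -- Again one position from each of the eight groups of equal blocks.
          a , a≡ = sized (0 mod 16)
          c , c≡ = sized (2 mod 16)
          e , e≡ = sized (4 mod 16)
          f , f≡ = sized (5 mod 16)
          g , g≡ = sized (6 mod 16)
          l , l≡ = sized (10 mod 16)
          n , n≡ = sized (12 mod 16)
          p , p≡ = sized (14 mod 16)
      in a , c , e , f , g , l , n , p ,
         trans (formula a≡) (a₃ k) , trans (formula c≡) (c₃ k) , trans (formula e≡) (e₃ k) , trans (formula f≡) (f₃ k) , trans (formula g≡) (g₃ k) , trans (formula l≡) (l₃ k) , trans (formula n≡) (n₃ k) , trans (formula p≡) (p₃ k) ,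
         isomorphism (2 ⊠-part a≡ ⊕-part 2 ⊠-part c≡ ⊕-part M-part e≡ ⊕-part M-part f≡ ⊕-part 4 ⊠-part g≡ ⊕-part 2 ⊠-part l≡ ⊕-part 2 ⊠-part n≡ ⊕-part 2 ⊠-part p≡)

    Claim₄ : ℕ → Set
    Claim₄ k =
      ∃[ a ] ∃[ e ] ∃[ l ] ∃[ p ]
      fromℕ a ≡ pow 32 (suc k ⊖ 1) ÷ 3 + pow 8 (+ suc k) ÷ 12 ×
      fromℕ e ≡ pow 32 (+ suc k) ÷ 48 - pow 8 (+ suc k) ÷ 12 ×
      fromℕ l ≡ pow 32 (suc k ⊖ 1) ×
      fromℕ p ≡ pow 32 (+ suc k) ÷ 24 + pow 8 (+ suc k) ÷ 12 ×
      𝔄 k ≃ 4 ⊠ M a ⊕ 6 ⊠ M e ⊕ 4 ⊠ M l ⊕ 2 ⊠ M p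

    result₄ : ∀ k → Decomposable 32 8 k values₄ → Claim₄ k
    result₄ k D =
      let open Decomposable D
          a , a≡ = sized (0 mod 16)
          e , e≡ = sized (4 mod 16)
          l , l≡ = sized (10 mod 16)
          p , p≡ = sized (14 mod 16)
      in a , e , l , p ,
         trans (formula a≡) (a₄ k) , trans (formula e≡) (e₄ k) , trans (formula l≡) (l₄ k) , trans (formula p≡) (p₄ k) ,
         isomorphism (4 ⊠-part a≡ ⊕-part 6 ⊠-part e≡ ⊕-part 4 ⊠-part l≡ ⊕-part 2 ⊠-part p≡)

    Claim₈ : ℕ → Set
    Claim₈ k =
      ∃[ a ] ∃[ b ] ∃[ e ] ∃[ f ] ∃[ l ] ∃[ m ] ∃[ p ]
      fromℕ a ≡ pow 24 (suc k ⊖ 1) ÷ 4 + fromℕ 3 * pow 4 (suc k ⊖ 2) ×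
      fromℕ b ≡ pow 24 (suc k ⊖ 1) ÷ 4 - pow 4 (suc k ⊖ 2) ×
      fromℕ e ≡ pow 24 (suc k ⊖ 1) ÷ 2 + pow 4 (suc k ⊖ 1) ÷ 2 ×
      fromℕ f ≡ pow 24 (suc k ⊖ 1) ÷ 2 - pow 4 (suc k ⊖ 1) ÷ 2 ×
      fromℕ l ≡ pow 24 (+ suc k) ÷ 32 - fromℕ 3 * pow 4 (suc k ⊖ 2) ×
      fromℕ m ≡ pow 24 (+ suc k) ÷ 32 + pow 4 (suc k ⊖ 2) ×
      fromℕ p ≡ pow 24 (suc k ⊖ 1) ×
      𝔄 k ≃ M a ⊕ 3 ⊠ M b ⊕ M e ⊕ 3 ⊠ M f ⊕ 2 ⊠ M e ⊕ M l ⊕ 3 ⊠ M m ⊕ 2 ⊠ M p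

    result₈ : ∀ k → Decomposable 24 4 k values₈ → Claim₈ k
    result₈ k D =
      let open Decomposable D
          a , a≡ = sized (0 mod 16)
          b , b≡ = sized (1 mod 16)
          e , e≡ = sized (4 mod 16)
          f , f≡ = sized (5 mod 16)
          l , l≡ = sized (10 mod 16)
          m , m≡ = sized (11 mod 16)
          p , p≡ = sized (14 mod 16)
      in a , b , e , f , l , m , p ,
         trans (formula a≡) (a₈ k) , trans (formula b≡) (b₈ k) , trans (formula e≡) (e₈ k) , trans (formula f≡) (f₈ k) , trans (formula l≡) (l₈ k) , trans (formula m≡) (m₈ k) , trans (formula p≡) (p₈ k) ,
         isomorphism (M-part a≡ ⊕-part 3 ⊠-part b≡ ⊕-part M-part e≡ ⊕-part 3 ⊠-part f≡ ⊕-part 2 ⊠-part e≡ ⊕-part M-part l≡ ⊕-part 3 ⊠-part m≡ ⊕-part 2 ⊠-part p≡)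

    claim₁ : HasOrder Γ K 1 → Faithful Γ K → ∀ k → Claim₁ k
    claim₁ hasOrder faithful k = at (fixed-θ hasOrder faithful (ℕₚ.≤ᵇ⇒≤ 1 4 _))
      where
      at : (∃ λ κ → Kinds 1 κ × Fixed hasOrder faithful κ) → Claim₁ k
      at (_ , refl , f) = result₁ k (decomposable hasOrder faithful f k order₁)

    claim₃ : HasOrder Γ K 2 → Faithful Γ K → ∀ k → Claim₃ k
    claim₃ hasOrder faithful k = at (fixed-θ hasOrder faithful (ℕₚ.≤ᵇ⇒≤ 2 4 _))
      where
      at : (∃ λ κ → Kinds 2 κ × Fixed hasOrder faithful κ) → Claim₃ k
      at (_ , refl , f) = result₃ k (decomposable hasOrder faithful f k order₃)

    claim₄ : HasOrder Γ K 3 → Faithful Γ K → ∀ k → Claim₄ k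
    claim₄ hasOrder faithful k = at (fixed-θ hasOrder faithful (ℕₚ.≤ᵇ⇒≤ 3 4 _))
      where
      at : (∃ λ κ → Kinds 3 κ × Fixed hasOrder faithful κ) → Claim₄ k
      at (_ , refl , f) = result₄ k (decomposable hasOrder faithful f k order₄)

    claim₈ : HasOrder Γ K 4 → Faithful Γ K → ∀ k → Claim₈ k
    claim₈ hasOrder faithful k = at (fixed-θ hasOrder faithful (ℕₚ.≤ᵇ⇒≤ 4 4 _))
      where
      at : (∃ λ κ → Kinds 4 κ × Fixed hasOrder faithful κ) → Claim₈ k
      at (_ , inj₁ refl , f) = result₈ k (decomposable hasOrder faithful f k order₈)
      at (_ , inj₂ refl , f) = result₈ k (decomposable hasOrder faithful f k order₉)

open import Defs
open import Data.Integer.Base using (+_; _⊖_)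
open import Data.Nat.Base using (ℕ; _≤_; zero; suc)
open import Data.Product.Base using (_×_; _,_; ∃-syntax)
open import Data.Rational.Base using (_+_; _-_; _*_)
open import Data.Sum.Base using (_⊎_; inj₁; inj₂)
open import Relation.Binary.PropositionalEquality using (_≡_; refl)
open TensorCentralizers
open ReflectionGroup

theorem3 : (R : FaithfulRepresentatives H₁) →
    let open FaithfulRepresentatives R using (K) in
    (n : Index → ℕ) (cosets : ∀ i → CosetEnumeration H₁ (K i) (n i)) →
    let 𝔄 = λ i k → tensorCentralizer H₁ (K i) (cosets i) k in
    ∀ k → 1 ≤ k →
    (∃[ a ] ∃[ e ] ∃[ l ] ∃[ p ]
    fromℕ a ≡ pow 96 (k ⊖ 1) ×
    fromℕ e ≡ pow 96 (+ k) ÷ 48 ×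
    fromℕ l ≡ pow 96 (+ k) ÷ 32 ×
    fromℕ p ≡ pow 96 (+ k) ÷ 24 ×
    𝔄 #1 k ≃ 4 ⊠ M a ⊕ 6 ⊠ M e ⊕ 4 ⊠ M l ⊕ 2 ⊠ M p)
    ×
    (∃[ a ] ∃[ c ] ∃[ e ] ∃[ f ] ∃[ g ] ∃[ l ] ∃[ n ] ∃[ p ]
    fromℕ a ≡ pow 48 (k ⊖ 1) ÷ 2 + pow 8 (k ⊖ 1) ÷ 2 ×
    fromℕ c ≡ pow 48 (k ⊖ 1) ÷ 2 - pow 8 (k ⊖ 1) ÷ 2 ×
    fromℕ e ≡ pow 48 (k ⊖ 1) + pow 8 (k ⊖ 1) ×
    fromℕ f ≡ pow 48 (k ⊖ 1) - pow 8 (k ⊖ 1) ×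
    fromℕ g ≡ pow 48 (k ⊖ 1) ×
    fromℕ l ≡ pow 48 (+ k) ÷ 32 - pow 8 (k ⊖ 1) ÷ 2 ×
    fromℕ n ≡ pow 48 (+ k) ÷ 32 + pow 8 (k ⊖ 1) ÷ 2 ×
    fromℕ p ≡ pow 48 (+ k) ÷ 24 ×
    𝔄 #3 k ≃ 2 ⊠ M a ⊕ 2 ⊠ M c ⊕ M e ⊕ M f ⊕ 4 ⊠ M g ⊕ 2 ⊠ M l ⊕ 2 ⊠ M n ⊕ 2 ⊠ M p)
    ×
    (∃[ a ] ∃[ e ] ∃[ l ] ∃[ p ]
    fromℕ a ≡ pow 32 (k ⊖ 1) ÷ 3 + pow 8 (+ k) ÷ 12 ×
    fromℕ e ≡ pow 32 (+ k) ÷ 48 - pow 8 (+ k) ÷ 12 ×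
    fromℕ l ≡ pow 32 (k ⊖ 1) ×
    fromℕ p ≡ pow 32 (+ k) ÷ 24 + pow 8 (+ k) ÷ 12 ×
    𝔄 #4 k ≃ 4 ⊠ M a ⊕ 6 ⊠ M e ⊕ 4 ⊠ M l ⊕ 2 ⊠ M p)
    ×
    (∀ i → i ≡ #8 ⊎ i ≡ #9 →
    ∃[ a ] ∃[ b ] ∃[ e ] ∃[ f ] ∃[ l ] ∃[ m ] ∃[ p ]
    fromℕ a ≡ pow 24 (k ⊖ 1) ÷ 4 + fromℕ 3 * pow 4 (k ⊖ 2) ×
    fromℕ b ≡ pow 24 (k ⊖ 1) ÷ 4 - pow 4 (k ⊖ 2) ×
    fromℕ e ≡ pow 24 (k ⊖ 1) ÷ 2 + pow 4 (k ⊖ 1) ÷ 2 ×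
    fromℕ f ≡ pow 24 (k ⊖ 1) ÷ 2 - pow 4 (k ⊖ 1) ÷ 2 ×
    fromℕ l ≡ pow 24 (+ k) ÷ 32 - fromℕ 3 * pow 4 (k ⊖ 2) ×
    fromℕ m ≡ pow 24 (+ k) ÷ 32 + pow 4 (k ⊖ 2) ×
    fromℕ p ≡ pow 24 (k ⊖ 1) ×
    𝔄 i k ≃ M a ⊕ 3 ⊠ M b ⊕ M e ⊕ 3 ⊠ M f ⊕ 2 ⊠ M e ⊕ M l ⊕ 3 ⊠ M m ⊕ 2 ⊠ M p)
theorem3 R n cosets (suc k) _ =
  Result.claim₁ isomorphic (K #1) (cosets #1) (hasOrder #1) (faithful #1) k ,
  Result.claim₃ isomorphic (K #3) (cosets #3) (hasOrder #3) (faithful #3) k ,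
  Result.claim₄ isomorphic (K #4) (cosets #4) (hasOrder #4) (faithful #4) k ,
  λ { .#8 (inj₁ refl) → Result.claim₈ isomorphic (K #8) (cosets #8) (hasOrder #8) (faithful #8) k
    ; .#9 (inj₂ refl) → Result.claim₈ isomorphic (K #9) (cosets #9) (hasOrder #9) (faithful #9) k }
  where open FaithfulRepresentatives R
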